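{- The Cycle plus Triangles problem is polynomial-time reducible to the restriction of the Unfair Independent Set in Cycle problem to instances that consist of $k$ sets of size $3$ that form a partition of $[n]$ where $n=3k$.
   Context: Write $[n]=\{1,\ldots,n\}$. A subset of $[n]$ is stable if it contains no two consecutive elements and does not contain both $1$ and $n$ (i.e., it is independent in the cycle on $[n]$). Cycle plus Triangles problem: the input consists of an integer $k$ and a graph $G$ on $3k$ vertices whose edge set is the disjoint union of (the edge sets of) a Hamilton cycle and $k$ pairwise vertex-disjoint triangles; only the graph $G$ is given, not the decomposition. The goal is to find an independent set of size $k$ in $G$. Unfair Independent Set in Cycle problem: the input consists of integers $n$ and $k$ with $n\ge 2k$ and $\ell$ subsets $V_1,\ldots,V_\ell$ of $[n]$, where $\ell\le n-2k+1$ and $|V_i|\ge 2$ for all $i\in[\ell]$. The goal is to find a stable $k$-subset $S$ of $[n]$ such that $|S\cap V_i|\le |V_i|/2$ for all $i\in[\ell]$. A search problem $P$ is polynomial-time reducible to a search problem $Q$ if there are polynomial-time computable maps, one taking each instance of $P$ to an instance of $Q$, and one taking each instance of $P$ together with any solution of the corresponding $Q$-instance to a solution of the $P$-instance. -}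

module Defs where

open import Data.Bool using (Bool; true; false)
open import Data.Fin using (Fin; toℕ)
open import Data.Fin.Permutation using (Permutation′; _⟨$⟩ʳ_)
open import Data.Fin.Subset using (Subset; _∈_; _∩_; ∣_∣)
open import Data.Nat using (ℕ; zero; suc; _+_; _*_; _∸_; _^_; _≤_)
open import Data.Product using (Σ; Σ-syntax; ∃-syntax; _×_; _,_; proj₁; proj₂)
open import Data.Sum using (_⊎_)
open import Data.Vec using (Vec; []; _∷_; lookup; tabulate)
open import Function.Bundles using (_⇔_)
open import Relation.Binary.PropositionalEquality using (_≡_; _≢_)
open import Relation.Nullary using (¬_)

------------------------------------------------------------------------
-- Polynomial-time computation
--
-- The machine model is the usual one of WHILE programs on binary trees
-- (Jones, "Computability and Complexity from a Programming Perspective"),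
-- in the form where the whole store is a single tree.

data Tree : Set where
  nil  : Tree
  cons : Tree → Tree → Tree

size : Tree → ℕ
size nil        = 1
size (cons l r) = 1 + (size l + size r)

data Program : Set where
  skip nil hd tl : Program
  pair           : Program → Program → Program
  _⨾_            : Program → Program → Program
  if_then_else_  : Program → Program → Program → Program
  while_loop_    : Program → Program → Program

infixr 5 _⨾_

-- p ⊢ x ⇓ y [ t ] : program p, started on x, halts with result y after
-- time t.  In tests, nil is false and every other tree is true.
--
-- An atomic instruction is charged the size of the tree it is applied to
-- rather than a constant.  Hence t bounds the size of every tree built on
-- the way (repeated `pair skip skip` doubles the store, and pays for it),
-- so that these programs and Turing machines simulate each other with
-- polynomial overhead, also when computing functions.
infix 4 _⊢_⇓_[_]

data _⊢_⇓_[_] : Program → Tree → Tree → ℕ → Set where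
  ⇓-skip  : ∀ {x} → skip ⊢ x ⇓ x [ size x ]
  ⇓-nil   : ∀ {x} → nil ⊢ x ⇓ nil [ size x ]
  ⇓-hd    : ∀ {l r} → hd ⊢ cons l r ⇓ l [ size (cons l r) ]
  ⇓-hdnil : hd ⊢ nil ⇓ nil [ size nil ]
  ⇓-tl    : ∀ {l r} → tl ⊢ cons l r ⇓ r [ size (cons l r) ]
  ⇓-tlnil : tl ⊢ nil ⇓ nil [ size nil ]
  ⇓-pair  : ∀ {p q x y z s t} →
            p ⊢ x ⇓ y [ s ] → q ⊢ x ⇓ z [ t ] →
            pair p q ⊢ x ⇓ cons y z [ 1 + (s + t) ]
  ⇓-seq   : ∀ {p q x y z s t} →
            p ⊢ x ⇓ y [ s ] → q ⊢ y ⇓ z [ t ] →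
            p ⨾ q ⊢ x ⇓ z [ 1 + (s + t) ]
  ⇓-then  : ∀ {c p q x l r y s t} →
            c ⊢ x ⇓ cons l r [ s ] → p ⊢ x ⇓ y [ t ] →
            if c then p else q ⊢ x ⇓ y [ 1 + (s + t) ]
  ⇓-else  : ∀ {c p q x y s t} →
            c ⊢ x ⇓ nil [ s ] → q ⊢ x ⇓ y [ t ] →
            if c then p else q ⊢ x ⇓ y [ 1 + (s + t) ]
  ⇓-stop  : ∀ {c p x s} →
            c ⊢ x ⇓ nil [ s ] →
            while c loop p ⊢ x ⇓ x [ 1 + s ]
  ⇓-loop  : ∀ {c p x l r y z s t u} →
            c ⊢ x ⇓ cons l r [ s ] → p ⊢ x ⇓ y [ t ] →
            while c loop p ⊢ y ⇓ z [ u ] →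
            while c loop p ⊢ x ⇓ z [ 1 + (s + t + u) ]

-- One program computes, for every a, the encoded output from the encoded
-- input, in time polynomial in the size of the encoded input.  (Sizes are
-- at least 1, so every polynomial is dominated by some c · sizeᵈ.)
PolyTime : {A : Set} (input output : A → Tree) → Set
PolyTime {A} input output =
  Σ[ p ∈ Program ] Σ[ c ∈ ℕ ] Σ[ d ∈ ℕ ] ((a : A) →
    Σ[ t ∈ ℕ ] (p ⊢ input a ⇓ output a [ t ] × t ≤ c * size (input a) ^ d))

------------------------------------------------------------------------
-- Search problems and reductions

-- Instances and solutions carry the proofs of their defining properties;
-- programs only ever see the encodings, which leave those proofs out.
record SearchProblem : Set₁ where
  field
    Instance       : Set
    Solution       : Instance → Set
    encodeInstance : Instance → Tree
    encodeSolution : {x : Instance} → Solution x → Tree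

open SearchProblem

restrict : (P : SearchProblem) → (Instance P → Set) → SearchProblem
restrict P R = record
  { Instance       = Σ (Instance P) R
  ; Solution       = λ x → Solution P (proj₁ x)
  ; encodeInstance = λ x → encodeInstance P (proj₁ x)
  ; encodeSolution = encodeSolution P
  }

record PolyTimeReducible (P Q : SearchProblem) : Set where
  field
    mapInstance     : Instance P → Instance Q
    mapSolution     : (x : Instance P) → Solution Q (mapInstance x) → Solution P x
    mapInstancePoly : PolyTime (encodeInstance P)
                               (λ x → encodeInstance Q (mapInstance x))
    mapSolutionPoly : PolyTime {Σ[ x ∈ Instance P ] Solution Q (mapInstance x)}
                               (λ (x , s) → cons (encodeInstance P x) (encodeSolution Q s))
                               (λ (x , s) → encodeSolution P (mapSolution x s))

------------------------------------------------------------------------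
-- Encodings
--
-- Numbers are written in unary.  In the two problems of the reduction this
-- agrees with binary up to a polynomial: the adjacency matrix, and sets
-- covering [n] with n = 3k, are at least as large as the numbers.

encodeℕ : ℕ → Tree
encodeℕ zero    = nil
encodeℕ (suc n) = cons nil (encodeℕ n)

encodeBool : Bool → Tree
encodeBool false = nil
encodeBool true  = cons nil nil

encodeVec : {A : Set} {n : ℕ} → (A → Tree) → Vec A n → Tree
encodeVec e []       = nil
encodeVec e (x ∷ xs) = cons (e x) (encodeVec e xs)

encodeSubset : {n : ℕ} → Subset n → Tree
encodeSubset = encodeVec encodeBool

------------------------------------------------------------------------
-- The cycle on [n]; the element i of [n] is the i′ : Fin n with
-- toℕ i′ = i − 1.

Consecutive : {n : ℕ} → Fin n → Fin n → Set
Consecutive i j = toℕ j ≡ suc (toℕ i)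

-- i is the first and j the last element of [n].
FirstLast : {n : ℕ} → Fin n → Fin n → Set
FirstLast {n} i j = toℕ i ≡ 0 × suc (toℕ j) ≡ n

CycleAdjacent : {n : ℕ} → Fin n → Fin n → Set
CycleAdjacent i j =
  (Consecutive i j ⊎ Consecutive j i) ⊎ (FirstLast i j ⊎ FirstLast j i)

Stable : {n : ℕ} → Subset n → Set
Stable S = ∀ i j → i ∈ S → j ∈ S → ¬ Consecutive i j × ¬ FirstLast i j

------------------------------------------------------------------------
-- Graphs

record Graph (n : ℕ) : Set where
  field
    adj   : Fin n → Fin n → Bool
    sym   : ∀ u v → adj u v ≡ adj v u
    irref : ∀ v → adj v v ≡ false

  Edge : Fin n → Fin n → Set
  Edge u v = adj u v ≡ true

  Independent : Subset n → Set
  Independent S = ∀ u v → u ∈ S → v ∈ S → ¬ Edge u v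

encodeGraph : {n : ℕ} → Graph n → Tree
encodeGraph G =
  encodeVec (encodeVec encodeBool) (tabulate λ u → tabulate λ v → Graph.adj G u v)

-- A cycle through all of the vertices Fin n, listed in cyclic order.
record HamiltonCycle (n : ℕ) : Set where
  field
    order : Permutation′ n
    long  : 3 ≤ n

  Edge : Fin n → Fin n → Set
  Edge u v = ∃[ i ] ∃[ j ]
    (CycleAdjacent i j × u ≡ order ⟨$⟩ʳ i × v ≡ order ⟨$⟩ʳ j)

record DisjointTriangles (k n : ℕ) : Set where
  field
    corner   : Fin k → Fin 3 → Fin n
    disjoint : ∀ i a j b → corner i a ≡ corner j b → i ≡ j × a ≡ b

  Edge : Fin n → Fin n → Set
  Edge u v = ∃[ i ] ∃[ a ] ∃[ b ]
    (a ≢ b × u ≡ corner i a × v ≡ corner i b)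

record CyclePlusTrianglesDecomposition (k : ℕ) (G : Graph (3 * k)) : Set where
  field
    cycle     : HamiltonCycle (3 * k)
    triangles : DisjointTriangles k (3 * k)
    union     : ∀ u v → Graph.Edge G u v ⇔
                  (HamiltonCycle.Edge cycle u v ⊎ DisjointTriangles.Edge triangles u v)
    disjoint  : ∀ u v →
                  ¬ (HamiltonCycle.Edge cycle u v × DisjointTriangles.Edge triangles u v)

------------------------------------------------------------------------
-- The two problems

record CPTInstance : Set where
  field
    k             : ℕ
    graph         : Graph (3 * k)
    decomposition : CyclePlusTrianglesDecomposition k graph

record CPTSolution (x : CPTInstance) : Set where
  open CPTInstance x
  field
    set         : Subset (3 * k)
    independent : Graph.Independent graph set
    card        : ∣ set ∣ ≡ k

-- The decomposition is not part of the encoded input.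
CyclePlusTriangles : SearchProblem
CyclePlusTriangles = record
  { Instance       = CPTInstance
  ; Solution       = CPTSolution
  ; encodeInstance = λ x → cons (encodeℕ (CPTInstance.k x)) (encodeGraph (CPTInstance.graph x))
  ; encodeSolution = λ s → encodeSubset (CPTSolution.set s)
  }

record UnfairInstance : Set where
  field
    n k ℓ : ℕ
    sets  : Vec (Subset n) ℓ
    2k≤n  : 2 * k ≤ n
    few   : ℓ ≤ n ∸ 2 * k + 1
    large : ∀ i → 2 ≤ ∣ lookup sets i ∣

record UnfairSolution (x : UnfairInstance) : Set where
  open UnfairInstance x
  field
    set    : Subset n
    stable : Stable set
    card   : ∣ set ∣ ≡ k
    -- |S ∩ Vᵢ| ≤ |Vᵢ| / 2, with exact division
    unfair : ∀ i → 2 * ∣ set ∩ lookup sets i ∣ ≤ ∣ lookup sets i ∣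

UnfairIndependentSetInCycle : SearchProblem
UnfairIndependentSetInCycle = record
  { Instance       = UnfairInstance
  ; Solution       = UnfairSolution
  ; encodeInstance = λ x → let open UnfairInstance x in
      cons (encodeℕ n) (cons (encodeℕ k) (encodeVec encodeSubset sets))
  ; encodeSolution = λ s → encodeSubset (UnfairSolution.set s)
  }

record PartitionIntoTriples (x : UnfairInstance) : Set where
  open UnfairInstance x
  field
    n≡3k     : n ≡ 3 * k
    ℓ≡k      : ℓ ≡ k
    triples  : ∀ i → ∣ lookup sets i ∣ ≡ 3
    disjoint : ∀ i j → i ≢ j → ∀ v → ¬ (v ∈ lookup sets i × v ∈ lookup sets j)
    cover    : ∀ v → ∃[ i ] v ∈ lookup sets i

-- The reduction finds a partition of G into triangles; the remaining edges turn out to form a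
-- Hamilton cycle, along which one walks.
--
-- Fix a decomposition of G.  A triangle of G outside the partition must be an arc p j n of the
-- cycle: two of its three edges are of the same kind, and two triangle edges at a vertex span a
-- triangle of the partition.  As p n is then a triangle edge, {p, n, w} is in the partition
-- for some w = w(j).
--
-- The search keeps a list of candidate triangles.  It commits to a triangle t by discarding those
-- that meet it, and then repeatedly discards every s for which some vertex off s lies in no
-- remaining triangle disjoint from s; it accepts the result if t survives.  Suppose that t = p j n
-- survives.  Since w(j) must be covered without meeting p, j, n, the arc around w(j) survives
-- as well, and w permutes the centres of such arcs, being injective.  Conjugating the Hamilton
-- cycle by this permutation, and the triangles by its inverse, gives a new decomposition of G
-- all of whose triangles survive.  So every acceptance is sound, and no triangle of the
-- final decomposition is ever rejected; hence nothing else is left at the end.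

module Submission where

open import Defs

open import Data.Bool using (Bool; true; false; not; _∧_; _∨_) renaming (if_then_else_ to when_then_else_)
import Data.Bool as Bool
open import Data.Bool.Properties using (∧-zeroʳ)
open import Data.Fin using (Fin; zero; suc; toℕ; punchOut; combine; remQuot)
import Data.Fin as Fin
open import Data.Fin.Permutation using (_⟨$⟩ʳ_; _⟨$⟩ˡ_; inverseˡ; inverseʳ)
import Data.Fin.Properties as Fin
import Data.Fin.Relation.Unary.Top as Top
open import Data.Fin.Subset using (Subset; _∈_; _∩_; ∣_∣)
open import Data.Fin.Subset.Properties using (x∈p∩q⁺)
open import Data.List using (List; []; _∷_; _++_; length; concatMap; reverse; filter; map; replicate; _ʳ++_; foldl; foldr; null; allFin; tabulate; applyUpTo; take)
import Data.List as List
open import Data.List.Membership.Propositional using (find; lose) renaming (_∈_ to _∈ₗ_)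
open import Data.List.Membership.Propositional.Properties using (∈-filter⁺; ∈-filter⁻; ∈-concatMap⁺; ∈-map⁺; ∈-allFin; ∈-lookup)
import Data.List.Properties as List
open import Data.List.Relation.Unary.All using (All; all?; []; _∷_)
import Data.List.Relation.Unary.All as All
open import Data.List.Relation.Unary.All.Properties using (¬All⇒Any¬)
open import Data.List.Relation.Unary.Any using (Any; any?; here; there; index)
open import Data.List.Relation.Unary.Any.Properties using (lookup-index)
open import Data.List.Relation.Unary.Unique.Propositional using (Unique; _∷_)
import Data.List.Relation.Unary.Unique.Propositional.Properties as Unique
open import Data.Nat using (ℕ; zero; suc; _+_; _*_; _^_; _∸_; _≤_; _<_; z≤n; s≤s; s≤s⁻¹; _≤?_; _<?_; _≟_)
open import Data.Nat.Induction using (<-wellFounded)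
open import Data.Nat.Properties hiding (_≤?_; _<?_; _≟_)
open import Data.Product using (Σ; Σ-syntax; ∃-syntax; _×_; _,_; proj₁; proj₂)
open import Data.Sum using (_⊎_; inj₁; inj₂)
import Data.Sum as Sum
open import Data.Unit using (⊤; tt)
open import Data.Vec using (Vec; []; _∷_; here; there; lookup)
import Data.Vec as Vec
open import Data.Vec.Properties using ([]=⇒lookup; lookup⇒[]=; lookup∘tabulate)
open import Function using (_∘_; id)
open import Function.Bundles using (_⇔_; Equivalence)
open import Induction.WellFounded using (Acc; acc)
open import Relation.Binary.PropositionalEquality using (_≡_; _≢_; refl; sym; trans; cong; cong₂; subst; subst₂; subst-subst-sym)
open import Relation.Nullary using (¬_; Dec; yes; no; does; ¬?; contradiction)
open import Relation.Nullary.Decidable using (map′; _×-dec_; _⊎-dec_; dec-true; dec-false)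


-- Polynomial-time computable terms

-- Partition into triangles is NP-complete for general graphs. The search gets by without
-- backtracking because the decomposition guides only the proof, where it may be replaced as often
-- as needed; the programs never see it.
--
-- Positions along the walk become the ground set `[n]`, and the recovered triangles, read as sets
-- of positions, become the sets `V_i`. As `3/2 < 2`, a solution takes at most one position from
-- each, and its stability rules out the remaining edges; carried back to vertices it is
-- independent.
--
-- Running times are not analysed on programs. Each function is an ordinary term over lists, and
-- `Poly` has one combinator per construct, so a derivation follows the term and yields program and
-- bound together. Hence decisions enter through `does`, and all iteration is a fold over a list
-- already at hand: loops alone could leave polynomial time, and a fold with additive growth does
-- not.

data Polynomial : Set where
  con     : ℕ → Polynomial
  var     : Polynomial
  _⊕_ _⊗_ : Polynomial → Polynomial → Polynomial

infixl 6 _⊕_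
infixl 7 _⊗_

eval : Polynomial → ℕ → ℕ
eval (con c) x = c
eval var     x = x
eval (p ⊕ q) x = eval p x + eval q x
eval (p ⊗ q) x = eval p x * eval q x

eval-mono : ∀ p {x y} → x ≤ y → eval p x ≤ eval p y
eval-mono (con c) x≤y = ≤-refl
eval-mono var     x≤y = x≤y
eval-mono (p ⊕ q) x≤y = +-mono-≤ (eval-mono p x≤y) (eval-mono q x≤y)
eval-mono (p ⊗ q) x≤y = *-mono-≤ (eval-mono p x≤y) (eval-mono q x≤y)

infixl 8 _∘ₚ_

_∘ₚ_ : Polynomial → Polynomial → Polynomial
con c   ∘ₚ r = con c
var     ∘ₚ r = r
(p ⊕ q) ∘ₚ r = (p ∘ₚ r) ⊕ (q ∘ₚ r)
(p ⊗ q) ∘ₚ r = (p ∘ₚ r) ⊗ (q ∘ₚ r)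

eval-at : ∀ p r x → eval (p ∘ₚ r) x ≡ eval p (eval r x)
eval-at (con c) r x = refl
eval-at var     r x = refl
eval-at (p ⊕ q) r x = cong₂ _+_ (eval-at p r x) (eval-at q r x)
eval-at (p ⊗ q) r x = cong₂ _*_ (eval-at p r x) (eval-at q r x)

eval-at-≤ : ∀ p r {x y} → y ≤ eval r x → eval p y ≤ eval (p ∘ₚ r) x
eval-at-≤ p r {x} y≤ = subst (eval p _ ≤_) (sym (eval-at p r x)) (eval-mono p y≤)

-- In a sum both exponents are raised to `d + d′`, which requires a base of at least 1; sizes of
-- trees satisfy this.
monomial-bound : ∀ p → Σ[ c ∈ ℕ ] Σ[ d ∈ ℕ ] (∀ x → 1 ≤ x → eval p x ≤ c * x ^ d)
monomial-bound (con c) = c , 0 , λ x _ → ≤-reflexive (sym (*-identityʳ c))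
monomial-bound var     = 1 , 1 , λ x _ → ≤-reflexive (sym (trans (*-identityˡ (x ^ 1)) (^-identityʳ x)))
monomial-bound (p ⊕ q) with monomial-bound p | monomial-bound q
... | c , d , f | c′ , d′ , g = c + c′ , d + d′ , λ { x@(suc _) 1≤x → begin
  eval p x + eval q x                       ≤⟨ +-mono-≤ (f x 1≤x) (g x 1≤x) ⟩
  c * x ^ d + c′ * x ^ d′                   ≤⟨ +-mono-≤ (*-monoʳ-≤ c (^-monoʳ-≤ x (m≤m+n d d′)))
                                                        (*-monoʳ-≤ c′ (^-monoʳ-≤ x (m≤n+m d′ d))) ⟩
  c * x ^ (d + d′) + c′ * x ^ (d + d′)      ≡⟨ *-distribʳ-+ (x ^ (d + d′)) c c′ ⟨
  (c + c′) * x ^ (d + d′)                   ∎ }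
  where open ≤-Reasoning
monomial-bound (p ⊗ q) with monomial-bound p | monomial-bound q
... | c , d , f | c′ , d′ , g = c * c′ , d + d′ , λ x 1≤x → begin
  eval p x * eval q x             ≤⟨ *-mono-≤ (f x 1≤x) (g x 1≤x) ⟩
  (c * x ^ d) * (c′ * x ^ d′)     ≡⟨ [m*n]*[o*p]≡[m*o]*[n*p] c (x ^ d) c′ (x ^ d′) ⟩
  (c * c′) * (x ^ d * x ^ d′)     ≡⟨ cong (c * c′ *_) (^-distribˡ-+-* x d d′) ⟨
  (c * c′) * x ^ (d + d′)         ∎
  where open ≤-Reasoning

1≤size : ∀ x → 1 ≤ size x
1≤size nil        = ≤-refl
1≤size (cons l r) = s≤s z≤n

-- A loop that stops at once returns its whole store for the price of the test. Bounding outputs by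
-- time therefore rests on the fact that every run pays for its input.
size-input : ∀ {p x y t} → p ⊢ x ⇓ y [ t ] → size x ≤ t
size-input ⇓-skip       = ≤-refl
size-input ⇓-nil        = ≤-refl
size-input ⇓-hd         = ≤-refl
size-input ⇓-hdnil      = ≤-refl
size-input ⇓-tl         = ≤-refl
size-input ⇓-tlnil      = ≤-refl
size-input (⇓-pair d _) = m≤n⇒m≤1+n (m≤n⇒m≤n+o _ (size-input d))
size-input (⇓-seq d _)  = m≤n⇒m≤1+n (m≤n⇒m≤n+o _ (size-input d))
size-input (⇓-then d _) = m≤n⇒m≤1+n (m≤n⇒m≤n+o _ (size-input d))
size-input (⇓-else d _) = m≤n⇒m≤1+n (m≤n⇒m≤n+o _ (size-input d))
size-input (⇓-stop d)   = m≤n⇒m≤1+n (size-input d)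
size-input (⇓-loop d _ _) = m≤n⇒m≤1+n (m≤n⇒m≤n+o _ (m≤n⇒m≤n+o _ (size-input d)))

size-output : ∀ {p x y t} → p ⊢ x ⇓ y [ t ] → size y ≤ t
size-output ⇓-skip            = ≤-refl
size-output {x = x} ⇓-nil     = 1≤size x
size-output ⇓-hd              = m≤n⇒m≤1+n (m≤m+n _ _)
size-output ⇓-hdnil           = ≤-refl
size-output (⇓-tl {l = l})    = m≤n⇒m≤1+n (m≤n+m _ (size l))
size-output ⇓-tlnil           = ≤-refl
size-output (⇓-pair d e)      = s≤s (+-mono-≤ (size-output d) (size-output e))
size-output (⇓-seq {s = s} d e)  = m≤n⇒m≤1+n (m≤n⇒m≤o+n s (size-output e))
size-output (⇓-then {s = s} d e) = m≤n⇒m≤1+n (m≤n⇒m≤o+n s (size-output e))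
size-output (⇓-else {s = s} d e) = m≤n⇒m≤1+n (m≤n⇒m≤o+n s (size-output e))
size-output (⇓-stop d)        = m≤n⇒m≤1+n (size-input d)
size-output (⇓-loop {s = s} {t = t} d e f) = m≤n⇒m≤1+n (m≤n⇒m≤o+n (s + t) (size-output f))

-- The type of a value may depend on the environment, as `Fin (n a)` does, and so may the way it is
-- written.
Encoding : {A : Set} → (A → Set) → Set
Encoding {A} X = (a : A) → X a → Tree

-- A is a typing context and e encodes its environments: Poly e enc f says
-- that the term f, with free variables in A, is computable in polynomial time.
record Poly {A : Set} (e : A → Tree) {X : A → Set} (enc : Encoding X) (f : ∀ a → X a) : Set where
  constructor poly
  field
    program : Program
    bound   : Polynomial
    run     : ∀ a → Σ[ t ∈ ℕ ] (program ⊢ e a ⇓ enc a (f a) [ t ] × t ≤ eval bound (size (e a)))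

  -- Time bounds size, so a single polynomial serves for both when programs are composed.
  size≤ : ∀ a → size (enc a (f a)) ≤ eval bound (size (e a))
  size≤ a with run a
  ... | t , d , t≤ = ≤-trans (size-output d) t≤

open Poly using (program; bound; run; size≤)

tree : {A : Set} → Encoding {A} (λ _ → Tree)
tree _ x = x

bool : {A : Set} → Encoding {A} (λ _ → Bool)
bool _ = encodeBool

nat : {A : Set} → Encoding {A} (λ _ → ℕ)
nat _ = encodeℕ

encodeList : {X : Set} → (X → Tree) → List X → Tree
encodeList e []       = nil
encodeList e (x ∷ xs) = cons (e x) (encodeList e xs)

list : {A : Set} {X : A → Set} → Encoding X → Encoding (λ a → List (X a))
list enc a = encodeList (enc a)

infixl 4 _▹_

_▹_ : {A : Set} (e : A → Tree) {X : A → Set} → Encoding X → Σ A X → Tree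
(e ▹ enc) (a , x) = cons (e a) (enc a x)

toPolyTime : {A : Set} {e : A → Tree} {X : A → Set} {enc : Encoding X} {f : ∀ a → X a} →
             Poly e enc f → PolyTime e (λ a → enc a (f a))
toPolyTime {e = e} P with monomial-bound (bound P)
... | c , d , b = program P , c , d , λ a →
  let t , r , t≤ = run P a in t , r , ≤-trans t≤ (b _ (1≤size (e a)))

module _ {A : Set} {e : A → Tree} where

  -- Programs see only trees, so the type of a result can be changed freely as long as the tree
  -- stays the same. Mostly the equation is `refl`: two types are written alike.
  recode : {X Y : A → Set} {enc : Encoding X} {enc′ : Encoding Y} {f : ∀ a → X a} {g : ∀ a → Y a} →
           (∀ a → enc a (f a) ≡ enc′ a (g a)) → Poly e enc f → Poly e enc′ g
  recode eq (poly p b r) = poly p b λ a →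
    let t , d , t≤ = r a in t , subst (λ y → p ⊢ _ ⇓ y [ t ]) (eq a) d , t≤

  replace : {X : A → Set} {enc : Encoding X} {f g : ∀ a → X a} →
            (∀ a → f a ≡ g a) → Poly e enc f → Poly e enc g
  replace {enc = enc} eq = recode (λ a → cong (enc a) (eq a))

  environment : Poly e tree e
  environment = poly skip var λ a → _ , ⇓-skip , ≤-refl

  leaf : Poly e tree (λ _ → nil)
  leaf = poly nil var λ a → _ , ⇓-nil , ≤-refl

  infixr 3 _then_

  -- Besides composing functions this substitutes environments: the second program runs in the
  -- context `B` that the first one builds.
  _then_ : {B : Set} {e′ : B → Tree} {h : A → B} {Y : B → Set} {enc : Encoding Y} {f : ∀ b → Y b} →
           Poly e (λ _ → e′) h → Poly e′ enc f → Poly e (λ a → enc (h a)) (λ a → f (h a))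
  _then_ {h = h} P Q = poly (program P ⨾ program Q) (con 1 ⊕ (bound P ⊕ bound Q ∘ₚ bound P)) λ a →
    let s , d , s≤ = run P a
        t , d′ , t≤ = run Q (h a)
    in _ , ⇓-seq d d′ , s≤s (+-mono-≤ s≤ (≤-trans t≤ (eval-at-≤ (bound Q) (bound P) (size≤ P a))))

  node : {X Y : A → Set} {enc : Encoding X} {enc′ : Encoding Y} {f : ∀ a → X a} {g : ∀ a → Y a} →
         Poly e enc f → Poly e enc′ g → Poly e tree (λ a → cons (enc a (f a)) (enc′ a (g a)))
  node P Q = poly (pair (program P) (program Q)) (con 1 ⊕ (bound P ⊕ bound Q)) λ a →
    let s , d , s≤ = run P a
        t , d′ , t≤ = run Q a
    in _ , ⇓-pair d d′ , s≤s (+-mono-≤ s≤ t≤)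

-- Branching, Booleans and variables

head-tree tail-tree : Tree → Tree
head-tree nil        = nil
head-tree (cons l r) = l
tail-tree nil        = nil
tail-tree (cons l r) = r

headP : Poly (λ x → x) tree head-tree
headP = poly hd var λ { nil → _ , ⇓-hdnil , ≤-refl ; (cons l r) → _ , ⇓-hd , ≤-refl }

tailP : Poly (λ x → x) tree tail-tree
tailP = poly tl var λ { nil → _ , ⇓-tlnil , ≤-refl ; (cons l r) → _ , ⇓-tl , ≤-refl }

branch : {X : Set} → Tree → X → X → X
branch nil        x y = y
branch (cons _ _) x y = x

module _ {A : Set} {e : A → Tree} where

  left : {f : A → Tree} → Poly e tree f → Poly e tree (λ a → head-tree (f a))
  left P = P then headP

  right : {f : A → Tree} → Poly e tree f → Poly e tree (λ a → tail-tree (f a))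
  right P = P then tailP

  caseTree : {c : A → Tree} {X : A → Set} {enc : Encoding X} {f g : ∀ a → X a} →
             Poly e tree c → Poly e enc f → Poly e enc g →
             Poly e enc (λ a → branch (c a) (f a) (g a))
  caseTree {c} {enc = enc} {f} {g} C P Q =
    poly (if program C then program P else program Q) (con 1 ⊕ (bound C ⊕ (bound P ⊕ bound Q))) go
    where
    go : ∀ a → Σ[ t ∈ ℕ ] (_ ⊢ e a ⇓ enc a (branch (c a) (f a) (g a)) [ t ] × _)
    go a with c a | run C a
    ... | nil      | s , d , s≤ = let t , d′ , t≤ = run Q a in
      _ , ⇓-else d d′ , s≤s (+-mono-≤ s≤ (m≤n⇒m≤o+n _ t≤))
    ... | cons _ _ | s , d , s≤ = let t , d′ , t≤ = run P a in
      _ , ⇓-then d d′ , s≤s (+-mono-≤ s≤ (m≤n⇒m≤n+o _ t≤))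

  ifP : {b : A → Bool} {X : A → Set} {enc : Encoding X} {f g : ∀ a → X a} →
        Poly e bool b → Poly e enc f → Poly e enc g → Poly e enc (λ a → when b a then f a else g a)
  ifP {b} {enc = enc} {f} {g} B P Q =
    replace (λ a → lemma (b a)) (caseTree (recode (λ _ → refl) B) P Q)
    where
    lemma : ∀ b {X : Set} {x y : X} → branch (encodeBool b) x y ≡ (when b then x else y)
    lemma false = refl
    lemma true  = refl

  falseP : Poly e bool (λ _ → false)
  falseP = recode (λ _ → refl) leaf

  trueP : Poly e bool (λ _ → true)
  trueP = recode (λ _ → refl) (node leaf leaf)

  notP : {b : A → Bool} → Poly e bool b → Poly e bool (λ a → not (b a))
  notP {b} B = replace (λ a → lemma (b a)) (ifP B falseP trueP)
    where
    lemma : ∀ b → (when b then false else true) ≡ not b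
    lemma false = refl
    lemma true  = refl

  andP : {b c : A → Bool} → Poly e bool b → Poly e bool c → Poly e bool (λ a → b a ∧ c a)
  andP {b} {c} B C = replace (λ a → lemma (b a)) (ifP B C falseP)
    where
    lemma : ∀ b {c} → (when b then c else false) ≡ b ∧ c
    lemma false = refl
    lemma true  = refl

  orP : {b c : A → Bool} → Poly e bool b → Poly e bool c → Poly e bool (λ a → b a ∨ c a)
  orP {b} {c} B C = replace (λ a → lemma (b a)) (ifP B trueP C)
    where
    lemma : ∀ b {c} → (when b then true else c) ≡ b ∨ c
    lemma false = refl
    lemma true  = refl

  []P : {X : A → Set} {enc : Encoding X} → Poly e (list enc) (λ _ → [])
  []P = recode (λ _ → refl) leaf

  ∷P : {X : A → Set} {enc : Encoding X} {x : ∀ a → X a} {xs : ∀ a → List (X a)} →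
       Poly e enc x → Poly e (list enc) xs → Poly e (list enc) (λ a → x a ∷ xs a)
  ∷P P Q = recode (λ _ → refl) (node P Q)

module _ {A : Set} {e : A → Tree} {X : A → Set} {enc : Encoding X} where

  -- Variables are addressed as in de Bruijn notation: `v0` is the newest entry of the environment,
  -- and `wk` skips it.
  wk : {Y : A → Set} {enc′ : Encoding Y} {f : ∀ a → Y a} →
       Poly e enc′ f → Poly (e ▹ enc) (λ p → enc′ (proj₁ p)) (λ p → f (proj₁ p))
  wk P = recode {enc′ = λ _ → e} {g = proj₁} (λ _ → refl) (left environment) then P

  v0 : Poly (e ▹ enc) (λ p → enc (proj₁ p)) proj₂
  v0 = recode (λ _ → refl) (right environment)

  push : {x : ∀ a → X a} → Poly e enc x → Poly e (λ _ → e ▹ enc) (λ a → a , x a)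
  push P = recode (λ _ → refl) (node environment P)

-- Loops as folds with bounded growth

length≤size : {X : Set} (e : X → Tree) (xs : List X) → length xs ≤ size (encodeList e xs)
length≤size e []       = z≤n
length≤size e (x ∷ xs) = s≤s (m≤n⇒m≤o+n (size (e x)) (length≤size e xs))

-- A left fold whose step also sees the part of the list still to come.
para : {X S : Set} → (X → List X → S → S) → S → List X → S
para f s []       = s
para f s (x ∷ xs) = para f (f x xs s) xs

nonEmpty : {A : Set} {X : A → Set} → Encoding X → Encoding (λ a → X a × List (X a))
nonEmpty enc a (x , xs) = cons (enc a x) (encodeList (enc a) xs)

module _ {A : Set} {e : A → Tree} {X : A → Set} {encX : Encoding X}
         {S : A → Set} {encS : Encoding S}
         {xs₀ : ∀ a → List (X a)} {s₀ : ∀ a → S a}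
         (step : ∀ a → X a → List (X a) → S a → S a)
         (growth : Polynomial)
         (grows : ∀ a x xs s → size (encS a (step a x xs s)) ≤
                    size (encS a s) + eval growth (size ((e ▹ nonEmpty encX) (a , x , xs))))
         where

  private
    Body : Set
    Body = Σ[ p ∈ Σ A (λ a → X a × List (X a)) ] S (proj₁ p)

    encBody : Body → Tree
    encBody = (e ▹ nonEmpty encX) ▹ λ p → encS (proj₁ p)

    State : Set
    State = Σ[ p ∈ Σ A (λ a → List (X a)) ] S (proj₁ p)

    encState : State → Tree
    encState = (e ▹ list encX) ▹ λ p → encS (proj₁ p)

  -- `growth` sees the environment and the list but not the accumulator: a step allowed to double
  -- the accumulator could make it exponentially large in linearly many rounds.
  paraP : Poly e (list encX) xs₀ → Poly e encS s₀ →
          Poly encBody (λ p → encS (proj₁ (proj₁ p)))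
            (λ ((a , x , xs) , s) → step a x xs s) →
          Poly e encS (λ a → para (step a) (s₀ a) (xs₀ a))
  paraP PX PS PF = init then loop then result
    where
    test : Poly encState tree (λ ((a , xs) , s) → encodeList (encX a) xs)
    test = right (left environment)

    next : Poly encBody (λ _ → encState) (λ ((a , x , xs) , s) → (a , xs) , step a x xs s)
    next = recode (λ _ → refl)
      (node (node (left (left environment)) (right (right (left environment)))) PF)

    loopProgram : Program
    loopProgram = while program test loop program next

    init : Poly e (λ _ → encState) (λ a → (a , xs₀ a) , s₀ a)
    init = recode (λ _ → refl) (node (node environment PX) PS)

    -- Environment and remaining list each have size at most `N`, whence the argument `1 + (N + N)`.
    G : Polynomial
    G = growth ∘ₚ (con 1 ⊕ (var ⊕ var))

    stateSize : Polynomial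
    stateSize = var ⊕ var ⊗ G

    round : Polynomial
    round = (con 1 ⊕ (bound test ⊕ bound next)) ∘ₚ stateSize

    -- The last hypothesis is a budget: each element still to come may claim `eval G N`. So the
    -- total never exceeds `N + N * eval G N`, although the accumulator grows.
    loop-run : ∀ a N → size (e a) ≤ N → ∀ xs s →
      size (encodeList (encX a) xs) ≤ N →
      size (encState ((a , xs) , s)) + length xs * eval G N ≤ eval stateSize N →
      Σ[ t ∈ ℕ ] (loopProgram ⊢ encState ((a , xs) , s) ⇓
                    encState ((a , []) , para (step a) s xs) [ t ] ×
                  t ≤ suc (length xs) * eval round N)
    loop-run a N a≤N [] s xs≤N state≤ =
      let t , d , t≤ = run test ((a , []) , s) in
      _ , ⇓-stop d , (begin
        suc t
          ≤⟨ s≤s (m≤n⇒m≤n+o _ t≤) ⟩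
        eval (con 1 ⊕ (bound test ⊕ bound next)) (size (encState ((a , []) , s)))
          ≤⟨ eval-at-≤ (con 1 ⊕ (bound test ⊕ bound next)) stateSize {N} (m+n≤o⇒m≤o (size (encState ((a , []) , s))) state≤) ⟩
        eval round N
          ≡⟨ *-identityˡ _ ⟨
        1 * eval round N ∎)
      where open ≤-Reasoning
    loop-run a N a≤N (x ∷ xs) s xs≤N state≤ =
      let s₁ , d , s≤ = run test ((a , x ∷ xs) , s)
          t , d′ , t≤ = run next ((a , x , xs) , s)
          u , d″ , u≤ = loop-run a N a≤N xs (step a x xs s)
                          (≤-trans (m≤n⇒m≤1+n (m≤n+m _ (size (encX a x)))) xs≤N) next≤
      in _ , ⇓-loop d d′ d″ , (begin
        suc (s₁ + t + u)
          ≤⟨ s≤s (+-mono-≤ (+-mono-≤ s≤ t≤) u≤) ⟩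
        eval (con 1 ⊕ (bound test ⊕ bound next)) (size (encState ((a , x ∷ xs) , s)))
          + suc (length xs) * eval round N
          ≤⟨ +-monoˡ-≤ _ (eval-at-≤ (con 1 ⊕ (bound test ⊕ bound next)) stateSize {N} (m+n≤o⇒m≤o (size (encState ((a , x ∷ xs) , s))) state≤)) ⟩
        suc (suc (length xs)) * eval round N ∎)
      where
      open ≤-Reasoning
      next≤ : size (encState ((a , xs) , step a x xs s)) + length xs * eval G N ≤ eval stateSize N
      next≤ = begin
        suc (suc (size (e a) + size (encodeList (encX a) xs)) + size (encS a (step a x xs s)))
          + length xs * eval G N
          ≤⟨ +-monoˡ-≤ (length xs * eval G N) (s≤s (+-mono-≤
               (s≤s (+-monoʳ-≤ (size (e a)) (m≤n⇒m≤1+n (m≤n+m _ (size (encX a x))))))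
               (≤-trans (grows a x xs s) (+-monoʳ-≤ (size (encS a s))
                 (eval-at-≤ growth (con 1 ⊕ (var ⊕ var)) {N} (s≤s (+-mono-≤ a≤N xs≤N))))))) ⟩
        suc (suc (size (e a) + size (encodeList (encX a) (x ∷ xs))) + (size (encS a s) + eval G N))
          + length xs * eval G N
          ≡⟨ cong (λ z → suc z + length xs * eval G N) (+-assoc _ (size (encS a s)) (eval G N)) ⟨
        size (encState ((a , x ∷ xs) , s)) + eval G N + length xs * eval G N
          ≡⟨ +-assoc (size (encState ((a , x ∷ xs) , s))) (eval G N) _ ⟩
        size (encState ((a , x ∷ xs) , s)) + suc (length xs) * eval G N
          ≤⟨ state≤ ⟩
        eval stateSize N ∎

    loop : Poly encState (λ _ → encState) (λ ((a , xs) , s) → (a , []) , para (step a) s xs)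
    loop = poly loopProgram ((con 1 ⊕ var) ⊗ round) λ ((a , xs) , s) →
      let N     = size (encState ((a , xs) , s))
          list≤ : size (encodeList (encX a) xs) ≤ N
          list≤ = m≤n⇒m≤1+n (m≤n⇒m≤n+o _ (m≤n⇒m≤1+n (m≤n+m _ (size (e a)))))
          len≤  : length xs ≤ N
          len≤  = ≤-trans (length≤size (encX a) xs) list≤
          t , d , t≤ = loop-run a N (m≤n⇒m≤1+n (m≤n⇒m≤n+o _ (m≤n⇒m≤1+n (m≤m+n _ _)))) xs s
                         list≤ (+-monoʳ-≤ N (*-monoˡ-≤ (eval G N) len≤))
      in t , d , ≤-trans t≤ (*-monoˡ-≤ (eval round N) (s≤s len≤))

    result : Poly encState (λ p → encS (proj₁ (proj₁ p))) proj₂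
    result = v0

para-foldl : {X S : Set} (f : X → S → S) (s : S) (xs : List X) →
             para (λ x _ s → f x s) s xs ≡ foldl (λ s x → f x s) s xs
para-foldl f s []       = refl
para-foldl f s (x ∷ xs) = para-foldl f (f x s) xs

concatMap-foldr : {X Y : Set} (f : X → List Y) (xs : List X) →
                  foldr (λ x ys → f x ++ ys) [] xs ≡ concatMap f xs
concatMap-foldr f []       = refl
concatMap-foldr f (x ∷ xs) = cong (f x ++_) (concatMap-foldr f xs)

size-++ : {X : Set} (enc : X → Tree) (xs ys : List X) →
          size (encodeList enc (xs ++ ys)) ≤ size (encodeList enc ys) + size (encodeList enc xs)
size-++ enc []       ys = m≤m+n _ _
size-++ enc (x ∷ xs) ys = begin
  suc (size (enc x) + size (encodeList enc (xs ++ ys))) ≤⟨ s≤s (+-monoʳ-≤ (size (enc x)) (size-++ enc xs ys)) ⟩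
  suc (size (enc x) + (b + c))                          ≡⟨ cong suc (+-comm (size (enc x)) (b + c)) ⟩
  suc (b + c + size (enc x))                            ≡⟨ cong suc (+-assoc b c _) ⟩
  suc (b + (c + size (enc x)))                          ≡⟨ +-suc b _ ⟨
  b + suc (c + size (enc x))                            ≡⟨ cong (λ z → b + suc z) (+-comm c _) ⟩
  b + suc (size (enc x) + c)                            ∎
  where
  open ≤-Reasoning
  b = size (encodeList enc ys)
  c = size (encodeList enc xs)

size-filter : {X : Set} (enc : X → Tree) {P : X → Set} (P? : ∀ x → Dec (P x)) (xs : List X) →
              size (encodeList enc (filter P? xs)) ≤ size (encodeList enc xs)
size-filter enc P? []       = ≤-refl
size-filter enc P? (x ∷ xs) with does (P? x)
... | true  = s≤s (+-monoʳ-≤ (size (enc x)) (size-filter enc P? xs))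
... | false = m≤n⇒m≤1+n (m≤n⇒m≤o+n (size (enc x)) (size-filter enc P? xs))

module _ {A : Set} {e : A → Tree} {X : A → Set} {encX : Encoding X} where

  foldlP : {S : A → Set} {encS : Encoding S} {xs₀ : ∀ a → List (X a)} {s₀ : ∀ a → S a}
           (step : ∀ a → X a → S a → S a) (growth : Polynomial) →
           (∀ a x s → size (encS a (step a x s)) ≤ size (encS a s) + eval growth (size ((e ▹ encX) (a , x)))) →
           Poly e (list encX) xs₀ → Poly e encS s₀ →
           Poly ((e ▹ encX) ▹ λ p → encS (proj₁ p)) (λ p → encS (proj₁ (proj₁ p)))
             (λ ((a , x) , s) → step a x s) →
           Poly e encS (λ a → foldl (λ s x → step a x s) (s₀ a) (xs₀ a))
  foldlP {encS = encS} {xs₀} {s₀} step growth grows PX PS PF =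
    replace (λ a → para-foldl (step a) (s₀ a) (xs₀ a))
      (paraP (λ a x _ s → step a x s) growth
        (λ a x xs s → ≤-trans (grows a x s) (+-monoʳ-≤ (size (encS a s))
          (eval-mono growth (s≤s (+-monoʳ-≤ (size (e a)) (m≤n⇒m≤1+n (m≤m+n _ _)))))))
        PX PS (recode {g = λ ((a , x , _) , s) → (a , x) , s} (λ _ → refl) forget then PF))
    where
    forget : Poly ((e ▹ nonEmpty encX) ▹ λ p → encS (proj₁ p)) tree
               (λ ((a , x , _) , s) → cons (cons (e a) (encX a x)) (encS a s))
    forget = node (node (left (left environment)) (left (right (left environment)))) (right environment)

  revAppendP : {xs ys : ∀ a → List (X a)} → Poly e (list encX) xs → Poly e (list encX) ys →
               Poly e (list encX) (λ a → xs a ʳ++ ys a)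
  revAppendP P Q = foldlP (λ _ → _∷_) var
    (λ a x xs → ≤-trans (≤-reflexive (cong suc (+-comm (size (encX a x)) _)))
      (≤-trans (≤-reflexive (sym (+-suc _ _)))
        (+-monoʳ-≤ (size (encodeList (encX a) xs)) (s≤s (m≤n+m _ (size (e a)))))))
    P Q (∷P (wk v0) v0)

  reverseP : {xs : ∀ a → List (X a)} → Poly e (list encX) xs → Poly e (list encX) (λ a → reverse (xs a))
  reverseP P = revAppendP P []P

module _ {A : Set} {e : A → Tree} {X : A → Set} {encX : Encoding X} where

  -- A left fold that conses reverses its list, so appending means reversing twice.
  ++P : {xs ys : ∀ a → List (X a)} → Poly e (list encX) xs → Poly e (list encX) ys →
        Poly e (list encX) (λ a → xs a ++ ys a)
  ++P {xs} {ys} P Q = replace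
    (λ a → trans (List.ʳ++-defn (reverse (xs a))) (cong (_++ ys a) (List.reverse-involutive (xs a))))
    (revAppendP (reverseP P) Q)

  nullP : {xs : ∀ a → List (X a)} → Poly e (list encX) xs → Poly e bool (λ a → null (xs a))
  nullP {xs} P = replace (λ a → lemma (xs a)) (caseTree (recode (λ _ → refl) P) falseP trueP)
    where
    lemma : ∀ {a} (xs : List (X a)) → branch (encodeList (encX a) xs) false true ≡ null xs
    lemma []       = refl
    lemma (x ∷ xs) = refl

module _ {A : Set} {e : A → Tree} {X : A → Set} {encX : Encoding X} where

  -- The fold runs over the reversed list, so that each `f x` is put in front of what follows it.
  concatMapP : {Y : A → Set} {encY : Encoding Y} {f : ∀ a → X a → List (Y a)} {xs : ∀ a → List (X a)} →
               Poly (e ▹ encX) (λ p → list encY (proj₁ p)) (λ (a , x) → f a x) →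
               Poly e (list encX) xs →
               Poly e (list encY) (λ a → concatMap (f a) (xs a))
  concatMapP {encY = encY} {f} {xs} F P = replace
    (λ a → trans (List.reverse-foldl _ [] (xs a)) (concatMap-foldr (f a) (xs a)))
    (foldlP (λ a x ys → f a x ++ ys) (bound F)
      (λ a x ys → ≤-trans (size-++ (encY a) (f a x) ys)
                    (+-monoʳ-≤ (size (encodeList (encY a) ys)) (size≤ F (a , x))))
      (reverseP P) []P (++P (wk F) v0))

  mapP : {Y : A → Set} {encY : Encoding Y} {f : ∀ a → X a → Y a} {xs : ∀ a → List (X a)} →
         Poly (e ▹ encX) (λ p → encY (proj₁ p)) (λ (a , x) → f a x) →
         Poly e (list encX) xs →
         Poly e (list encY) (λ a → map (f a) (xs a))
  mapP {f = f} {xs} F P = replace (λ a → lemma (f a) (xs a)) (concatMapP (∷P F []P) P)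
    where
    lemma : {X Y : Set} (f : X → Y) (xs : List X) → concatMap (λ x → f x ∷ []) xs ≡ map f xs
    lemma f []       = refl
    lemma f (x ∷ xs) = cong (f x ∷_) (lemma f xs)

  module _ {P : ∀ a → X a → Set} {P? : ∀ a x → Dec (P a x)}
           (D : Poly (e ▹ encX) bool (λ (a , x) → does (P? a x)))
           {xs : ∀ a → List (X a)} (L : Poly e (list encX) xs) where

    filterP : Poly e (list encX) (λ a → filter (P? a) (xs a))
    filterP = replace (λ a → lemma (P? a) (xs a)) (concatMapP (ifP D (∷P v0 []P) []P) L)
      where
      lemma : {X : Set} {P : X → Set} (P? : ∀ x → Dec (P x)) (xs : List X) →
              concatMap (λ x → when does (P? x) then x ∷ [] else []) xs ≡ filter P? xs
      lemma P? []       = refl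
      lemma P? (x ∷ xs) with does (P? x)
      ... | true  = cong (x ∷_) (lemma P? xs)
      ... | false = lemma P? xs

    anyP : Poly e bool (λ a → does (any? (P? a) (xs a)))
    anyP = replace (λ a → lemma (P? a) (xs a)) (notP (nullP filterP))
      where
      lemma : {X : Set} {P : X → Set} (P? : ∀ x → Dec (P x)) (xs : List X) →
              not (null (filter P? xs)) ≡ does (any? P? xs)
      lemma P? []       = refl
      lemma P? (x ∷ xs) with does (P? x)
      ... | true  = refl
      ... | false = lemma P? xs

  allP : {P : ∀ a → X a → Set} {P? : ∀ a x → Dec (P a x)} →
         Poly (e ▹ encX) bool (λ (a , x) → does (P? a x)) →
         {xs : ∀ a → List (X a)} → Poly e (list encX) xs →
         Poly e bool (λ a → does (all? (P? a) (xs a)))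
  allP {P? = P?} D {xs} L = replace (λ a → lemma (P? a) (xs a))
    (notP (anyP {P? = λ a x → ¬? (P? a x)} (notP D) L))
    where
    lemma : {X : Set} {P : X → Set} (P? : ∀ x → Dec (P x)) (xs : List X) →
            not (does (any? (λ x → ¬? (P? x)) xs)) ≡ does (all? P? xs)
    lemma P? []       = refl
    lemma P? (x ∷ xs) with does (P? x)
    ... | true  = lemma P? xs
    ... | false = refl

-- Unary numerals, vectors and indices

unit : {A : Set} → Encoding {A} (λ _ → ⊤)
unit _ _ = nil

encodeℕ-replicate : ∀ n → encodeℕ n ≡ encodeList (λ _ → nil) (replicate n tt)
encodeℕ-replicate zero    = refl
encodeℕ-replicate (suc n) = cong (cons nil) (encodeℕ-replicate n)

dropTree : ℕ → Tree → Tree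
dropTree zero    x = x
dropTree (suc i) x = dropTree i (tail-tree x)

lookup-dropTree : {X : Set} {n : ℕ} (enc : X → Tree) (xs : Vec X n) (i : Fin n) →
                  head-tree (dropTree (toℕ i) (encodeVec enc xs)) ≡ enc (lookup xs i)
lookup-dropTree enc (x ∷ xs) zero    = refl
lookup-dropTree enc (x ∷ xs) (suc i) = lookup-dropTree enc xs i

dropTree-encodeℕ : ∀ i n → dropTree i (encodeℕ n) ≡ encodeℕ (n ∸ i)
dropTree-encodeℕ zero    n       = refl
dropTree-encodeℕ (suc i) zero    = trans (dropTree-encodeℕ i zero) (cong encodeℕ (0∸n≡0 i))
dropTree-encodeℕ (suc i) (suc n) = dropTree-encodeℕ i n

fin : {A : Set} {n : A → ℕ} → Encoding (λ a → Fin (n a))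
fin a v = encodeℕ (toℕ v)

vec : {A : Set} {n : A → ℕ} {X : A → Set} → Encoding X → Encoding (λ a → Vec (X a) (n a))
vec enc a = encodeVec (enc a)

-- The proper suffixes of the unary numeral n are the numerals n ∸ 1, …, 0.
para-suffixes : ∀ n (ts : List Tree) →
  para (λ _ xs ts → encodeList (λ _ → nil) xs ∷ ts) ts (replicate n tt) ≡ applyUpTo encodeℕ n ++ ts
para-suffixes zero    ts = refl
para-suffixes (suc n) ts = trans (para-suffixes n _)
  (trans (cong (λ t → applyUpTo encodeℕ n ++ t ∷ ts) (sym (encodeℕ-replicate n)))
    (trans (sym (List.++-assoc (applyUpTo encodeℕ n) (encodeℕ n ∷ []) ts))
      (cong (_++ ts) (List.applyUpTo-∷ʳ encodeℕ n))))

encodeList-tabulate : {X : Set} (enc : X → Tree) (g : ℕ → Tree) → ∀ n (f : Fin n → X) →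
  (∀ i → enc (f i) ≡ g (toℕ i)) → encodeList (λ t → t) (applyUpTo g n) ≡ encodeList enc (tabulate f)
encodeList-tabulate enc g zero    f eq = refl
encodeList-tabulate enc g (suc n) f eq =
  cong₂ cons (sym (eq zero)) (encodeList-tabulate enc (g ∘ suc) n (f ∘ suc) (eq ∘ suc))

module _ {A : Set} {e : A → Tree} where

  dropTreeP : {i : A → ℕ} {x : A → Tree} → Poly e nat i → Poly e tree x →
              Poly e tree (λ a → dropTree (i a) (x a))
  dropTreeP {i} {x} I P = replace (λ a → lemma (i a) (x a))
    (foldlP {encX = unit} {xs₀ = λ a → replicate (i a) tt} (λ _ _ → tail-tree) (con 0)
      (λ { _ _ nil → ≤-refl ; _ _ (cons l r) → ≤-trans (m≤n⇒m≤1+n (m≤n+m _ (size l))) (m≤m+n _ _) })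
      (recode (λ a → encodeℕ-replicate (i a)) I) P (right v0))
    where
    lemma : ∀ i x → foldl (λ y _ → tail-tree y) x (replicate i tt) ≡ dropTree i x
    lemma zero    x = refl
    lemma (suc i) x = lemma i (tail-tree x)

  lookupP : {n : A → ℕ} {X : A → Set} {enc : Encoding X} {xs : ∀ a → Vec (X a) (n a)} {i : ∀ a → Fin (n a)} →
            Poly e (vec enc) xs → Poly e fin i → Poly e enc (λ a → lookup (xs a) (i a))
  lookupP {enc = enc} {xs} {i} P I = recode (λ a → lookup-dropTree (enc a) (xs a) (i a))
    (left (dropTreeP {i = λ a → toℕ (i a)} (recode (λ _ → refl) I) (recode (λ _ → refl) P)))

  -- In unary, `i ≤ j` holds exactly when `j` tails of `i` leave `nil`.
  ≤P : {i j : A → ℕ} → Poly e nat i → Poly e nat j → Poly e bool (λ a → does (i a ≤? j a))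
  ≤P {i} {j} I J = replace (λ a → lemma (i a) (j a))
    (caseTree (dropTreeP J (recode (λ _ → refl) I)) falseP trueP)
    where
    lemma : ∀ i j → branch (dropTree j (encodeℕ i)) false true ≡ does (i ≤? j)
    lemma i j with i ≤? j
    ... | yes i≤j = trans (cong (λ t → branch t false true)
                      (trans (dropTree-encodeℕ j i) (cong encodeℕ (m≤n⇒m∸n≡0 i≤j))))
                      (sym (dec-true (i ≤? j) i≤j))
    ... | no  i≰j = trans (cong (λ t → branch t false true) (dropTree-encodeℕ j i))
                      (trans (positive (i ∸ j) λ eq → i≰j (m∸n≡0⇒m≤n eq)) (sym (dec-false (i ≤? j) i≰j)))
      where
      positive : ∀ n → n ≢ 0 → branch (encodeℕ n) false true ≡ false
      positive zero    n≢0 = contradiction refl n≢0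
      positive (suc n) n≢0 = refl

  -- The suffixes of the input numeral are themselves the encodings of the elements, hence `paraP`.
  -- Consing them from the longest on leaves them in increasing order.
  allFinP : {n : A → ℕ} → Poly e nat n → Poly e (list fin) (λ a → allFin (n a))
  allFinP {n} N = recode
    (λ a → trans (cong (encodeList (λ t → t)) (trans (para-suffixes (n a) []) (List.++-identityʳ _)))
                 (encodeList-tabulate (λ v → encodeℕ (toℕ v)) encodeℕ (n a) (λ v → v) (λ _ → refl)))
    (paraP {encX = unit} {encS = list tree} {xs₀ = λ a → replicate (n a) tt}
      (λ _ _ xs ts → encodeList (λ _ → nil) xs ∷ ts) var
      (λ a _ xs ts → ≤-trans (≤-reflexive (+-comm (suc (size (encodeList (λ _ → nil) xs))) _))
        (+-monoʳ-≤ (size (encodeList (λ t → t) ts)) (s≤s (m≤n⇒m≤o+n (size (e a)) (m≤n⇒m≤1+n (m≤n⇒m≤1+n ≤-refl))))))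
      (recode (λ a → encodeℕ-replicate (n a)) N) []P
      (∷P (right (right (left environment))) v0))

  ≟P : {n : A → ℕ} {u v : ∀ a → Fin (n a)} → Poly e fin u → Poly e fin v →
       Poly e bool (λ a → does (u a Fin.≟ v a))
  ≟P {u = u} {v} U V = replace (λ a → lemma (u a) (v a)) (andP (≤P (toℕP U) (toℕP V)) (≤P (toℕP V) (toℕP U)))
    where
    toℕP : {n : A → ℕ} {u : ∀ a → Fin (n a)} → Poly e fin u → Poly e nat (λ a → toℕ (u a))
    toℕP = recode (λ _ → refl)
    lemma : ∀ {n} (u v : Fin n) → does (toℕ u ≤? toℕ v) ∧ does (toℕ v ≤? toℕ u) ≡ does (u Fin.≟ v)
    lemma u v with u Fin.≟ v
    ... | yes refl = cong (λ b → b ∧ b) (dec-true (toℕ u ≤? toℕ u) ≤-refl)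
    ... | no  u≢v with toℕ u ≤? toℕ v
    ...   | yes p = trans (cong (does (toℕ u ≤? toℕ v) ∧_)
                      (dec-false (toℕ v ≤? toℕ u) λ q → u≢v (Fin.toℕ-injective (≤-antisym p q)))) (∧-zeroʳ _)
    ...   | no ¬p = cong (_∧ does (toℕ v ≤? toℕ u)) (dec-false (toℕ u ≤? toℕ v) ¬p)

-- The search for a partition into triangles

Triple : ℕ → Set
Triple n = Fin n × Fin n × Fin n

module _ {n : ℕ} where

  infix 4 _∈ₜ_ _∈ₜ?_ _⊆_ _⊆?_ _≐_ _≐?_

  _∈ₜ_ : Fin n → Triple n → Set
  v ∈ₜ (a , b , c) = v ≡ a ⊎ v ≡ b ⊎ v ≡ c

  _∈ₜ?_ : ∀ v r → Dec (v ∈ₜ r)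
  v ∈ₜ? (a , b , c) = (v Fin.≟ a) ⊎-dec (v Fin.≟ b) ⊎-dec (v Fin.≟ c)

  allₜ? : {P : Fin n → Set} (P? : ∀ v → Dec (P v)) → ∀ r → Dec (∀ v → v ∈ₜ r → P v)
  allₜ? {P} P? (a , b , c) = map′ from to (P? a ×-dec P? b ×-dec P? c)
    where
    from : P a × P b × P c → ∀ v → v ∈ₜ (a , b , c) → P v
    from (p , q , r) v (inj₁ refl)        = p
    from (p , q , r) v (inj₂ (inj₁ refl)) = q
    from (p , q , r) v (inj₂ (inj₂ refl)) = r
    to : (∀ v → v ∈ₜ (a , b , c) → P v) → P a × P b × P c
    to f = f a (inj₁ refl) , f b (inj₂ (inj₁ refl)) , f c (inj₂ (inj₂ refl))

  -- The initial list has each triangle once for every order of its corners, so triples are compared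
  -- as sets.
  _⊆_ Disjoint _≐_ : Triple n → Triple n → Set
  r ⊆ s        = ∀ v → v ∈ₜ r → v ∈ₜ s
  Disjoint r s = ∀ v → v ∈ₜ r → ¬ v ∈ₜ s
  r ≐ s        = r ⊆ s × s ⊆ r

  _⊆?_ : ∀ r s → Dec (r ⊆ s)
  r ⊆? s = allₜ? (_∈ₜ? s) r

  disjoint? : ∀ r s → Dec (Disjoint r s)
  disjoint? r s = allₜ? (λ v → ¬? (v ∈ₜ? s)) r

  _≐?_ : ∀ r s → Dec (r ≐ s)
  r ≐? s = (r ⊆? s) ×-dec (s ⊆? r)

  ≐-trans : ∀ {r s t} → r ≐ s → s ≐ t → r ≐ t
  ≐-trans (f , g) (h , k) = (λ v → h v ∘ f v) , (λ v → g v ∘ k v)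

  ≐-sym : ∀ {r s} → r ≐ s → s ≐ r
  ≐-sym (f , g) = g , f

  Alive : List (Triple n) → Triple n → Set
  Alive A s = ∃[ r ] (r ∈ₗ A × r ≐ s)

  -- The alternative `r ⊆ t` spares `t` itself, with its corners in any order.
  commit : Triple n → List (Triple n) → List (Triple n)
  commit t A = filter (λ r → disjoint? r t ⊎-dec (r ⊆? t)) A

  Supported : List (Triple n) → Triple n → Set
  Supported A s = All (λ v → v ∈ₜ s ⊎ Any (λ r → v ∈ₜ r × Disjoint r s) A) (allFin n)

  supported? : ∀ A s → Dec (Supported A s)
  supported? A s = all? (λ v → (v ∈ₜ? s) ⊎-dec any? (λ r → (v ∈ₜ? r) ×-dec disjoint? r s) A) (allFin n)

  -- A triangle of a partition within A is supported, so prune keeps all such partitions.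
  prune : List (Triple n) → List (Triple n)
  prune A = filter (supported? A) A

  -- The list is its own clock: a round that changes it removes a candidate, so `length A` rounds
  -- reach a fixed point.
  propagate : List (Triple n) → List (Triple n)
  propagate A = foldl (λ B _ → prune B) A A

  attempt : List (Triple n) → Triple n → List (Triple n)
  attempt A t = when does (any? (_≐? t) (propagate (commit t A))) then propagate (commit t A) else A

  Same : List (Triple n) → Fin n → Fin n → Set
  Same A u v = Any (λ r → u ∈ₜ r × v ∈ₜ r) A

  same? : ∀ A u v → Dec (Same A u v)
  same? A u v = any? (λ r → (u ∈ₜ? r) ×-dec (v ∈ₜ? r)) A

  prune-⊆ : ∀ {A r} → r ∈ₗ prune A → r ∈ₗ A
  prune-⊆ {A} = proj₁ ∘ ∈-filter⁻ (supported? A)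

  pruneAll-⊆ : ∀ {A r} (xs : List (Triple n)) → r ∈ₗ foldl (λ B _ → prune B) A xs → r ∈ₗ A
  pruneAll-⊆ []       r∈ = r∈
  pruneAll-⊆ (_ ∷ xs) r∈ = prune-⊆ (pruneAll-⊆ xs r∈)

  commit-⊆ : ∀ t {A r} → r ∈ₗ commit t A → r ∈ₗ A
  commit-⊆ t = proj₁ ∘ ∈-filter⁻ (λ r → disjoint? r t ⊎-dec (r ⊆? t))

  propagate-⊆ : ∀ {A r} → r ∈ₗ propagate A → r ∈ₗ A
  propagate-⊆ {A} = pruneAll-⊆ A

  commit-compatible : ∀ t {A r} → r ∈ₗ commit t A → Disjoint r t ⊎ r ⊆ t
  commit-compatible t {A} = proj₂ ∘ ∈-filter⁻ (λ r → disjoint? r t ⊎-dec (r ⊆? t)) {xs = A}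

  attempt-⊆ : ∀ {A t r} → r ∈ₗ attempt A t → r ∈ₗ A
  attempt-⊆ {A} {t} r∈ with does (any? (_≐? t) (propagate (commit t A)))
  ... | true  = commit-⊆ t (propagate-⊆ r∈)
  ... | false = r∈

  attempts-⊆ : ∀ {A r} ts → r ∈ₗ foldl attempt A ts → r ∈ₗ A
  attempts-⊆ []       r∈ = r∈
  attempts-⊆ (t ∷ ts) r∈ = attempt-⊆ (attempts-⊆ ts r∈)

  Stabilised : List (Triple n) → Set
  Stabilised A = All (Supported A) A

  pruneAll-stabilised : ∀ A (xs : List (Triple n)) → length A ≤ length xs →
                        Stabilised (foldl (λ B _ → prune B) A xs)
  pruneAll-stabilised []  []       _  = []
  pruneAll-stabilised A   (x ∷ xs) le with all? (supported? A) A
  ... | yes p = subst Stabilised (sym (stays (x ∷ xs))) p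
    where
    stays : ∀ xs → foldl (λ B _ → prune B) A xs ≡ A
    stays []       = refl
    stays (_ ∷ xs) = trans (cong (λ B → foldl (λ B _ → prune B) B xs) (List.filter-all (supported? A) p)) (stays xs)
  ... | no ¬p = pruneAll-stabilised (prune A) xs
    (s≤s⁻¹ (≤-trans (List.filter-notAll (supported? A) A (¬All⇒Any¬ (supported? A) A ¬p)) le))

  propagate-stabilised : ∀ A → Stabilised (propagate A)
  propagate-stabilised A = pruneAll-stabilised A A ≤-refl

  support : ∀ {A s} → Stabilised A → s ∈ₗ A → ∀ v → ¬ v ∈ₜ s → ∃[ r ] (r ∈ₗ A × v ∈ₜ r × Disjoint r s)
  support st s∈ v v∉s with All.lookup (All.lookup st s∈) (∈-allFin v)
  ... | inj₁ v∈s = contradiction v∈s v∉s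
  ... | inj₂ a   = find a

-- Decompositions as permutations

injective⇒surjective : ∀ {n} (f : Fin n → Fin n) → (∀ {x y} → f x ≡ f y → x ≡ y) → ∀ y → ∃[ x ] f x ≡ y
injective⇒surjective {suc n} f inj y with Fin.any? (λ x → f x Fin.≟ y)
... | yes p = p
... | no ¬p = contradiction (Fin.injective⇒≤ {f = λ x → punchOut (y≢ x)} λ eq → inj (Fin.punchOut-injective (y≢ _) (y≢ _) eq)) 1+n≰n
  where
  y≢ : ∀ x → y ≢ f x
  y≢ x eq = ¬p (x , sym eq)

iterate : {X : Set} → (X → X) → ℕ → X → X
iterate f zero    x = x
iterate f (suc i) x = f (iterate f i x)

module Triangulation {n : ℕ} (adj : Fin n → Fin n → Bool)
                     (adj-sym : ∀ u v → adj u v ≡ adj v u) (adj-irrefl : ∀ v → adj v v ≡ false)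
                     (4≤n : 4 ≤ n) where

  Edge : Fin n → Fin n → Set
  Edge u v = adj u v ≡ true

  edge-sym : ∀ {u v} → Edge u v → Edge v u
  edge-sym {u} {v} = trans (adj-sym v u)

  edge-irrefl : ∀ {u v} → Edge u v → u ≢ v
  edge-irrefl {u} e refl with trans (sym e) (adj-irrefl u)
  ... | ()

  Triangle : Triple n → Set
  Triangle (a , b , c) = Edge a b × Edge b c × Edge a c

  -- A decomposition in the form of permutations: `next` follows the Hamilton cycle and `mate` goes
  -- round each triangle, both with a chosen orientation. In this form exchanging vertices is
  -- conjugation. `cyclic` says that `next` has a single orbit.
  record Splitting : Set where
    field
      next prev mate : Fin n → Fin n
      next-prev  : ∀ v → next (prev v) ≡ v
      prev-next  : ∀ v → prev (next v) ≡ v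
      mate³      : ∀ v → mate (mate (mate v)) ≡ v
      cyclic     : ∀ v i j → i < n → j < n → iterate next i v ≡ iterate next j v → i ≡ j
      neighbour  : ∀ {u v} → Edge u v → v ≡ next u ⊎ v ≡ prev u ⊎ v ≡ mate u ⊎ v ≡ mate (mate u)
      edge-next  : ∀ v → Edge v (next v)
      edge-mate  : ∀ v → Edge v (mate v)
      next≢mate  : ∀ v → next v ≢ mate v
      next≢mate² : ∀ v → next v ≢ mate (mate v)

    block path : Fin n → Triple n
    block v = v , mate v , mate (mate v)
    path v  = prev v , v , next v

    edge-prev : ∀ v → Edge v (prev v)
    edge-prev v = edge-sym (subst (Edge (prev v)) (next-prev v) (edge-next (prev v)))

    edge-mate² : ∀ v → Edge v (mate (mate v))
    edge-mate² v = edge-sym (subst (Edge (mate (mate v))) (mate³ v) (edge-mate (mate (mate v))))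

    prev≢mate : ∀ v → prev v ≢ mate v
    prev≢mate v eq = next≢mate² (mate v) (trans (trans (cong next (sym eq)) (next-prev v)) (sym (mate³ v)))

    prev≢mate² : ∀ v → prev v ≢ mate (mate v)
    prev≢mate² v eq = next≢mate (mate (mate v)) (trans (trans (cong next (sym eq)) (next-prev v)) (sym (mate³ v)))

    next-injective : ∀ {u v} → next u ≡ next v → u ≡ v
    next-injective eq = trans (sym (prev-next _)) (trans (cong prev eq) (prev-next _))

    prev-injective : ∀ {u v} → prev u ≡ prev v → u ≡ v
    prev-injective eq = trans (sym (next-prev _)) (trans (cong next eq) (next-prev _))

    next²≢ : ∀ v → next (next v) ≢ v
    next²≢ v eq with cyclic v 2 0 (≤-trans (s≤s (s≤s (s≤s z≤n))) 4≤n) (≤-trans (s≤s z≤n) 4≤n) eq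
    ... | ()

    -- Here `4 ≤ n` enters: on a cycle of length three the ends of an arc would be neighbours.
    next³≢ : ∀ v → next (next (next v)) ≢ v
    next³≢ v eq with cyclic v 3 0 4≤n (≤-trans (s≤s z≤n) 4≤n) eq
    ... | ()

    next≢prev : ∀ v → next v ≢ prev v
    next≢prev v eq = next²≢ v (trans (cong next eq) (next-prev v))

    next²≢prev : ∀ v → next (next v) ≢ prev v
    next²≢prev v eq = next³≢ v (trans (cong next eq) (next-prev v))

    prev²≢next : ∀ v → prev (prev v) ≢ next v
    prev²≢next v eq = next²≢prev (prev v) (trans (cong next (next-prev v)) (sym eq))

    block-trans : ∀ {u v w} → v ∈ₜ block u → w ∈ₜ block v → w ∈ₜ block u
    block-trans (inj₁ refl)        q                  = q
    block-trans p                  (inj₁ refl)        = p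
    block-trans (inj₂ (inj₁ refl)) (inj₂ (inj₁ refl)) = inj₂ (inj₂ refl)
    block-trans (inj₂ (inj₁ refl)) (inj₂ (inj₂ refl)) = inj₁ (mate³ _)
    block-trans (inj₂ (inj₂ refl)) (inj₂ (inj₁ refl)) = inj₁ (mate³ _)
    block-trans (inj₂ (inj₂ refl)) (inj₂ (inj₂ refl)) = inj₂ (inj₁ (cong mate (mate³ _)))

    block-sym : ∀ {u v} → v ∈ₜ block u → u ∈ₜ block v
    block-sym (inj₁ refl)        = inj₁ refl
    block-sym (inj₂ (inj₁ refl)) = inj₂ (inj₂ (sym (mate³ _)))
    block-sym (inj₂ (inj₂ refl)) = inj₂ (inj₁ (sym (mate³ _)))

    Contained : List (Triple n) → Set
    Contained A = ∀ v → Alive A (block v)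

    prune-contained : ∀ {A} → Contained A → Contained (prune A)
    prune-contained {A} al v with al v
    ... | r , r∈ , r≐ = r , ∈-filter⁺ (supported? A) r∈ (All.tabulate λ {u} _ → supported u) , r≐
      where
      supported : ∀ u → u ∈ₜ r ⊎ Any (λ r′ → u ∈ₜ r′ × Disjoint r′ r) A
      supported u with u ∈ₜ? r
      ... | yes u∈ = inj₁ u∈
      ... | no  u∉ with al u
      ...   | r′ , r′∈ , r′≐ = inj₂ (lose r′∈ (proj₂ r′≐ u (inj₁ refl) , λ w w∈r′ w∈r →
        u∉ (proj₂ r≐ u (block-trans (proj₁ r≐ w w∈r) (block-sym (proj₁ r′≐ w w∈r′))))))

    propagate-contained : ∀ {A} → Contained A → Contained (propagate A)
    propagate-contained {A} = go A
      where
      go : ∀ {A} (xs : List (Triple n)) → Contained A → Contained (foldl (λ B _ → prune B) A xs)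
      go []       al = al
      go (_ ∷ xs) al = go xs (prune-contained al)

    -- Blocks are equal or disjoint, and `t` is one of them.
    commit-contained : ∀ {A t v} → t ≐ block v → Contained A → Contained (commit t A)
    commit-contained {A} {t} {v} t≐ al u with al u
    ... | r , r∈ , r≐ = r , ∈-filter⁺ (λ r → disjoint? r t ⊎-dec (r ⊆? t)) r∈ compatible , r≐
      where
      compatible : Disjoint r t ⊎ r ⊆ t
      compatible with u ∈ₜ? block v
      ... | yes u∈ = inj₂ λ w w∈ → proj₂ t≐ w (block-trans u∈ (proj₁ r≐ w w∈))
      ... | no  u∉ = inj₁ λ w w∈r w∈t → u∉ (block-trans (proj₁ t≐ w w∈t) (block-sym (proj₁ r≐ w w∈r)))


  triangle-edge : ∀ {r u v} → Triangle r → u ∈ₜ r → v ∈ₜ r → u ≢ v → Edge u v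
  triangle-edge (ab , bc , ac) (inj₁ refl)        (inj₁ refl)        u≢v = contradiction refl u≢v
  triangle-edge (ab , bc , ac) (inj₁ refl)        (inj₂ (inj₁ refl)) u≢v = ab
  triangle-edge (ab , bc , ac) (inj₁ refl)        (inj₂ (inj₂ refl)) u≢v = ac
  triangle-edge (ab , bc , ac) (inj₂ (inj₁ refl)) (inj₁ refl)        u≢v = edge-sym ab
  triangle-edge (ab , bc , ac) (inj₂ (inj₁ refl)) (inj₂ (inj₁ refl)) u≢v = contradiction refl u≢v
  triangle-edge (ab , bc , ac) (inj₂ (inj₁ refl)) (inj₂ (inj₂ refl)) u≢v = bc
  triangle-edge (ab , bc , ac) (inj₂ (inj₂ refl)) (inj₁ refl)        u≢v = edge-sym ac
  triangle-edge (ab , bc , ac) (inj₂ (inj₂ refl)) (inj₂ (inj₁ refl)) u≢v = edge-sym bc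
  triangle-edge (ab , bc , ac) (inj₂ (inj₂ refl)) (inj₂ (inj₂ refl)) u≢v = contradiction refl u≢v

  swapˡ : ∀ {a b c : Fin n} → (a , b , c) ≐ (b , a , c)
  swapˡ = swap , swap
    where
    swap : ∀ {a b c : Fin n} → (a , b , c) ⊆ (b , a , c)
    swap v (inj₁ p)        = inj₂ (inj₁ p)
    swap v (inj₂ (inj₁ p)) = inj₁ p
    swap v (inj₂ (inj₂ p)) = inj₂ (inj₂ p)

  swapʳ : ∀ {a b c : Fin n} → (a , b , c) ≐ (a , c , b)
  swapʳ = swap , swap
    where
    swap : ∀ {a b c : Fin n} → (a , b , c) ⊆ (a , c , b)
    swap v (inj₁ p)        = inj₁ p
    swap v (inj₂ (inj₁ p)) = inj₂ (inj₂ p)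
    swap v (inj₂ (inj₂ p)) = inj₂ (inj₁ p)

  ≐-refl : ∀ {r : Triple n} → r ≐ r
  ≐-refl = (λ _ → id) , (λ _ → id)

  -- Bringing `w` to the middle leaves only the two edges at `w` to be distinguished.
  centre : ∀ {r w} → Triangle r → w ∈ₜ r →
           ∃[ x ] ∃[ y ] (r ≐ (x , w , y) × Edge w x × Edge w y × Edge x y)
  centre (ab , bc , ac) (inj₁ refl)        = _ , _ , swapˡ , ab , ac , bc
  centre (ab , bc , ac) (inj₂ (inj₁ refl)) = _ , _ , ≐-refl , edge-sym ab , bc , ac
  centre (ab , bc , ac) (inj₂ (inj₂ refl)) = _ , _ , swapʳ , edge-sym ac , edge-sym bc , ab

  module _ (σ : Splitting) where
    open Splitting σ

    private
      Near Mates : Fin n → Fin n → Set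
      Near u v  = v ≡ next u ⊎ v ≡ prev u
      Mates u v = v ≡ mate u ⊎ v ≡ mate (mate u)

      near-sym : ∀ {u v} → Near u v → Near v u
      near-sym (inj₁ refl) = inj₂ (sym (prev-next _))
      near-sym (inj₂ refl) = inj₁ (sym (next-prev _))

      mates-sym : ∀ {u v} → Mates u v → Mates v u
      mates-sym (inj₁ refl) = inj₂ (sym (mate³ _))
      mates-sym (inj₂ refl) = inj₁ (sym (mate³ _))

      kind : ∀ {u v} → Edge u v → Near u v ⊎ Mates u v
      kind e with neighbour e
      ... | inj₁ p               = inj₁ (inj₁ p)
      ... | inj₂ (inj₁ p)        = inj₁ (inj₂ p)
      ... | inj₂ (inj₂ (inj₁ p)) = inj₂ (inj₁ p)
      ... | inj₂ (inj₂ (inj₂ p)) = inj₂ (inj₂ p)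

      near² : ∀ {w x y} → Near w x → Near w y → x ≢ y → (x , w , y) ≐ path w
      near² (inj₁ refl) (inj₁ refl) x≢y = contradiction refl x≢y
      near² (inj₁ refl) (inj₂ refl) x≢y = ≐-trans swapˡ (≐-trans swapʳ swapˡ)
      near² (inj₂ refl) (inj₁ refl) x≢y = ≐-refl
      near² (inj₂ refl) (inj₂ refl) x≢y = contradiction refl x≢y

      mates² : ∀ {w x y} → Mates w x → Mates w y → x ≢ y → (x , w , y) ≐ block w
      mates² (inj₁ refl) (inj₁ refl) x≢y = contradiction refl x≢y
      mates² (inj₁ refl) (inj₂ refl) x≢y = swapˡ
      mates² (inj₂ refl) (inj₁ refl) x≢y = ≐-trans swapˡ swapʳ
      mates² (inj₂ refl) (inj₂ refl) x≢y = contradiction refl x≢y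

    -- Two of the three edges are of the same kind, and they share a vertex.
    classify : ∀ t → Triangle t → (∃[ v ] t ≐ block v) ⊎ (∃[ j ] t ≐ path j)
    classify (x , w , y) (xw , wy , xy) with kind xw | kind wy | kind xy
    ... | inj₁ p | inj₁ q | _      = inj₂ (_ , near² (near-sym p) q (edge-irrefl xy))
    ... | inj₂ p | inj₂ q | _      = inj₁ (_ , mates² (mates-sym p) q (edge-irrefl xy))
    ... | inj₁ p | inj₂ _ | inj₁ r = inj₂ (_ , ≐-trans swapˡ (near² p r (edge-irrefl wy)))
    ... | inj₂ p | inj₁ _ | inj₂ r = inj₁ (_ , ≐-trans swapˡ (mates² p r (edge-irrefl wy)))
    ... | inj₁ _ | inj₂ q | inj₂ r = inj₁ (_ , ≐-trans swapʳ (mates² (mates-sym r) (mates-sym q) (edge-irrefl xw)))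
    ... | inj₂ _ | inj₁ q | inj₁ r = inj₂ (_ , ≐-trans swapʳ (near² (near-sym r) (near-sym q) (edge-irrefl xw)))

    -- Of the four neighbours of `w` only `next w` and `prev w` are left as further corners, and the
    -- triangle has to use both.
    path-through : ∀ {r w} → Triangle r → w ∈ₜ r → ¬ mate w ∈ₜ r → ¬ mate (mate w) ∈ₜ r → r ≐ path w
    path-through {r} {w} tri w∈ m∉ m²∉ with centre tri w∈
    ... | x , y , r≐ , wx , wy , xy with kind wx | kind wy
    ...   | inj₁ p           | inj₁ q           = ≐-trans r≐ (near² p q (edge-irrefl xy))
    ...   | inj₂ (inj₁ refl) | _                = contradiction (proj₂ r≐ x (inj₁ refl)) m∉
    ...   | inj₂ (inj₂ refl) | _                = contradiction (proj₂ r≐ x (inj₁ refl)) m²∉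
    ...   | inj₁ _           | inj₂ (inj₁ refl) = contradiction (proj₂ r≐ y (inj₂ (inj₂ refl))) m∉
    ...   | inj₁ _           | inj₂ (inj₂ refl) = contradiction (proj₂ r≐ y (inj₂ (inj₂ refl))) m²∉

  -- Exchanging along surviving arcs

  module Exchange (σ : Splitting) (B : List (Triple n)) (triangles : ∀ {r} → r ∈ₗ B → Triangle r)
                  (stable : Stabilised B) where
    open Splitting σ

    -- What a successful commitment to the arc around `j` achieves: the arc survives, and every
    -- candidate that meets it lies inside it. The second half keeps the arcs of different centres
    -- apart.
    Flip : Fin n → Set
    Flip j = Alive B (path j) × All (λ s → Disjoint s (path j) ⊎ s ⊆ path j) B

    abstract
      flip? : ∀ j → Dec (Flip j)
      flip? j = map′ find (λ (r , r∈ , r≐) → lose r∈ r≐) (any? (_≐? path j) B)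
        ×-dec all? (λ s → disjoint? s (path j) ⊎-dec (s ⊆? path j)) B

    -- As the arc survives as a triangle, its ends are adjacent in the graph. With at least four
    -- vertices they are not consecutive on the cycle, so they are mates.
    ends : ∀ {j} → Flip j → mate (prev j) ≡ next j ⊎ mate (mate (prev j)) ≡ next j
    ends {j} ((r , r∈ , r≐) , _)
      with neighbour (triangle-edge (triangles r∈) (proj₂ r≐ _ (inj₁ refl)) (proj₂ r≐ _ (inj₂ (inj₂ refl)))
                       (next≢prev j ∘ sym))
    ... | inj₁ eq               = contradiction (trans eq (next-prev j)) (edge-irrefl (edge-next j) ∘ sym)
    ... | inj₂ (inj₁ eq)        = contradiction (sym eq) (prev²≢next j)
    ... | inj₂ (inj₂ (inj₁ eq)) = inj₁ (sym eq)
    ... | inj₂ (inj₂ (inj₂ eq)) = inj₂ (sym eq)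

    -- The third corner of the triangle on prev j and next j; a junk value if these are not mates.
    third : Fin n → Fin n
    third j = when does (mate (prev j) Fin.≟ next j) then mate (next j) else mate (prev j)

    -- `mate` orients every triangle, so the one on `prev j`, `next j` and `third j` can be
    -- traversed in two ways; the lemmas about it split accordingly.
    Corners : Fin n → Fin n → Fin n → Set
    Corners p q w = mate p ≡ q × mate q ≡ w × mate w ≡ p

    corners : ∀ {j} → Flip j → Corners (prev j) (next j) (third j) ⊎ Corners (next j) (prev j) (third j)
    corners {j} f with mate (prev j) Fin.≟ next j | ends f
    ... | yes eq | _       = inj₁ (eq , refl , trans (cong (mate ∘ mate) (sym eq)) (mate³ _))
    ... | no ¬eq | inj₁ eq = contradiction eq ¬eq
    ... | no ¬eq | inj₂ eq = inj₂ (trans (cong mate (sym eq)) (mate³ _) , refl , eq)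

    third-mates : ∀ {j} → Flip j → (mate (third j) ≡ prev j × mate (mate (third j)) ≡ next j) ⊎
                                   (mate (third j) ≡ next j × mate (mate (third j)) ≡ prev j)
    third-mates f with corners f
    ... | inj₁ (a , b , c) = inj₁ (c , trans (cong mate c) a)
    ... | inj₂ (a , b , c) = inj₂ (c , trans (cong mate c) a)

    prev-mates : ∀ {j} → Flip j → (mate (prev j) ≡ next j × mate (mate (prev j)) ≡ third j) ⊎
                                  (mate (prev j) ≡ third j × mate (mate (prev j)) ≡ next j)
    prev-mates f with corners f
    ... | inj₁ (a , b , c) = inj₁ (a , trans (cong mate a) b)
    ... | inj₂ (a , b , c) = inj₂ (b , trans (cong mate b) c)

    next-mates : ∀ {j} → Flip j → (mate (next j) ≡ prev j × mate (mate (next j)) ≡ third j) ⊎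
                                  (mate (next j) ≡ third j × mate (mate (next j)) ≡ prev j)
    next-mates f with corners f
    ... | inj₁ (a , b , c) = inj₂ (b , trans (cong mate b) c)
    ... | inj₂ (a , b , c) = inj₁ (a , trans (cong mate a) b)

    mate≢ : ∀ v → mate v ≢ v
    mate≢ v = edge-irrefl (edge-mate v) ∘ sym

    mate²≢ : ∀ v → mate (mate v) ≢ v
    mate²≢ v = edge-irrefl (edge-mate² v) ∘ sym

    third≢prev : ∀ {j} → Flip j → third j ≢ prev j
    third≢prev {j} f eq with prev-mates f
    ... | inj₁ (_ , m) = mate²≢ (prev j) (trans m eq)
    ... | inj₂ (m , _) = mate≢ (prev j) (trans m eq)

    third≢next : ∀ {j} → Flip j → third j ≢ next j
    third≢next {j} f eq with next-mates f
    ... | inj₁ (_ , m) = mate²≢ (next j) (trans m eq)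
    ... | inj₂ (m , _) = mate≢ (next j) (trans m eq)

    -- Otherwise the cycle edge from `prev j` to `j` would also be a triangle edge.
    third≢ : ∀ {j} → Flip j → third j ≢ j
    third≢ {j} f eq with prev-mates f
    ... | inj₁ (_ , m) = next≢mate² (prev j) (trans (next-prev j) (trans (sym eq) (sym m)))
    ... | inj₂ (m , _) = next≢mate (prev j) (trans (next-prev j) (trans (sym eq) (sym m)))

    third∉path : ∀ {j} → Flip j → ¬ third j ∈ₜ path j
    third∉path f (inj₁ eq)        = third≢prev f eq
    third∉path f (inj₂ (inj₁ eq)) = third≢ f eq
    third∉path f (inj₂ (inj₂ eq)) = third≢next f eq

    -- A candidate through `third j` does not lie inside the arc around `j`, so it avoids that arc
    -- and with it both mates of `third j`.
    path-at-third : ∀ {j r} → Flip j → r ∈ₗ B → third j ∈ₜ r → r ≐ path (third j)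
    path-at-third {j} {r} f r∈ w∈ = path-through σ (triangles r∈) w∈ m∉ m²∉
      where
      disjoint : Disjoint r (path j)
      disjoint with All.lookup (proj₂ f) r∈
      ... | inj₁ d   = d
      ... | inj₂ r⊆ = contradiction (r⊆ _ w∈) (third∉path f)
      m∉ : ¬ mate (third j) ∈ₜ r
      m∉ m∈ with third-mates f
      ... | inj₁ (eq , _) = disjoint _ m∈ (inj₁ eq)
      ... | inj₂ (eq , _) = disjoint _ m∈ (inj₂ (inj₂ eq))
      m²∉ : ¬ mate (mate (third j)) ∈ₜ r
      m²∉ m∈ with third-mates f
      ... | inj₁ (_ , eq) = disjoint _ m∈ (inj₂ (inj₂ eq))
      ... | inj₂ (_ , eq) = disjoint _ m∈ (inj₁ eq)

    -- Stability is used twice. The surviving arc around `j` needs a candidate covering `third j`,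
    -- and every `s` off `third j` needs one that is disjoint from `s`. By `path-at-third` either
    -- candidate is the arc around `third j`.
    third-flip : ∀ {j} → Flip j → Flip (third j)
    third-flip {j} f@((r , r∈ , r≐) , _) = alive , All.tabulate separated
      where
      alive : Alive B (path (third j))
      alive with support stable r∈ (third j) (third∉path f ∘ proj₁ r≐ _)
      ... | r′ , r′∈ , w∈ , _ = r′ , r′∈ , path-at-third f r′∈ w∈
      separated : ∀ {s} → s ∈ₗ B → Disjoint s (path (third j)) ⊎ s ⊆ path (third j)
      separated {s} s∈ with third j ∈ₜ? s
      ... | yes w∈ = inj₂ (proj₁ (path-at-third f s∈ w∈))
      ... | no  w∉ with support stable s∈ (third j) w∉
      ...   | r′ , r′∈ , w∈ , d = inj₁ λ v v∈s v∈p → d v (proj₂ (path-at-third f r′∈ w∈) v v∈p) v∈s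

    -- If the arcs meet, the first lies inside the second. With at least four vertices an arc
    -- shifted by one step sticks out, so the centres agree.
    flip-unique : ∀ {i j x} → Flip i → Flip j → x ∈ₜ path i → x ∈ₜ path j → i ≡ j
    flip-unique {i} {j} {x} ((r , r∈ , r≐) , _) (_ , sep) x∈i x∈j with All.lookup sep r∈
    ... | inj₁ d   = contradiction x∈j (d x (proj₂ r≐ x x∈i))
    ... | inj₂ r⊆ with r⊆ _ (proj₂ r≐ i (inj₂ (inj₁ refl)))
    ...   | inj₂ (inj₁ eq) = eq
    ...   | inj₁ refl with r⊆ _ (proj₂ r≐ _ (inj₁ refl))
    ...     | inj₁ eq        = contradiction (sym eq) (edge-irrefl (edge-prev (prev j)))
    ...     | inj₂ (inj₁ eq) = contradiction (trans (trans (cong next (sym eq)) (next-prev (prev j))) refl)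
                                 (next≢prev j)
    ...     | inj₂ (inj₂ eq) = contradiction eq (prev²≢next j)
    flip-unique {i} {j} ((r , r∈ , r≐) , _) (_ , sep) x∈i x∈j
        | inj₂ r⊆ | inj₂ (inj₂ refl) with r⊆ _ (proj₂ r≐ _ (inj₂ (inj₂ refl)))
    ...     | inj₁ eq        = contradiction eq (next²≢prev j)
    ...     | inj₂ (inj₁ eq) = contradiction eq (next²≢ j)
    ...     | inj₂ (inj₂ eq) = contradiction (sym eq) (edge-irrefl (edge-next (next j)))

    -- The mates of `third i` are the ends of the arc around `i`, so equal thirds force the two arcs
    -- to share an end.
    third-injective : ∀ {i j} → Flip i → Flip j → third i ≡ third j → i ≡ j
    third-injective {i} {j} f g eq with third-mates f | third-mates g
    ... | inj₁ (a , _) | inj₁ (b , _) = prev-injective (trans (sym a) (trans (cong mate eq) b))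
    ... | inj₂ (a , _) | inj₂ (b , _) = next-injective (trans (sym a) (trans (cong mate eq) b))
    ... | inj₁ (a , _) | inj₂ (b , _) =
      flip-unique f g (inj₁ refl) (inj₂ (inj₂ (trans (sym a) (trans (cong mate eq) b))))
    ... | inj₂ (a , _) | inj₁ (b , _) =
      flip-unique f g (inj₂ (inj₂ refl)) (inj₁ (trans (sym a) (trans (cong mate eq) b)))

    -- On the cycle `third j` takes the place of `j`, while in its triangle `j` takes the place of
    -- `third j`. As `third` need not be an involution, `next′` and `mate′` are conjugated in
    -- opposite directions.
    exchange : Fin n → Fin n
    exchange v = when does (flip? v) then third v else v

    exchange-flip : ∀ {v} → Flip v → exchange v ≡ third v
    exchange-flip {v} f = cong (λ b → when b then third v else v) (dec-true (flip? v) f)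

    exchange-fix : ∀ {v} → ¬ Flip v → exchange v ≡ v
    exchange-fix {v} ¬f = cong (λ b → when b then third v else v) (dec-false (flip? v) ¬f)

    -- `third` takes centres to centres, so a moved vertex and a fixed one never have the same
    -- image.
    exchange-injective : ∀ {u v} → exchange u ≡ exchange v → u ≡ v
    exchange-injective {u} {v} eq = compare (flip? u) (flip? v)
      where
      compare : Dec (Flip u) → Dec (Flip v) → u ≡ v
      compare (yes f) (yes g) =
        third-injective f g (trans (sym (exchange-flip f)) (trans eq (exchange-flip g)))
      compare (yes f) (no ¬g) = contradiction
        (subst Flip (trans (sym (exchange-flip f)) (trans eq (exchange-fix ¬g))) (third-flip f)) ¬g
      compare (no ¬f) (yes g) = contradiction
        (subst Flip (trans (sym (exchange-flip g)) (trans (sym eq) (exchange-fix ¬f))) (third-flip g)) ¬f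
      compare (no ¬f) (no ¬g) = trans (sym (exchange-fix ¬f)) (trans eq (exchange-fix ¬g))

    abstract
      exchange⁻¹ : Fin n → Fin n
      exchange⁻¹ v = proj₁ (injective⇒surjective exchange exchange-injective v)

      exchange-exchange⁻¹ : ∀ v → exchange (exchange⁻¹ v) ≡ v
      exchange-exchange⁻¹ v = proj₂ (injective⇒surjective exchange exchange-injective v)

    exchange⁻¹-exchange : ∀ v → exchange⁻¹ (exchange v) ≡ v
    exchange⁻¹-exchange v = exchange-injective (exchange-exchange⁻¹ (exchange v))

    exchange⁻¹-fix : ∀ {v} → ¬ Flip v → exchange⁻¹ v ≡ v
    exchange⁻¹-fix {v} ¬f = trans (cong exchange⁻¹ (sym (exchange-fix ¬f))) (exchange⁻¹-exchange v)

    exchange⁻¹-third : ∀ {v} → Flip v → exchange⁻¹ (third v) ≡ v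
    exchange⁻¹-third {v} f = trans (cong exchange⁻¹ (sym (exchange-flip f))) (exchange⁻¹-exchange v)

    third-surjective : ∀ {v} → Flip v → ∃[ u ] (Flip u × third u ≡ v)
    third-surjective {v} f with flip? (exchange⁻¹ v)
    ... | yes g = _ , g , trans (sym (exchange-flip g)) (exchange-exchange⁻¹ v)
    ... | no ¬g = contradiction (subst Flip (trans (sym (exchange-exchange⁻¹ v)) (exchange-fix ¬g)) f) ¬g

    -- Conjugation keeps next′ a single cycle and mate′ of order three without further argument.
    next′ prev′ mate′ : Fin n → Fin n
    next′ = exchange ∘ next ∘ exchange⁻¹
    prev′ = exchange ∘ prev ∘ exchange⁻¹
    mate′ = exchange⁻¹ ∘ mate ∘ exchange

    mate′² : ∀ v → mate′ (mate′ v) ≡ exchange⁻¹ (mate (mate (exchange v)))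
    mate′² v = cong (exchange⁻¹ ∘ mate) (exchange-exchange⁻¹ _)

    -- Arcs of distinct centres are disjoint, so centres are at least three steps apart on the
    -- cycle. Hence `exchange` fixes the vertices one or two steps from a centre.
    ¬flip-prev : ∀ {j} → Flip j → ¬ Flip (prev j)
    ¬flip-prev f g = edge-irrefl (edge-prev _) (flip-unique f g (inj₁ refl) (inj₂ (inj₁ refl)))

    ¬flip-next : ∀ {j} → Flip j → ¬ Flip (next j)
    ¬flip-next f g = edge-irrefl (edge-next _) (flip-unique f g (inj₂ (inj₂ refl)) (inj₂ (inj₁ refl)))

    ¬flip-prev² : ∀ {j} → Flip j → ¬ Flip (prev (prev j))
    ¬flip-prev² {j} f g = next²≢ (prev (prev j))
      (trans (cong next (next-prev (prev j)))
        (trans (next-prev j) (flip-unique f g (inj₁ refl) (inj₂ (inj₂ (sym (next-prev (prev j))))))))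

    ¬flip-next² : ∀ {j} → Flip j → ¬ Flip (next (next j))
    ¬flip-next² {j} f g = next²≢ j (sym (flip-unique f g (inj₂ (inj₂ refl)) (inj₁ (sym (prev-next (next j))))))

    Untouched : Fin n → Set
    Untouched v = ¬ Flip v × ¬ Flip (next v) × ¬ Flip (prev v)

    -- The neighbours of v after the exchange: a and b on the cycle, c and d in the triangle.
    record Local (v : Fin n) : Set where
      field
        a b c d : Fin n
        next′≡  : next′ v ≡ a
        prev′≡  : prev′ v ≡ b
        mates′  : (mate′ v ≡ c × mate′ (mate′ v) ≡ d) ⊎ (mate′ v ≡ d × mate′ (mate′ v) ≡ c)
        edge-a  : Edge v a
        edge-c  : Edge v c
        edge-d  : Edge v d
        a≢c     : a ≢ c
        a≢d     : a ≢ d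
        cover   : ∀ {x} → Edge v x → x ≡ a ⊎ x ≡ b ⊎ x ≡ c ⊎ x ≡ d
        -- Either the new triangle is a surviving arc, or `v` keeps its old one;
        -- `exchanged-contained` relies on this dichotomy.
        block′  : Alive B (v , c , d) ⊎ (Untouched v × (v , c , d) ≡ block v)

    mates-fix : ∀ {v c d c₀ d₀} → exchange⁻¹ c₀ ≡ c → exchange⁻¹ d₀ ≡ d →
      (mate (exchange v) ≡ c₀ × mate (mate (exchange v)) ≡ d₀) ⊎
      (mate (exchange v) ≡ d₀ × mate (mate (exchange v)) ≡ c₀) →
      (mate′ v ≡ c × mate′ (mate′ v) ≡ d) ⊎ (mate′ v ≡ d × mate′ (mate′ v) ≡ c)
    mates-fix {v} p q (inj₁ (r , s)) =
      inj₁ (trans (cong exchange⁻¹ r) p , trans (mate′² v) (trans (cong exchange⁻¹ s) q))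
    mates-fix {v} p q (inj₂ (r , s)) =
      inj₂ (trans (cong exchange⁻¹ r) q , trans (mate′² v) (trans (cong exchange⁻¹ s) p))

    alive-≐ : ∀ {A} {r s : Triple n} → r ≐ s → Alive A r → Alive A s
    alive-≐ r≐s (t , t∈ , t≐) = t , t∈ , ≐-trans t≐ r≐s

    -- Two edges at `prev j` change roles: the one to `j` leaves the cycle for a triangle, and the
    -- one to `third j` goes the other way.
    local-prev : ∀ {j} → Flip j → Local (prev j)
    local-prev {j} f = record
      { a = third j ; b = prev (prev j) ; c = next j ; d = j
      ; next′≡ = trans (cong (exchange ∘ next) (exchange⁻¹-fix (¬flip-prev f)))
                   (trans (cong exchange (next-prev j)) (exchange-flip f))
      ; prev′≡ = trans (cong (exchange ∘ prev) (exchange⁻¹-fix (¬flip-prev f))) (exchange-fix (¬flip-prev² f))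
      ; mates′ = mates-fix (exchange⁻¹-fix (¬flip-next f)) (exchange⁻¹-third f)
                   (subst (λ v → (mate v ≡ _ × mate (mate v) ≡ _) ⊎ (mate v ≡ _ × mate (mate v) ≡ _))
                     (sym (exchange-fix (¬flip-prev f))) (prev-mates f))
      ; edge-a = edge-third
      ; edge-c = edge-end
      ; edge-d = subst (Edge (prev j)) (next-prev j) (edge-next (prev j))
      ; a≢c = third≢next f ; a≢d = third≢ f
      ; cover = cover ∘ neighbour
      ; block′ = inj₁ (alive-≐ swapʳ (proj₁ f))
      }
      where
      edge-third : Edge (prev j) (third j)
      edge-third with prev-mates f
      ... | inj₁ (_ , m) = subst (Edge _) m (edge-mate² _)
      ... | inj₂ (m , _) = subst (Edge _) m (edge-mate _)
      edge-end : Edge (prev j) (next j)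
      edge-end with prev-mates f
      ... | inj₁ (m , _) = subst (Edge _) m (edge-mate _)
      ... | inj₂ (_ , m) = subst (Edge _) m (edge-mate² _)
      cover : ∀ {x} → x ≡ next (prev j) ⊎ x ≡ prev (prev j) ⊎ x ≡ mate (prev j) ⊎ x ≡ mate (mate (prev j)) →
              x ≡ third j ⊎ x ≡ prev (prev j) ⊎ x ≡ next j ⊎ x ≡ j
      cover (inj₁ p)        = inj₂ (inj₂ (inj₂ (trans p (next-prev j))))
      cover (inj₂ (inj₁ p)) = inj₂ (inj₁ p)
      cover (inj₂ (inj₂ (inj₁ p))) with prev-mates f
      ... | inj₁ (m , _) = inj₂ (inj₂ (inj₁ (trans p m)))
      ... | inj₂ (m , _) = inj₁ (trans p m)
      cover (inj₂ (inj₂ (inj₂ p))) with prev-mates f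
      ... | inj₁ (_ , m) = inj₁ (trans p m)
      ... | inj₂ (_ , m) = inj₂ (inj₂ (inj₁ (trans p m)))

    local-next : ∀ {j} → Flip j → Local (next j)
    local-next {j} f = record
      { a = next (next j) ; b = third j ; c = prev j ; d = j
      ; next′≡ = trans (cong (exchange ∘ next) (exchange⁻¹-fix (¬flip-next f))) (exchange-fix (¬flip-next² f))
      ; prev′≡ = trans (cong (exchange ∘ prev) (exchange⁻¹-fix (¬flip-next f)))
                   (trans (cong exchange (prev-next j)) (exchange-flip f))
      ; mates′ = mates-fix (exchange⁻¹-fix (¬flip-prev f)) (exchange⁻¹-third f)
                   (subst (λ v → (mate v ≡ _ × mate (mate v) ≡ _) ⊎ (mate v ≡ _ × mate (mate v) ≡ _))
                     (sym (exchange-fix (¬flip-next f))) (next-mates f))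
      ; edge-a = edge-next (next j)
      ; edge-c = edge-end
      ; edge-d = edge-sym (edge-next j)
      ; a≢c = next²≢prev j ; a≢d = next²≢ j
      ; cover = cover ∘ neighbour
      ; block′ = inj₁ (alive-≐ (≐-trans swapʳ swapˡ) (proj₁ f))
      }
      where
      edge-end : Edge (next j) (prev j)
      edge-end with next-mates f
      ... | inj₁ (m , _) = subst (Edge _) m (edge-mate _)
      ... | inj₂ (_ , m) = subst (Edge _) m (edge-mate² _)
      cover : ∀ {x} → x ≡ next (next j) ⊎ x ≡ prev (next j) ⊎ x ≡ mate (next j) ⊎ x ≡ mate (mate (next j)) →
              x ≡ next (next j) ⊎ x ≡ third j ⊎ x ≡ prev j ⊎ x ≡ j
      cover (inj₁ p)        = inj₁ p
      cover (inj₂ (inj₁ p)) = inj₂ (inj₂ (inj₂ (trans p (prev-next j))))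
      cover (inj₂ (inj₂ (inj₁ p))) with next-mates f
      ... | inj₁ (m , _) = inj₂ (inj₂ (inj₁ (trans p m)))
      ... | inj₂ (m , _) = inj₂ (inj₁ (trans p m))
      cover (inj₂ (inj₂ (inj₂ p))) with next-mates f
      ... | inj₁ (_ , m) = inj₂ (inj₁ (trans p m))
      ... | inj₂ (_ , m) = inj₂ (inj₂ (inj₁ (trans p m)))

    -- A centre is written as `third u` because its new place on the cycle is that of `u`, between
    -- its two former mates. Its former cycle neighbours become its mates.
    local-flip : ∀ {u} → Flip u → Local (third u)
    local-flip {u} f = record
      { a = next u ; b = prev u ; c = prev v ; d = next v
      ; next′≡ = trans (cong (exchange ∘ next) (exchange⁻¹-third f)) (exchange-fix (¬flip-next f))
      ; prev′≡ = trans (cong (exchange ∘ prev) (exchange⁻¹-third f)) (exchange-fix (¬flip-prev f))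
      ; mates′ = mates-fix (exchange⁻¹-fix (¬flip-prev g)) (exchange⁻¹-fix (¬flip-next g))
                   (subst (λ v′ → (mate v′ ≡ _ × mate (mate v′) ≡ _) ⊎ (mate v′ ≡ _ × mate (mate v′) ≡ _))
                     (sym (exchange-flip g)) (third-mates g))
      ; edge-a = edge-a
      ; edge-c = edge-prev v
      ; edge-d = edge-next v
      ; a≢c = λ eq → third≢ f (sym (flip-unique f g (inj₂ (inj₂ refl)) (inj₁ eq)))
      ; a≢d = λ eq → third≢ f (sym (flip-unique f g (inj₂ (inj₂ refl)) (inj₂ (inj₂ eq))))
      ; cover = cover ∘ neighbour
      ; block′ = inj₁ (alive-≐ swapˡ (proj₁ g))
      }
      where
      v = third u
      g = third-flip f
      edge-a : Edge v (next u)
      edge-a with third-mates f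
      ... | inj₁ (_ , m) = subst (Edge _) m (edge-mate² _)
      ... | inj₂ (m , _) = subst (Edge _) m (edge-mate _)
      cover : ∀ {x} → x ≡ next v ⊎ x ≡ prev v ⊎ x ≡ mate v ⊎ x ≡ mate (mate v) →
              x ≡ next u ⊎ x ≡ prev u ⊎ x ≡ prev v ⊎ x ≡ next v
      cover (inj₁ p)        = inj₂ (inj₂ (inj₂ p))
      cover (inj₂ (inj₁ p)) = inj₂ (inj₂ (inj₁ p))
      cover (inj₂ (inj₂ (inj₁ p))) with third-mates f
      ... | inj₁ (m , _) = inj₂ (inj₁ (trans p m))
      ... | inj₂ (m , _) = inj₁ (trans p m)
      cover (inj₂ (inj₂ (inj₂ p))) with third-mates f
      ... | inj₁ (_ , m) = inj₁ (trans p m)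
      ... | inj₂ (_ , m) = inj₂ (inj₁ (trans p m))

    -- A centre is `third u` for some centre `u`, so its mates are the ends of the arc around `u`.
    -- Thus each vertex of its triangle is a centre or next to one on the cycle.
    flip-block : ∀ {v x} → Flip x → x ∈ₜ block v → ¬ Untouched v
    flip-block {v} {x} f x∈ (¬v , ¬n , ¬p) with third-surjective f
    ... | u , g , refl with block-sym x∈ | third-mates g
    ...   | inj₁ refl        | _              = ¬v f
    ...   | inj₂ (inj₁ refl) | inj₁ (m , _)   = ¬n (subst Flip (sym (trans (cong next m) (next-prev u))) g)
    ...   | inj₂ (inj₁ refl) | inj₂ (m , _)   = ¬p (subst Flip (sym (trans (cong prev m) (prev-next u))) g)
    ...   | inj₂ (inj₂ refl) | inj₁ (_ , m)   = ¬p (subst Flip (sym (trans (cong prev m) (prev-next u))) g)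
    ...   | inj₂ (inj₂ refl) | inj₂ (_ , m)   = ¬n (subst Flip (sym (trans (cong next m) (next-prev u))) g)

    local-untouched : ∀ {v} → Untouched v → Local v
    local-untouched {v} un@(¬v , ¬n , ¬p) = record
      { a = next v ; b = prev v ; c = mate v ; d = mate (mate v)
      ; next′≡ = trans (cong (exchange ∘ next) (exchange⁻¹-fix ¬v)) (exchange-fix ¬n)
      ; prev′≡ = trans (cong (exchange ∘ prev) (exchange⁻¹-fix ¬v)) (exchange-fix ¬p)
      ; mates′ = mates-fix (exchange⁻¹-fix λ f → flip-block f (inj₂ (inj₁ refl)) un)
                           (exchange⁻¹-fix λ f → flip-block f (inj₂ (inj₂ refl)) un)
                   (inj₁ (cong mate (exchange-fix ¬v) , cong (mate ∘ mate) (exchange-fix ¬v)))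
      ; edge-a = edge-next v ; edge-c = edge-mate v ; edge-d = edge-mate² v
      ; a≢c = next≢mate v ; a≢d = next≢mate² v
      ; cover = neighbour
      ; block′ = inj₂ (un , refl)
      }

    local : ∀ v → Local v
    local v with flip? v | flip? (next v) | flip? (prev v)
    ... | yes f | _     | _     = let u , g , eq = third-surjective f in subst Local eq (local-flip g)
    ... | no _  | yes f | _     = subst Local (prev-next v) (local-prev f)
    ... | no _  | no _  | yes f = subst Local (next-prev v) (local-next f)
    ... | no ¬v | no ¬n | no ¬p = local-untouched (¬v , ¬n , ¬p)

    iterate-next′ : ∀ i v → iterate next′ i v ≡ exchange (iterate next i (exchange⁻¹ v))
    iterate-next′ zero    v = sym (exchange-exchange⁻¹ v)
    iterate-next′ (suc i) v = cong (exchange ∘ next)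
      (trans (cong exchange⁻¹ (iterate-next′ i v)) (exchange⁻¹-exchange _))

    exchanged : Splitting
    exchanged = record
      { next = next′ ; prev = prev′ ; mate = mate′
      ; next-prev = λ v → trans (cong (exchange ∘ next) (exchange⁻¹-exchange _))
                            (trans (cong exchange (next-prev _)) (exchange-exchange⁻¹ v))
      ; prev-next = λ v → trans (cong (exchange ∘ prev) (exchange⁻¹-exchange _))
                            (trans (cong exchange (prev-next _)) (exchange-exchange⁻¹ v))
      ; mate³ = λ v → trans (cong mate′ (mate′² v)) (trans (cong (exchange⁻¹ ∘ mate) (exchange-exchange⁻¹ _))
                        (trans (cong exchange⁻¹ (mate³ _)) (exchange⁻¹-exchange v)))
      ; cyclic = λ v i j i<n j<n eq → cyclic (exchange⁻¹ v) i j i<n j<n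
          (exchange-injective (trans (sym (iterate-next′ i v)) (trans eq (iterate-next′ j v))))
      ; neighbour = λ {u} e → neighbour′ u e
      ; edge-next = λ v → subst (Edge v) (sym (Local.next′≡ (local v))) (Local.edge-a (local v))
      ; edge-mate = edge-mate′
      ; next≢mate = λ v eq → proj₁ (distinct v) eq
      ; next≢mate² = λ v eq → proj₂ (distinct v) eq
      }
      where
      neighbour′ : ∀ u {v} → Edge u v → v ≡ next′ u ⊎ v ≡ prev′ u ⊎ v ≡ mate′ u ⊎ v ≡ mate′ (mate′ u)
      neighbour′ u e with local u
      ... | L with Local.cover L e | Local.mates′ L
      ...   | inj₁ p               | _            = inj₁ (trans p (sym (Local.next′≡ L)))
      ...   | inj₂ (inj₁ p)        | _            = inj₂ (inj₁ (trans p (sym (Local.prev′≡ L))))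
      ...   | inj₂ (inj₂ (inj₁ p)) | inj₁ (m , _) = inj₂ (inj₂ (inj₁ (trans p (sym m))))
      ...   | inj₂ (inj₂ (inj₁ p)) | inj₂ (_ , m) = inj₂ (inj₂ (inj₂ (trans p (sym m))))
      ...   | inj₂ (inj₂ (inj₂ p)) | inj₁ (_ , m) = inj₂ (inj₂ (inj₂ (trans p (sym m))))
      ...   | inj₂ (inj₂ (inj₂ p)) | inj₂ (m , _) = inj₂ (inj₂ (inj₁ (trans p (sym m))))
      edge-mate′ : ∀ v → Edge v (mate′ v)
      edge-mate′ v with Local.mates′ (local v)
      ... | inj₁ (m , _) = subst (Edge v) (sym m) (Local.edge-c (local v))
      ... | inj₂ (m , _) = subst (Edge v) (sym m) (Local.edge-d (local v))
      distinct : ∀ v → next′ v ≢ mate′ v × next′ v ≢ mate′ (mate′ v)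
      distinct v with local v
      ... | L with Local.mates′ L
      ...   | inj₁ (m , m²) = (λ eq → Local.a≢c L (trans (sym (Local.next′≡ L)) (trans eq m))) ,
                              (λ eq → Local.a≢d L (trans (sym (Local.next′≡ L)) (trans eq m²)))
      ...   | inj₂ (m , m²) = (λ eq → Local.a≢d L (trans (sym (Local.next′≡ L)) (trans eq m))) ,
                              (λ eq → Local.a≢c L (trans (sym (Local.next′≡ L)) (trans eq m²)))

    -- A new triangle is an arc found in `B`, or an old triangle that avoids all arcs. The latter
    -- need not be known to lie in `B`, since its support may have come from triangles now given up.
    -- So `A` is the list before propagation, which then keeps all the new triangles together.
    exchanged-contained : ∀ {A} → (∀ {r} → r ∈ₗ B → r ∈ₗ A) →
      (∀ v → (∀ j → Flip j → Disjoint (block v) (path j)) → Alive A (block v)) →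
      Splitting.Contained exchanged A
    exchanged-contained {A} B⊆A old v = alive-≐ (rearrange (local v)) (alive (local v))
      where
      rearrange : (L : Local v) → (v , Local.c L , Local.d L) ≐ (v , mate′ v , mate′ (mate′ v))
      rearrange L with Local.mates′ L
      ... | inj₁ (refl , refl) = ≐-refl
      ... | inj₂ (refl , refl) = swapʳ
      away : Untouched v → ∀ j → Flip j → Disjoint (block v) (path j)
      away un@(¬v , ¬n , ¬p) j f x x∈b (inj₂ (inj₁ refl)) = flip-block f x∈b un
      away un@(¬v , ¬n , ¬p) j f x x∈b (inj₁ refl) with block-sym x∈b | prev-mates f
      ... | inj₁ refl        | _            = ¬n (subst Flip (sym (next-prev j)) f)
      ... | inj₂ (inj₁ refl) | inj₁ (m , _) = ¬p (subst Flip (sym (trans (cong prev m) (prev-next j))) f)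
      ... | inj₂ (inj₁ refl) | inj₂ (m , _) = ¬v (subst Flip (sym m) (third-flip f))
      ... | inj₂ (inj₂ refl) | inj₁ (_ , m) = ¬v (subst Flip (sym m) (third-flip f))
      ... | inj₂ (inj₂ refl) | inj₂ (_ , m) = ¬p (subst Flip (sym (trans (cong prev m) (prev-next j))) f)
      away un@(¬v , ¬n , ¬p) j f x x∈b (inj₂ (inj₂ refl)) with block-sym x∈b | next-mates f
      ... | inj₁ refl        | _            = ¬p (subst Flip (sym (prev-next j)) f)
      ... | inj₂ (inj₁ refl) | inj₁ (m , _) = ¬n (subst Flip (sym (trans (cong next m) (next-prev j))) f)
      ... | inj₂ (inj₁ refl) | inj₂ (m , _) = ¬v (subst Flip (sym m) (third-flip f))
      ... | inj₂ (inj₂ refl) | inj₁ (_ , m) = ¬v (subst Flip (sym m) (third-flip f))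
      ... | inj₂ (inj₂ refl) | inj₂ (_ , m) = ¬n (subst Flip (sym (trans (cong next m) (next-prev j))) f)
      alive : (L : Local v) → Alive A (v , Local.c L , Local.d L)
      alive L with Local.block′ L
      ... | inj₁ (r , r∈ , r≐) = r , B⊆A r∈ , r≐
      ... | inj₂ (un , eq)     = subst (Alive A) (sym eq) (old v (away un))

-- The greedy search and its correctness

triples : ∀ n → List (Triple n)
triples n = concatMap (λ a → concatMap (λ b → map (λ c → a , b , c) (allFin n)) (allFin n)) (allFin n)

∈-triples : ∀ {n} (t : Triple n) → t ∈ₗ triples n
∈-triples {n} (a , b , c) = ∈-concatMap⁺ _ (lose (∈-allFin a)
  (∈-concatMap⁺ _ (lose (∈-allFin b) (∈-map⁺ (λ c → a , b , c) (∈-allFin c)))))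

module Search {n : ℕ} (adj : Fin n → Fin n → Bool) where

  edge? : ∀ u v → Dec (adj u v ≡ true)
  edge? u v = adj u v Bool.≟ true

  triangle? : (t : Triple n) → let (a , b , c) = t in
              Dec (adj a b ≡ true × adj b c ≡ true × adj a c ≡ true)
  triangle? (a , b , c) = edge? a b ×-dec edge? b c ×-dec edge? a c

  triangles : List (Triple n)
  triangles = filter triangle? (triples n)

  chosen : List (Triple n)
  chosen = foldl attempt triangles triangles

  Link : Fin n → Fin n → Set
  Link u v = adj u v ≡ true × ¬ Same chosen u v

  link? : ∀ u v → Dec (Link u v)
  link? u v = edge? u v ×-dec ¬? (same? chosen u v)

module _ {n : ℕ} (adj : Fin n → Fin n → Bool)
         (adj-sym : ∀ u v → adj u v ≡ adj v u) (adj-irrefl : ∀ v → adj v v ≡ false)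
         (4≤n : 4 ≤ n) where

  open Triangulation adj adj-sym adj-irrefl 4≤n
  open Search adj
  open Splitting using (Contained; block)

  resolve : ∀ {A : List (Triple n)} {t : Triple n} (σ : Splitting) → (∀ {r} → r ∈ₗ A → Triangle r) → Contained σ A → Triangle t →
            Any (_≐ t) (propagate (commit t A)) → ∃[ σ′ ] Contained σ′ (propagate (commit t A))
  resolve {A} {t} σ tri contained t-tri survives with classify σ t t-tri
  ... | inj₁ (v , t≐) = σ , Splitting.propagate-contained σ (Splitting.commit-contained σ t≐ contained)
  ... | inj₂ (j , t≐) = exchanged , Splitting.propagate-contained exchanged
    (exchanged-contained propagate-⊆ λ v away →
      let r , r∈ , r≐ = contained v in
      r , ∈-filter⁺ (λ r → disjoint? r t ⊎-dec (r ⊆? t)) r∈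
            (inj₁ λ w w∈r w∈t → away j flip w (proj₁ r≐ w w∈r) (proj₁ t≐ w w∈t)) , r≐)
    where
    open Exchange σ (propagate (commit t A)) (tri ∘ commit-⊆ t ∘ propagate-⊆) (propagate-stabilised (commit t A))
    flip : Flip j
    -- Survival of `t` gives the first half of `Flip j`, the commitment to `t` the second.
    flip = alive-≐ t≐ (find survives) , All.tabulate λ r∈ → compatible (commit-compatible t {A} (propagate-⊆ r∈))
      where
      compatible : ∀ {r} → Disjoint r t ⊎ r ⊆ t → Disjoint r (Splitting.path σ j) ⊎ r ⊆ Splitting.path σ j
      compatible (inj₁ d)  = inj₁ λ v v∈r v∈p → d v v∈r (proj₂ t≐ v v∈p)
      compatible (inj₂ r⊆) = inj₂ λ v v∈r → proj₁ t≐ v (r⊆ v v∈r)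

  attempt-accept : ∀ {A : List (Triple n)} {t : Triple n} → Any (_≐ t) (propagate (commit t A)) → attempt A t ≡ propagate (commit t A)
  attempt-accept {A} {t} p = cong (λ b → when b then propagate (commit t A) else A)
    (dec-true (any? (_≐? t) (propagate (commit t A))) p)

  attempt-reject : ∀ {A : List (Triple n)} {t : Triple n} → ¬ Any (_≐ t) (propagate (commit t A)) → attempt A t ≡ A
  attempt-reject {A} {t} ¬p = cong (λ b → when b then propagate (commit t A) else A)
    (dec-false (any? (_≐? t) (propagate (commit t A))) ¬p)

  attempt-contained : ∀ {A : List (Triple n)} {t : Triple n} (σ : Splitting) → (∀ {r} → r ∈ₗ A → Triangle r) → Contained σ A → Triangle t →
                      ∃[ σ′ ] Contained σ′ (attempt A t)
  attempt-contained {A} {t} σ tri contained t-tri = go (any? (_≐? t) (propagate (commit t A)))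
    where
    go : Dec (Any (_≐ t) (propagate (commit t A))) → ∃[ σ′ ] Contained σ′ (attempt A t)
    go (yes p) = let σ′ , c = resolve σ tri contained t-tri p in
      σ′ , subst (Contained σ′) (sym (attempt-accept {A} {t} p)) c
    go (no ¬p) = σ , subst (Contained σ) (sym (attempt-reject {A} {t} ¬p)) contained

  attempts-contained : ∀ {A : List (Triple n)} (σ : Splitting) (ts : List (Triple n)) → (∀ {r} → r ∈ₗ A → Triangle r) →
                       (∀ {r} → r ∈ₗ ts → Triangle r) → Contained σ A → ∃[ σ′ ] Contained σ′ (foldl attempt A ts)
  attempts-contained σ []       tri tris contained = σ , contained
  attempts-contained {A} σ (t ∷ ts) tri tris contained =
    let σ′ , contained′ = attempt-contained σ tri contained (tris (here refl)) in
    attempts-contained {A = attempt A t} σ′ ts (tri ∘ attempt-⊆ {A = A} {t = t}) (tris ∘ there) contained′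

  -- `σ` belongs to the final list. Lists only shrink, so all its blocks were present when the turn
  -- of `t` came; hence `t` survived, was accepted, and everything incompatible with it was
  -- discarded.
  attempted-compatible : ∀ {A : List (Triple n)} {r t : Triple n} {v} (σ : Splitting) ts → t ∈ₗ ts → t ≐ block σ v →
    Contained σ (foldl attempt A ts) → r ∈ₗ foldl attempt A ts → Disjoint r t ⊎ r ⊆ t
  attempted-compatible {A} σ (t ∷ ts) (there t∈) t≐ contained r∈ = attempted-compatible {A = attempt A t} σ ts t∈ t≐ contained r∈
  attempted-compatible {A} {r} {t} {v} σ (t ∷ ts) (here refl) t≐ contained r∈ =
    commit-compatible t {A} (propagate-⊆ (subst (r ∈ₗ_) (attempt-accept {A} {t} survives) (attempts-⊆ {A = attempt A t} ts r∈)))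
    where
    before : Contained σ A
    before v = let s , s∈ , s≐ = contained v in s , attempts-⊆ {A = A} (t ∷ ts) s∈ , s≐
    survives : Any (_≐ t) (propagate (commit t A))
    survives =
      let s , s∈ , s≐ = Splitting.propagate-contained σ (Splitting.commit-contained σ t≐ before) v
      in lose s∈ (≐-trans s≐ (≐-sym t≐))

  triangle-∈ : ∀ {r} → r ∈ₗ triangles → Triangle r
  triangle-∈ = proj₂ ∘ ∈-filter⁻ triangle? {xs = triples n}

  -- Each block of the final splitting was itself attempted, in some order of its corners. A
  -- remaining candidate through `u` is therefore compatible with the block of `u`, and since it
  -- meets that block it lies inside it.
  chosen-splitting : Splitting → ∃[ σ ] (∀ u v → (Same chosen u v → v ∈ₜ block σ u) ×
                                                 (v ∈ₜ block σ u → Same chosen u v))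
  chosen-splitting σ₀ = σ , λ u v → same⇒block u v , block⇒same u v
    where
    initial : Contained σ₀ triangles
    initial v = block σ₀ v , ∈-filter⁺ triangle? (∈-triples _)
      (Splitting.edge-mate σ₀ v , Splitting.edge-mate σ₀ _ , Splitting.edge-mate² σ₀ v) , ≐-refl
    result = attempts-contained {A = triangles} σ₀ triangles triangle-∈ triangle-∈ initial
    σ = proj₁ result
    contained = proj₂ result
    same⇒block : ∀ u v → Same chosen u v → v ∈ₜ block σ u
    same⇒block u v same = go (attempted-compatible {A = triangles} σ triangles (attempts-⊆ {A = triangles} triangles t∈) t≐ contained r∈)
      where
      r∈ = proj₁ (proj₂ (find same))
      u∈r = proj₁ (proj₂ (proj₂ (find same)))
      v∈r = proj₂ (proj₂ (proj₂ (find same)))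
      t∈ = proj₁ (proj₂ (contained u))
      t≐ = proj₂ (proj₂ (contained u))
      go : Disjoint (proj₁ (find same)) (proj₁ (contained u)) ⊎ proj₁ (find same) ⊆ proj₁ (contained u) →
           v ∈ₜ block σ u
      go (inj₁ d)  = contradiction (proj₂ t≐ u (inj₁ refl)) (d u u∈r)
      go (inj₂ r⊆) = proj₁ t≐ v (r⊆ v v∈r)
    block⇒same : ∀ u v → v ∈ₜ block σ u → Same chosen u v
    block⇒same u v v∈ = let r , r∈ , r≐ = contained u in
      lose r∈ (proj₂ r≐ u (inj₁ refl) , proj₂ r≐ v v∈)

-- Walking along a cycle

iterate-suc : {X : Set} (f : X → X) (i : ℕ) (x : X) → iterate f i (f x) ≡ f (iterate f i x)
iterate-suc f zero    x = refl
iterate-suc f (suc i) x = cong f (iterate-suc f i x)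

iterate-+ : {X : Set} (f : X → X) (i j : ℕ) (x : X) → iterate f i (iterate f j x) ≡ iterate f (i + j) x
iterate-+ f zero    j x = refl
iterate-+ f (suc i) j x = cong f (iterate-+ f i j x)

iterate-inverse : {X : Set} {f g : X → X} → (∀ x → f (g x) ≡ x) →
                  ∀ i x → iterate f i (iterate g i x) ≡ x
iterate-inverse         fg zero    x = refl
iterate-inverse {f = f} fg (suc i) x =
  trans (sym (iterate-suc f i _)) (trans (cong (iterate f i) (fg _)) (iterate-inverse fg i x))

-- Newest vertex first, the order in which a walk that conses leaves it. Position `p` of a trail of
-- length `m` holds the iterate `i` with `i + suc p = m`.
trail : {X : Set} → (X → X) → X → ℕ → List X
trail f v zero    = []
trail f v (suc i) = iterate f i v ∷ trail f v i

module _ {X : Set} (f : X → X) (v : X) where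

  length-trail : ∀ m → length (trail f v m) ≡ m
  length-trail zero    = refl
  length-trail (suc m) = cong suc (length-trail m)

  ∈-trail⁻ : ∀ {u} m → u ∈ₗ trail f v m → ∃[ i ] (i < m × u ≡ iterate f i v)
  ∈-trail⁻ (suc m) (here eq)  = m , ≤-refl , eq
  ∈-trail⁻ (suc m) (there u∈) = let i , i<m , eq = ∈-trail⁻ m u∈ in i , m≤n⇒m≤1+n i<m , eq

  trail-lookup : ∀ m (p : Fin (length (trail f v m))) →
                 ∃[ i ] (i + suc (toℕ p) ≡ m × List.lookup (trail f v m) p ≡ iterate f i v)
  trail-lookup (suc m) zero    = m , +-comm m 1 , refl
  trail-lookup (suc m) (suc p) =
    let i , eq , at = trail-lookup m p in i , trans (+-suc i _) (cong suc eq) , at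

  trail-index : ∀ {m i} → i < m → ∃[ p ] List.lookup (trail f v m) p ≡ iterate f i v
  trail-index {suc m} {i} i<m with i ≟ m
  ... | yes refl = zero , refl
  ... | no i≢m   = let p , eq = trail-index (≤∧≢⇒< (s≤s⁻¹ i<m) i≢m) in suc p , eq

-- `adjacent` is what turns a stable set of positions into a set of vertices without links.
record Tour {n : ℕ} (Link : Fin n → Fin n → Set) (vs : List (Fin n)) : Set where
  field
    length≡    : length vs ≡ n
    injective  : ∀ p q → List.lookup vs p ≡ List.lookup vs q → p ≡ q
    surjective : ∀ u → ∃[ p ] List.lookup vs p ≡ u
    adjacent   : ∀ p q → Link (List.lookup vs p) (List.lookup vs q) → CycleAdjacent p q

record Rotation {n : ℕ} (Link : Fin n → Fin n → Set) (f g : Fin n → Fin n) : Set where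
  field
    f-g    : ∀ v → f (g v) ≡ v
    g-f    : ∀ v → g (f v) ≡ v
    cyclic : ∀ v i j → i < n → j < n → iterate f i v ≡ iterate f j v → i ≡ j
    link   : ∀ {u v} → Link u v → v ≡ f u ⊎ v ≡ g u
    link-f : ∀ u → Link u (f u)
    link-g : ∀ u → Link u (g u)

  -- Seen from `iterate g (i + j) v`, the two points lie `j` and `i` steps ahead along `f`.
  reverse-cyclic : ∀ v i j → i < n → j < n → iterate g i v ≡ iterate g j v → i ≡ j
  reverse-cyclic v i j i<n j<n eq = sym (cyclic (iterate g (i + j) v) j i j<n i<n
    (trans (drop j i (+-comm j i)) (trans eq (sym (drop i j refl)))))
    where
    drop : ∀ a b → a + b ≡ i + j → iterate f a (iterate g (i + j) v) ≡ iterate g b v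
    drop a b eq = trans (cong (λ k → iterate f a (iterate g k v)) (sym eq))
      (trans (cong (iterate f a) (sym (iterate-+ g a b v))) (iterate-inverse f-g a _))

  reversed : Rotation Link g f
  reversed = record
    { f-g = g-f ; g-f = f-g ; cyclic = reverse-cyclic ; link-f = link-g ; link-g = link-f
    ; link = λ l → Sum.swap (link l) }

  covering : ∀ v u → ∃[ i ] (i < n × iterate f i v ≡ u)
  covering v u = let i , eq = injective⇒surjective (λ i → iterate f (toℕ i) v)
                                (λ eq → Fin.toℕ-injective (cyclic v _ _ (Fin.toℕ<n _) (Fin.toℕ<n _) eq)) u
                 in toℕ i , Fin.toℕ<n i , eq

  -- The second alternative is the closing step, from the last iterate back to `v`.
  successor : ∀ v i j → i < n → j < n → iterate f j v ≡ iterate f (suc i) v → j ≡ suc i ⊎ (j ≡ 0 × suc i ≡ n)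
  successor v i zero    i<n j<n eq with suc i ≟ n
  ... | yes last = inj₂ (refl , last)
  ... | no ¬last = contradiction (cyclic v 0 (suc i) j<n (≤∧≢⇒< i<n ¬last) eq) λ ()
  successor v i (suc j) i<n j<n eq = inj₁ (cong suc (cyclic v j i (<-trans (n<1+n j) j<n) i<n
    (trans (sym (g-f _)) (trans (cong g eq) (g-f _)))))

  tour : ∀ v → Tour Link (trail f v n)
  tour v = record
    { length≡ = length-trail f v n
    ; injective = injective
    ; surjective = λ u → let i , i<n , eq = covering v u
                             p , at = trail-index f v i<n
                         in p , trans at eq
    ; adjacent = adjacent
    }
    where
    index<n : ∀ {i p} → i + suc p ≡ n → i < n
    index<n {i} {p} eq = ≤-trans (m≤m+n (suc i) p) (≤-reflexive (trans (sym (+-suc i p)) eq))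
    injective : ∀ p q → List.lookup (trail f v n) p ≡ List.lookup (trail f v n) q → p ≡ q
    injective p q eq with trail-lookup f v n p | trail-lookup f v n q
    ... | i , i+p , p↦ | j , j+q , q↦
      with cyclic v i j (index<n i+p) (index<n j+q) (trans (sym p↦) (trans eq q↦))
    ...   | refl = Fin.toℕ-injective (suc-injective (+-cancelˡ-≡ i _ _ (trans i+p (sym j+q))))
    -- The list runs backwards, so a step along `f` lowers the position by one.
    forward : ∀ p q {i j} → i + suc (toℕ p) ≡ n → j + suc (toℕ q) ≡ n →
              iterate f j v ≡ iterate f (suc i) v → Consecutive q p ⊎ FirstLast p q
    forward p q {i} {j} i+p j+q eq with successor v i j (index<n i+p) (index<n j+q) eq
    ... | inj₁ refl = inj₁ (sym (suc-injective (+-cancelˡ-≡ i _ _ (trans (+-suc i _) (trans j+q (sym i+p))))))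
    ... | inj₂ (refl , refl) =
      inj₂ (suc-injective (+-cancelˡ-≡ i _ _ (trans i+p (sym (+-comm i 1)))) , trans j+q (sym (length-trail f v n)))
    adjacent : ∀ p q → Link (List.lookup (trail f v n) p) (List.lookup (trail f v n) q) → CycleAdjacent p q
    adjacent p q l with trail-lookup f v n p | trail-lookup f v n q | link l
    ... | i , i+p , p↦ | j , j+q , q↦ | inj₁ eq
      with forward p q i+p j+q (trans (sym q↦) (trans eq (cong f p↦)))
    ...   | inj₁ c = inj₁ (inj₂ c)
    ...   | inj₂ c = inj₂ (inj₁ c)
    adjacent p q l | i , i+p , p↦ | j , j+q , q↦ | inj₂ eq
      with forward q p j+q i+p (trans (sym p↦) (trans (sym (f-g _)) (cong f (trans (sym eq) q↦))))
    ...   | inj₁ c = inj₁ (inj₁ c)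
    ...   | inj₂ c = inj₂ (inj₂ c)

module Walking {n : ℕ} (Link : Fin n → Fin n → Set) (link? : ∀ u v → Dec (Link u v)) where

  -- `take 1` is the current end of the walk; it is empty at the start, when every vertex qualifies.
  Next : List (Fin n) → Fin n → Set
  Next vs u = All (λ c → Link c u) (take 1 vs) × ¬ Any (u ≡_) vs

  next? : ∀ vs u → Dec (Next vs u)
  next? vs u = all? (λ c → link? c u) (take 1 vs) ×-dec ¬? (any? (u Fin.≟_) vs)

  extend : List (Fin n) → List (Fin n) → List (Fin n)
  extend []      vs = vs
  extend (u ∷ _) vs = u ∷ vs

  grow : List (Fin n) → List (Fin n)
  grow vs = extend (filter (next? vs) (allFin n)) vs

  walk : List (Fin n)
  walk = foldl (λ vs _ → grow vs) [] (allFin n)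

  private
    extend-∈ : ∀ {z} xs vs → z ∈ₗ xs → ∃[ u ] (u ∈ₗ xs × extend xs vs ≡ u ∷ vs)
    extend-∈ (x ∷ xs) vs _ = x , here refl , refl

    grow-∈ : ∀ {z} vs → Next vs z → ∃[ u ] (Next vs u × grow vs ≡ u ∷ vs)
    grow-∈ {z} vs nz =
      let u , u∈ , eq = extend-∈ _ vs (∈-filter⁺ (next? vs) (∈-allFin z) nz)
      in u , proj₂ (∈-filter⁻ (next? vs) {xs = allFin n} u∈) , eq

  module _ {f g : Fin n → Fin n} (R : Rotation Link f g) where
    open Rotation R

    private
      fresh : ∀ v i → i < n → ¬ iterate f i v ∈ₗ trail f v i
      fresh v i i<n u∈ with ∈-trail⁻ f v i u∈
      ... | j , j<i , eq = <⇒≢ j<i (sym (cyclic v i j i<n (<-trans j<i i<n) eq))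

    -- Once two vertices are listed, one neighbour of the current end is the vertex just left, so
    -- only the step along `f` is open.
    grow-trail : ∀ v i → 2 ≤ i → i < n → grow (trail f v i) ≡ trail f v (suc i)
    grow-trail v i@(suc (suc k)) _ i<n
      with grow-∈ (trail f v i) (link-f (iterate f (suc k) v) ∷ [] , fresh v i i<n)
    ... | u , (l ∷ [] , new) , eq with link l
    ...   | inj₁ refl = eq
    ...   | inj₂ refl = contradiction (there (here (g-f (iterate f k v)))) new
    grow-trail v (suc zero) (s≤s ()) _

    grows-trail : ∀ v i (zs : List (Fin n)) → 2 ≤ i → i + length zs ≤ n →
                  foldl (λ vs _ → grow vs) (trail f v i) zs ≡ trail f v (i + length zs)
    grows-trail v i []       2≤i le = cong (trail f v) (sym (+-identityʳ i))
    grows-trail v i (z ∷ zs) 2≤i le =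
      trans (cong (λ vs → foldl (λ vs _ → grow vs) vs zs)
              (grow-trail v i 2≤i (≤-trans (m≤m+n (suc i) (length zs)) (≤-trans (≤-reflexive (sym (+-suc i _))) le))))
        (trans (grows-trail v (suc i) zs (m≤n⇒m≤1+n 2≤i) (≤-trans (≤-reflexive (sym (+-suc i _))) le))
          (cong (trail f v) (sym (+-suc i (length zs)))))

  -- The first two vertices fix the direction, which may be that of `f` or of `g`; in the second
  -- case the rotation is reversed.
  grows-tour : ∀ {f g} → Rotation Link f g → (∀ v → ¬ Link v v) → 2 ≤ n →
               (zs : List (Fin n)) → length zs ≡ n → Tour Link (foldl (λ vs _ → grow vs) [] zs)
  grows-tour R irr 2≤n []       refl = contradiction 2≤n λ ()
  grows-tour R irr 2≤n (_ ∷ []) refl = contradiction 2≤n λ { (s≤s ()) }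
  grows-tour {f} {g} R irr 2≤n (y ∷ z ∷ zs) len with grow-∈ {y} [] ([] , λ ())
  ... | v , _ , eq₁
    with grow-∈ (v ∷ []) (Rotation.link-f R v ∷ [] , λ { (here eq) → irr v (subst (Link v) eq (Rotation.link-f R v)) })
  ...   | u , (l ∷ [] , _) , eq₂ = continue (Rotation.link R l)
    where
    along : ∀ {f g} → Rotation Link f g → u ≡ f v → Tour Link (foldl (λ vs _ → grow vs) (grow (grow [])) zs)
    along {f} R u≡ = subst (Tour Link) (sym (trans
      (cong (λ vs → foldl (λ vs _ → grow vs) vs zs)
        (trans (cong grow eq₁) (trans eq₂ (cong (λ w → w ∷ v ∷ []) u≡))))
      (trans (grows-trail R v 2 zs ≤-refl (≤-reflexive len)) (cong (trail f v) len)))) (Rotation.tour R v)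
    continue : u ≡ f v ⊎ u ≡ g v → Tour Link (foldl (λ vs _ → grow vs) (grow (grow [])) zs)
    continue (inj₁ eq) = along R eq
    continue (inj₂ eq) = along (Rotation.reversed R) eq

  walk-tour : ∀ {f g} → Rotation Link f g → (∀ v → ¬ Link v v) → 2 ≤ n → Tour Link walk
  walk-tour R irr 2≤n = grows-tour R irr 2≤n (allFin n) (List.length-tabulate id)

-- Cardinalities of subsets

record Enumeration {n : ℕ} (S : Subset n) (m : ℕ) : Set where
  field
    element    : Fin m → Fin n
    injective  : ∀ {i j} → element i ≡ element j → i ≡ j
    sound      : ∀ i → element i ∈ S
    complete   : ∀ {v} → v ∈ S → ∃[ i ] element i ≡ v

enumerate : ∀ {n} (S : Subset n) → Enumeration S ∣ S ∣
enumerate []          = record { element = λ () ; injective = λ { {()} } ; sound = λ () ; complete = λ () }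
enumerate (false ∷ S) = record
  { element   = suc ∘ element
  ; injective = injective ∘ Fin.suc-injective
  ; sound     = λ i → there (sound i)
  ; complete  = λ { (there v∈) → let i , eq = complete v∈ in i , cong suc eq }
  }
  where open Enumeration (enumerate S)
enumerate (true ∷ S) = record
  { element   = λ { zero → zero ; (suc i) → suc (element i) }
  ; injective = λ { {zero} {zero} _ → refl ; {suc i} {suc j} eq → cong suc (injective (Fin.suc-injective eq)) }
  ; sound     = λ { zero → here ; (suc i) → there (sound i) }
  ; complete  = λ { here → zero , refl ; (there v∈) → let i , eq = complete v∈ in suc i , cong suc eq }
  }
  where open Enumeration (enumerate S)

∣∣-≥ : ∀ {m n} (S : Subset n) (g : Fin m → Fin n) → (∀ {i j} → g i ≡ g j → i ≡ j) → (∀ i → g i ∈ S) → m ≤ ∣ S ∣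
∣∣-≥ S g g-injective g∈ = Fin.injective⇒≤ {f = λ i → proj₁ (complete (g∈ i))} λ {i} {j} eq →
  g-injective (trans (sym (proj₂ (complete (g∈ i)))) (trans (cong element eq) (proj₂ (complete (g∈ j)))))
  where open Enumeration (enumerate S)

∣∣-≤ : ∀ {m n} (S : Subset n) (g : Fin m → Fin n) → (∀ {v} → v ∈ S → ∃[ i ] g i ≡ v) → ∣ S ∣ ≤ m
∣∣-≤ S g onto = Fin.injective⇒≤ {f = λ i → proj₁ (onto (sound i))} λ {i} {j} eq →
  injective (trans (sym (proj₂ (onto (sound i)))) (trans (cong g eq) (proj₂ (onto (sound j)))))
  where open Enumeration (enumerate S)

∣∣-≡ : ∀ {m n} {S : Subset n} → Enumeration S m → ∣ S ∣ ≡ m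
∣∣-≡ {S = S} E = ≤-antisym (∣∣-≤ S element complete) (∣∣-≥ S element injective sound)
  where open Enumeration E

∈-tabulate⁺ : ∀ {n} {P : Fin n → Set} (P? : ∀ i → Dec (P i)) {i} → P i → i ∈ Vec.tabulate (does ∘ P?)
∈-tabulate⁺ P? {i} p = lookup⇒[]= i _ (trans (lookup∘tabulate (does ∘ P?) i) (dec-true (P? i) p))

∈-tabulate⁻ : ∀ {n} {P : Fin n → Set} (P? : ∀ i → Dec (P i)) {i} → i ∈ Vec.tabulate (does ∘ P?) → P i
∈-tabulate⁻ P? {i} i∈ with P? i | trans (sym (lookup∘tabulate (does ∘ P?) i)) ([]=⇒lookup i∈)
... | yes p | _  = p
... | no _  | ()

lookup-unique : {X : Set} {xs : List X} → Unique xs → ∀ i j → List.lookup xs i ≡ List.lookup xs j → i ≡ j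
lookup-unique (_ ∷ _)  zero    zero    eq = refl
lookup-unique (x ∷ _)  zero    (suc j) eq = contradiction eq (All.lookup x (∈-lookup j))
lookup-unique (x ∷ _)  (suc i) zero    eq = contradiction (sym eq) (All.lookup x (∈-lookup i))
lookup-unique (_ ∷ xs) (suc i) (suc j) eq = cong suc (lookup-unique xs i j eq)

-- Vertex sets, positions and classes of size three

module Image {n : ℕ} (vs : List (Fin n)) (S : Subset (length vs)) where

  Hit : Fin n → Set
  Hit u = Any (λ p → Vec.lookup S p ≡ true × u ≡ List.lookup vs p) (allFin (length vs))

  hit? : ∀ u → Dec (Hit u)
  hit? u = any? (λ p → (Vec.lookup S p Bool.≟ true) ×-dec (u Fin.≟ List.lookup vs p)) (allFin (length vs))

  image : Subset n
  image = Vec.tabulate (does ∘ hit?)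

  ∈-image⁻ : ∀ {u} → u ∈ image → ∃[ p ] (p ∈ S × u ≡ List.lookup vs p)
  ∈-image⁻ u∈ = let p , _ , p∈ , eq = find (∈-tabulate⁻ hit? u∈) in p , lookup⇒[]= p S p∈ , eq

  ∈-image⁺ : ∀ {p} → p ∈ S → List.lookup vs p ∈ image
  ∈-image⁺ {p} p∈ = ∈-tabulate⁺ hit? (lose (∈-allFin p) ([]=⇒lookup p∈ , refl))

  ∣image∣ : (∀ p q → List.lookup vs p ≡ List.lookup vs q → p ≡ q) → ∣ image ∣ ≡ ∣ S ∣
  ∣image∣ inj = ∣∣-≡ record
    { element   = List.lookup vs ∘ element
    ; injective = λ {i} {j} eq → injective (inj (element i) (element j) eq)
    ; sound     = λ i → ∈-image⁺ (sound i)
    ; complete  = λ v∈ → let p , p∈ , eq = ∈-image⁻ v∈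
                             i , at = complete p∈
                         in i , trans (cong (List.lookup vs) at) (sym eq)
    }
    where open Enumeration (enumerate S)

module Classes {n : ℕ} (Same : Fin n → Fin n → Set) (same? : ∀ u v → Dec (Same u v)) where

  -- The least member stands for its class, so that a filter can list the classes.
  Representative : Fin n → Set
  Representative v = All (λ u → ¬ Same u v ⊎ toℕ v ≤ toℕ u) (allFin n)

  representative? : ∀ v → Dec (Representative v)
  representative? v = all? (λ u → ¬? (same? u v) ⊎-dec (toℕ v ≤? toℕ u)) (allFin n)

  representatives : List (Fin n)
  representatives = filter representative? (allFin n)

  row : (vs : List (Fin n)) → Fin n → Subset (length vs)
  row vs v = Vec.tabulate (λ p → does (same? v (List.lookup vs p)))

  rows : (vs : List (Fin n)) → Vec (Subset (length vs)) (length representatives)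
  rows vs = Vec.tabulate (λ i → row vs (List.lookup representatives i))

  module _ (same-sym : ∀ {u v} → Same u v → Same v u) (same-trans : ∀ {u v w} → Same u v → Same v w → Same u w)
           (orbit : Fin n → Fin 3 → Fin n) (orbit-same : ∀ u a → Same u (orbit u a))
           (same-orbit : ∀ {u v} → Same u v → ∃[ a ] orbit u a ≡ v)
           (orbit-injective : ∀ u {a b} → orbit u a ≡ orbit u b → a ≡ b) where

    represent : ∀ u → ∃[ r ] (Representative r × Same r u)
    represent u = go u (<-wellFounded (toℕ u))
      where
      go : ∀ u → Acc _<_ (toℕ u) → ∃[ r ] (Representative r × Same r u)
      go u (acc rec) with Fin.any? (λ v → same? v u ×-dec (toℕ v <? toℕ u))
      ... | yes (v , s , v<u) = let r , rep , r~v = go v (rec v<u) in r , rep , same-trans r~v s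
      ... | no none = u , All.tabulate (λ {v} _ → least v) , same-refl u
        where
        same-refl : ∀ u → Same u u
        same-refl u = same-trans (orbit-same u zero) (same-sym (orbit-same u zero))
        least : ∀ v → ¬ Same v u ⊎ toℕ u ≤ toℕ v
        least v with same? v u
        ... | yes s = inj₂ (≮⇒≥ λ v<u → none (v , s , v<u))
        ... | no ¬s = inj₁ ¬s

    representative-unique : ∀ {r s} → Representative r → Representative s → Same r s → r ≡ s
    representative-unique {r} {s} R S r~s
      with All.lookup R (∈-allFin s) | All.lookup S (∈-allFin r)
    ... | inj₁ ¬p | _       = contradiction (same-sym r~s) ¬p
    ... | inj₂ _  | inj₁ ¬q = contradiction r~s ¬q
    ... | inj₂ p  | inj₂ q  = Fin.toℕ-injective (≤-antisym p q)

    private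
      ℓ = length representatives

      rep : Fin ℓ → Fin n
      rep = List.lookup representatives

      rep-is : ∀ i → Representative (rep i)
      rep-is i = proj₂ (∈-filter⁻ representative? {xs = allFin n} (∈-lookup i))

      rep-injective : ∀ {i j} → Same (rep i) (rep j) → i ≡ j
      rep-injective {i} {j} s = lookup-unique (Unique.filter⁺ representative? (Unique.allFin⁺ n)) i j
        (representative-unique (rep-is i) (rep-is j) s)

      rep-onto : ∀ u → ∃[ i ] Same (rep i) u
      rep-onto u =
        let r , R , s = represent u
            r∈ = ∈-filter⁺ representative? (∈-allFin r) R
        in index r∈ , subst (λ v → Same v u) (lookup-index r∈) s

    -- A representative and an index into its orbit address every vertex exactly once; each
    -- inequality comes from an injection between finite types.
    3*representatives : length representatives * 3 ≡ n
    3*representatives = ≤-antisym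
      (Fin.injective⇒≤ {f = λ x → member (remQuot {ℓ} 3 x)} λ {x} {y} eq →
        trans (sym (Fin.combine-remQuot {ℓ} 3 x)) (trans (cong (λ (i , a) → combine i a) (member-injective eq)) (Fin.combine-remQuot {ℓ} 3 y)))
      (Fin.injective⇒≤ {f = λ u → let i , a , _ = address u in combine i a} λ {u} {v} eq →
        let i , a , u≡ = address u
            j , b , v≡ = address v
            i≡j , a≡b = Fin.combine-injective i a j b eq
        in trans (sym u≡) (trans (cong₂ (λ i a → orbit (rep i) a) i≡j a≡b) v≡))
      where
      member : Fin ℓ × Fin 3 → Fin n
      member (i , a) = orbit (rep i) a
      member-injective : ∀ {x y} → member x ≡ member y → x ≡ y
      member-injective {i , a} {j , b} eq
        with rep-injective (same-trans (orbit-same (rep i) a)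
               (same-sym (subst (Same (rep j)) (sym eq) (orbit-same (rep j) b))))
      ... | refl = cong (i ,_) (orbit-injective (rep i) eq)
      address : ∀ u → ∃[ i ] ∃[ a ] orbit (rep i) a ≡ u
      address u = let i , s = rep-onto u
                      a , eq = same-orbit s
                  in i , a , eq

    module _ {Link : Fin n → Fin n → Set} (vs : List (Fin n)) (T : Tour Link vs) where
      open Tour T

      private
        at : Fin (length vs) → Fin n
        at = List.lookup vs

        rowAt : Fin ℓ → Subset (length vs)
        rowAt i = Vec.lookup (rows vs) i

      ∈-rows⁻ : ∀ i {p} → p ∈ rowAt i → Same (rep i) (at p)
      ∈-rows⁻ i {p} p∈ = ∈-tabulate⁻ (λ p → same? (rep i) (at p))
        (subst (p ∈_) (lookup∘tabulate (λ i → row vs (rep i)) i) p∈)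

      ∈-rows⁺ : ∀ i {p} → Same (rep i) (at p) → p ∈ rowAt i
      ∈-rows⁺ i {p} s = subst (p ∈_) (sym (lookup∘tabulate (λ i → row vs (rep i)) i))
        (∈-tabulate⁺ (λ p → same? (rep i) (at p)) s)

      rows-size : ∀ i → ∣ rowAt i ∣ ≡ 3
      rows-size i = ∣∣-≡ {S = rowAt i} record
        { element   = position
        ; injective = λ {a} {b} eq → orbit-injective (rep i)
            (trans (sym (position-at a)) (trans (cong at eq) (position-at b)))
        ; sound     = λ a → ∈-rows⁺ i (subst (Same (rep i)) (sym (position-at a)) (orbit-same (rep i) a))
        ; complete  = λ {p} p∈ → let a , eq = same-orbit (∈-rows⁻ i p∈)
                                 in a , injective (position a) p (trans (position-at a) eq)
        }
        where
        position : Fin 3 → Fin (length vs)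
        position a = proj₁ (surjective (orbit (rep i) a))
        position-at : ∀ a → at (position a) ≡ orbit (rep i) a
        position-at a = proj₂ (surjective (orbit (rep i) a))

      rows-disjoint : ∀ i j → i ≢ j → ∀ p → ¬ (p ∈ rowAt i × p ∈ rowAt j)
      rows-disjoint i j i≢j p (p∈i , p∈j) =
        i≢j (rep-injective (same-trans (∈-rows⁻ i p∈i) (same-sym (∈-rows⁻ j p∈j))))

      rows-cover : ∀ p → ∃[ i ] p ∈ rowAt i
      rows-cover p = let i , s = rep-onto (at p) in i , ∈-rows⁺ i s

      -- Two distinct positions in the same row would give `2 * 2 ≤ 3`.
      fair-unique : ∀ (S : Subset (length vs)) → (∀ i → 2 * ∣ S ∩ rowAt i ∣ ≤ ∣ rowAt i ∣) →
                    ∀ {p q} → p ∈ S → q ∈ S → Same (at p) (at q) → p ≡ q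
      fair-unique S fair {p} {q} p∈ q∈ s with p Fin.≟ q
      ... | yes eq = eq
      ... | no p≢q = contradiction (≤-trans (*-monoʳ-≤ 2 two) (≤-trans (fair i) (≤-reflexive (rows-size i))))
                       λ { (s≤s (s≤s (s≤s ()))) }
        where
        i = proj₁ (rep-onto (at p))
        i~p : Same (rep i) (at p)
        i~p = proj₂ (rep-onto (at p))
        both : Fin 2 → Fin (length vs)
        both zero       = p
        both (suc zero) = q
        two : 2 ≤ ∣ S ∩ rowAt i ∣
        two = ∣∣-≥ (S ∩ rowAt i) both
          (λ { {zero} {zero} _ → refl ; {suc zero} {suc zero} _ → refl
             ; {zero} {suc zero} eq → contradiction eq p≢q ; {suc zero} {zero} eq → contradiction (sym eq) p≢q })
          (λ { zero → x∈p∩q⁺ (p∈ , ∈-rows⁺ i i~p)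
             ; (suc zero) → x∈p∩q⁺ (q∈ , ∈-rows⁺ i (same-trans i~p s)) })

-- The cyclic order of positions

rotate unrotate : ∀ {m} → Fin (suc m) → Fin (suc m)
rotate i with Top.view i
... | Top.‵fromℕ     = zero
... | Top.‵inject₁ j = suc j
unrotate zero    = Fin.fromℕ _
unrotate (suc i) = Fin.inject₁ i

rotate-fromℕ : ∀ m → rotate (Fin.fromℕ m) ≡ zero
rotate-fromℕ m rewrite Top.view-fromℕ m = refl

rotate-inject₁ : ∀ {m} (i : Fin m) → rotate (Fin.inject₁ i) ≡ suc i
rotate-inject₁ i rewrite Top.view-inject₁ i = refl

rotate-unrotate : ∀ {m} (i : Fin (suc m)) → rotate (unrotate i) ≡ i
rotate-unrotate zero    = rotate-fromℕ _
rotate-unrotate (suc i) = rotate-inject₁ i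

unrotate-rotate : ∀ {m} (i : Fin (suc m)) → unrotate (rotate i) ≡ i
unrotate-rotate i with Top.view i
... | Top.‵fromℕ     = refl
... | Top.‵inject₁ j = refl

adjacent-rotate : ∀ {m} (i : Fin (suc m)) → CycleAdjacent i (rotate i)
adjacent-rotate {m} i with Top.view i
... | Top.‵fromℕ     = inj₂ (inj₂ (refl , cong suc (Fin.toℕ-fromℕ m)))
... | Top.‵inject₁ j = inj₁ (inj₁ (cong suc (sym (Fin.toℕ-inject₁ j))))

consecutive⇒rotate : ∀ {m} (i j : Fin (suc m)) → Consecutive i j → j ≡ rotate i
consecutive⇒rotate {m} i j c with Top.view i
... | Top.‵fromℕ     = contradiction (Fin.toℕ<n j) (<-irrefl (trans c (cong suc (Fin.toℕ-fromℕ m))))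
... | Top.‵inject₁ k = Fin.toℕ-injective (trans c (cong suc (Fin.toℕ-inject₁ k)))

firstLast⇒rotate : ∀ {m} (i j : Fin (suc m)) → FirstLast i j → i ≡ rotate j
firstLast⇒rotate {m} i j (i≡0 , j≡m) with Top.view j
... | Top.‵fromℕ     = Fin.toℕ-injective i≡0
... | Top.‵inject₁ k = contradiction (trans (sym (Fin.toℕ-inject₁ k)) (suc-injective j≡m)) (<⇒≢ (Fin.toℕ<n k))

adjacent⇒rotate : ∀ {m} {i j : Fin (suc m)} → CycleAdjacent i j → j ≡ rotate i ⊎ j ≡ unrotate i
adjacent⇒rotate {i = i} {j} (inj₁ (inj₁ c)) = inj₁ (consecutive⇒rotate i j c)
adjacent⇒rotate {i = i} {j} (inj₁ (inj₂ c)) =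
  inj₂ (trans (sym (unrotate-rotate j)) (cong unrotate (sym (consecutive⇒rotate j i c))))
adjacent⇒rotate {i = i} {j} (inj₂ (inj₁ c)) =
  inj₂ (trans (sym (unrotate-rotate j)) (cong unrotate (sym (firstLast⇒rotate i j c))))
adjacent⇒rotate {i = i} {j} (inj₂ (inj₂ c)) = inj₁ (firstLast⇒rotate j i c)

iterate-rotate : ∀ {m} i → i < suc m → toℕ (iterate (rotate {m}) i zero) ≡ i
iterate-rotate zero    _ = refl
iterate-rotate {m} (suc i) i<m with iterate (rotate {m}) i zero | iterate-rotate {m} i (<-trans (n<1+n i) i<m)
... | j | refl with Top.view j
...   | Top.‵fromℕ     = contradiction i<m (≤⇒≯ (s≤s (≤-reflexive (sym (Fin.toℕ-fromℕ m)))))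
...   | Top.‵inject₁ k = cong suc (sym (Fin.toℕ-inject₁ k))

iterate-comm : {X : Set} (f : X → X) (i j : ℕ) (x : X) →
               iterate f i (iterate f j x) ≡ iterate f j (iterate f i x)
iterate-comm f i j x = trans (iterate-+ f i j x)
  (trans (cong (λ k → iterate f k x) (+-comm i j)) (sym (iterate-+ f j i x)))

iterate-injective : {X : Set} (f : X → X) → (∀ {x y} → f x ≡ f y → x ≡ y) →
                    ∀ i {x y} → iterate f i x ≡ iterate f i y → x ≡ y
iterate-injective f inj zero    eq = eq
iterate-injective f inj (suc i) eq = iterate-injective f inj i (inj eq)

rotate-injective : ∀ {m} {i j : Fin (suc m)} → rotate i ≡ rotate j → i ≡ j
rotate-injective eq = trans (sym (unrotate-rotate _)) (trans (cong unrotate eq) (unrotate-rotate _))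

-- Every position is a rotation of 0, and rotations commute.
rotate-cyclic : ∀ {m} (v : Fin (suc m)) i j → i < suc m → j < suc m →
                iterate rotate i v ≡ iterate rotate j v → i ≡ j
rotate-cyclic {m} v i j i<m j<m eq =
  trans (sym (iterate-rotate i i<m)) (trans (cong toℕ at-zero) (iterate-rotate j j<m))
  where
  c = toℕ v
  v≡ : v ≡ iterate rotate c zero
  v≡ = Fin.toℕ-injective (sym (iterate-rotate c (Fin.toℕ<n v)))
  at-zero : iterate (rotate {m}) i zero ≡ iterate rotate j zero
  at-zero = iterate-injective rotate rotate-injective c
    (trans (iterate-comm rotate c i zero) (trans (cong (iterate rotate i) (sym v≡))
      (trans eq (trans (cong (iterate rotate j) v≡) (iterate-comm rotate j c zero)))))

-- From the given decomposition to permutations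

turn : Fin 3 → Fin 3
turn = rotate

turn³ : ∀ a → turn (turn (turn a)) ≡ a
turn³ zero             = refl
turn³ (suc zero)       = refl
turn³ (suc (suc zero)) = refl

turn-≢ : ∀ a → a ≢ turn a
turn-≢ zero             ()
turn-≢ (suc zero)       ()
turn-≢ (suc (suc zero)) ()

turn²-≢ : ∀ a → a ≢ turn (turn a)
turn²-≢ zero             ()
turn²-≢ (suc zero)       ()
turn²-≢ (suc (suc zero)) ()

turn-cover : ∀ a b → a ≢ b → b ≡ turn a ⊎ b ≡ turn (turn a)
turn-cover zero             zero             a≢b = contradiction refl a≢b
turn-cover zero             (suc zero)       a≢b = inj₁ refl
turn-cover zero             (suc (suc zero)) a≢b = inj₂ refl
turn-cover (suc zero)       zero             a≢b = inj₂ refl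
turn-cover (suc zero)       (suc zero)       a≢b = contradiction refl a≢b
turn-cover (suc zero)       (suc (suc zero)) a≢b = inj₁ refl
turn-cover (suc (suc zero)) zero             a≢b = inj₁ refl
turn-cover (suc (suc zero)) (suc zero)       a≢b = inj₂ refl
turn-cover (suc (suc zero)) (suc (suc zero)) a≢b = contradiction refl a≢b

module Decomposition {k m : ℕ} (size≡ : 3 * k ≡ suc m) (adj : Fin (suc m) → Fin (suc m) → Bool)
         (adj-sym : ∀ u v → adj u v ≡ adj v u) (adj-irrefl : ∀ v → adj v v ≡ false)
         (H : HamiltonCycle (suc m)) (T : DisjointTriangles k (suc m))
         (union : ∀ u v → (adj u v ≡ true) ⇔ (HamiltonCycle.Edge H u v ⊎ DisjointTriangles.Edge T u v))
         (exclusive : ∀ u v → ¬ (HamiltonCycle.Edge H u v × DisjointTriangles.Edge T u v)) where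

  open HamiltonCycle H using (order)
  open DisjointTriangles T using (corner) renaming (disjoint to corner-injective)

  private
    place : Fin (suc m) → Fin (suc m)
    place i = order ⟨$⟩ʳ i

    position : Fin (suc m) → Fin (suc m)
    position v = order ⟨$⟩ˡ v

    place-injective : ∀ {i j} → place i ≡ place j → i ≡ j
    place-injective eq = trans (sym (inverseˡ order)) (trans (cong position eq) (inverseˡ order))

    iterate-place : ∀ i v → iterate (place ∘ rotate ∘ position) i v ≡ place (iterate rotate i (position v))
    iterate-place zero    v = sym (inverseʳ order)
    iterate-place (suc i) v = cong (place ∘ rotate) (trans (cong position (iterate-place i v)) (inverseˡ order))

    -- The corners of the `k` triangles are distinct and as many as the vertices, so the triangles
    -- cover everything; inverting this map gives each vertex its `triangleOf` and `cornerOf`.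
    cornerAt : Fin (suc m) → Fin (suc m)
    cornerAt x = let a , i = remQuot {3} k (subst Fin (sym size≡) x) in corner i a

    cornerAt-injective : ∀ {x y} → cornerAt x ≡ cornerAt y → x ≡ y
    cornerAt-injective {x} {y} eq =
      let i≡j , a≡b = corner-injective _ _ _ _ eq
      in subst-injective (trans (sym (Fin.combine-remQuot {3} k _))
           (trans (cong₂ combine a≡b i≡j) (Fin.combine-remQuot {3} k _)))
      where
      subst-injective : subst Fin (sym size≡) x ≡ subst Fin (sym size≡) y → x ≡ y
      subst-injective eq = trans (sym (subst-subst-sym size≡)) (trans (cong (subst Fin size≡) eq) (subst-subst-sym size≡))

    abstract
      triangleOf : Fin (suc m) → Fin k
      triangleOf v = proj₂ (remQuot {3} k (subst Fin (sym size≡) (proj₁ (injective⇒surjective cornerAt cornerAt-injective v))))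

      cornerOf : Fin (suc m) → Fin 3
      cornerOf v = proj₁ (remQuot {3} k (subst Fin (sym size≡) (proj₁ (injective⇒surjective cornerAt cornerAt-injective v))))

      corner-of : ∀ v → corner (triangleOf v) (cornerOf v) ≡ v
      corner-of v = proj₂ (injective⇒surjective cornerAt cornerAt-injective v)

    step : Fin (suc m) → Fin (suc m)
    step v = corner (triangleOf v) (turn (cornerOf v))

    step-corner : ∀ i a → step (corner i a) ≡ corner i (turn a)
    step-corner i a = let i≡ , a≡ = corner-injective _ _ _ _ (corner-of (corner i a)) in
      cong₂ (λ j b → corner j (turn b)) i≡ a≡

    step² : ∀ v → step (step v) ≡ corner (triangleOf v) (turn (turn (cornerOf v)))
    step² v = step-corner (triangleOf v) (turn (cornerOf v))

    hamilton-edge : ∀ v → HamiltonCycle.Edge H v (place (rotate (position v)))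
    hamilton-edge v = position v , rotate (position v) , adjacent-rotate _ , sym (inverseʳ order) , refl

    step-edge : ∀ v → DisjointTriangles.Edge T v (step v)
    step-edge v = triangleOf v , cornerOf v , turn (cornerOf v) , turn-≢ _ , sym (corner-of v) , refl

    step²-edge : ∀ v → DisjointTriangles.Edge T v (step (step v))
    step²-edge v = triangleOf v , cornerOf v , turn (turn (cornerOf v)) , turn²-≢ _ , sym (corner-of v) , step² v

  -- A single triangle would contain every pair of vertices, leaving no edge for the cycle. Together
  -- with `long` this gives `k ≥ 2`, and so `4 ≤ n`.
  k≢1 : k ≢ 1
  k≢1 k≡1 = exclusive v u (hamilton-edge v , triangle-edge)
    where
    v = place zero
    u = place (rotate (position v))
    only : ∀ {k} → k ≡ 1 → (i j : Fin k) → i ≡ j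
    only refl zero zero = refl
    v≢u : v ≢ u
    v≢u eq with trans (sym (Equivalence.from (union v u) (inj₁ (hamilton-edge v))))
                  (trans (cong (adj v) (sym eq)) (adj-irrefl v))
    ... | ()
    i≡ : triangleOf u ≡ triangleOf v
    i≡ = only k≡1 _ _
    u≡ : u ≡ corner (triangleOf v) (cornerOf u)
    u≡ = trans (sym (corner-of u)) (cong (λ i → corner i (cornerOf u)) i≡)
    triangle-edge : DisjointTriangles.Edge T v u
    triangle-edge = triangleOf v , cornerOf v , cornerOf u ,
      (λ a≡b → v≢u (trans (sym (corner-of v)) (trans (cong (corner (triangleOf v)) a≡b) (sym u≡)))) ,
      sym (corner-of v) , u≡

  4≤n : 3 ≤ suc m → 4 ≤ suc m
  4≤n 3≤n = subst (4 ≤_) size≡ (enough k (subst (3 ≤_) (sym size≡) 3≤n) k≢1)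
    where
    enough : ∀ k → 3 ≤ 3 * k → k ≢ 1 → 4 ≤ 3 * k
    enough zero          ()  _
    enough (suc zero)    _   k≢1 = contradiction refl k≢1
    enough (suc (suc k)) _   _   = ≤-trans (s≤s (s≤s (s≤s (s≤s z≤n)))) (*-monoʳ-≤ 3 {2} {suc (suc k)} (s≤s (s≤s z≤n)))

  module _ (4≤n : 4 ≤ suc m) where

    open Triangulation adj adj-sym adj-irrefl 4≤n

    initial-splitting : Splitting
    initial-splitting = record
      { next = place ∘ rotate ∘ position
      ; prev = place ∘ unrotate ∘ position
      ; mate = step
      ; next-prev = λ v → trans (cong (place ∘ rotate) (inverseˡ order))
                            (trans (cong place (rotate-unrotate _)) (inverseʳ order))
      ; prev-next = λ v → trans (cong (place ∘ unrotate) (inverseˡ order))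
                            (trans (cong place (unrotate-rotate _)) (inverseʳ order))
      ; mate³ = λ v → trans (cong step (step² v)) (trans (step-corner (triangleOf v) (turn (turn (cornerOf v))))
                        (trans (cong (corner (triangleOf v)) (turn³ (cornerOf v))) (corner-of v)))
      ; cyclic = λ v i j i<n j<n eq → rotate-cyclic (position v) i j i<n j<n
          (place-injective (trans (sym (iterate-place i v)) (trans eq (iterate-place j v))))
      ; neighbour = neighbour ∘ Equivalence.to (union _ _)
      ; edge-next = λ v → Equivalence.from (union _ _) (inj₁ (hamilton-edge v))
      ; edge-mate = λ v → Equivalence.from (union _ _) (inj₂ (step-edge v))
      ; next≢mate = λ v eq → exclusive _ _ (subst (HamiltonCycle.Edge H v) eq (hamilton-edge v) , step-edge v)
      ; next≢mate² = λ v eq → exclusive _ _ (subst (HamiltonCycle.Edge H v) eq (hamilton-edge v) , step²-edge v)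
      }
      where
      neighbour : ∀ {u v} → HamiltonCycle.Edge H u v ⊎ DisjointTriangles.Edge T u v →
        v ≡ place (rotate (position u)) ⊎ v ≡ place (unrotate (position u)) ⊎ v ≡ step u ⊎ v ≡ step (step u)
      neighbour (inj₁ (i , j , a , refl , refl)) with adjacent⇒rotate a
      ... | inj₁ refl = inj₁ (cong (place ∘ rotate) (sym (inverseˡ order)))
      ... | inj₂ refl = inj₂ (inj₁ (cong (place ∘ unrotate) (sym (inverseˡ order))))
      neighbour (inj₂ (i , a , b , a≢b , refl , refl)) with turn-cover a b a≢b
      ... | inj₁ refl = inj₂ (inj₂ (inj₁ (sym (step-corner i a))))
      ... | inj₂ refl = inj₂ (inj₂ (inj₂ (sym (trans (cong step (step-corner i a)) (step-corner i (turn a))))))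

SplittingOf : {n : ℕ} → Graph n → Set
SplittingOf {n} G = Σ[ 4≤n ∈ 4 ≤ n ] Triangulation.Splitting (Graph.adj G) (Graph.sym G) (Graph.irref G) 4≤n

-- `n` is kept apart from `3 * k` so that it can be matched against `suc m`, the form that `rotate`
-- works with.
splitting : ∀ {k n} → 3 * k ≡ n → (G : Graph n) (H : HamiltonCycle n) (T : DisjointTriangles k n) →
  (∀ u v → Graph.Edge G u v ⇔ (HamiltonCycle.Edge H u v ⊎ DisjointTriangles.Edge T u v)) →
  (∀ u v → ¬ (HamiltonCycle.Edge H u v × DisjointTriangles.Edge T u v)) → SplittingOf G
splitting {n = zero}  eq G H T union exclusive = contradiction (HamiltonCycle.long H) λ ()
splitting {n = suc m} eq G H T union exclusive = 4≤n , D.initial-splitting 4≤n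
  where
  module D = Decomposition eq (Graph.adj G) (Graph.sym G) (Graph.irref G) H T union exclusive
  4≤n = D.4≤n (HamiltonCycle.long H)

-- The two maps of the reduction

module Route (x : CPTInstance) where
  open CPTInstance x

  n : ℕ
  n = 3 * k

  adj : Fin n → Fin n → Bool
  adj = Graph.adj graph

  Together : Fin n → Fin n → Set
  Together = Same (Search.chosen adj)

  together? : ∀ u v → Dec (Together u v)
  together? = same? (Search.chosen adj)

  module C = Classes Together together?

  walk : List (Fin n)
  walk = Walking.walk (Search.Link adj) (Search.link? adj)

  abstract
    start : SplittingOf graph
    start = splitting refl graph (CyclePlusTrianglesDecomposition.cycle decomposition)
      (CyclePlusTrianglesDecomposition.triangles decomposition)
      (CyclePlusTrianglesDecomposition.union decomposition)
      (CyclePlusTrianglesDecomposition.disjoint decomposition)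

  module Tr = Triangulation adj (Graph.sym graph) (Graph.irref graph) (proj₁ start)

  abstract
    selected : ∃[ σ ] (∀ u v → (Together u v → v ∈ₜ Tr.Splitting.block σ u) ×
                               (v ∈ₜ Tr.Splitting.block σ u → Together u v))
    selected = chosen-splitting adj (Graph.sym graph) (Graph.irref graph) (proj₁ start) (proj₂ start)

  open Tr.Splitting (proj₁ selected)

  together⇒block : ∀ {u v} → Together u v → v ∈ₜ block u
  together⇒block {u} {v} = proj₁ (proj₂ selected u v)

  block⇒together : ∀ {u v} → v ∈ₜ block u → Together u v
  block⇒together {u} {v} = proj₂ (proj₂ selected u v)

  -- The edges outside the chosen triangles form the Hamilton cycle of the final splitting, which
  -- may differ from the cycle of the given decomposition.
  rotation : Rotation (Search.Link adj) next prev
  rotation = record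
    { f-g = next-prev ; g-f = prev-next ; cyclic = cyclic
    ; link   = λ (e , apart) → near apart (neighbour e)
    ; link-f = λ u → edge-next u , apart-next u ∘ together⇒block
    ; link-g = λ u → edge-prev u , apart-prev u ∘ together⇒block
    }
    where
    near : ∀ {u v} → ¬ Together u v → v ≡ next u ⊎ v ≡ prev u ⊎ v ≡ mate u ⊎ v ≡ mate (mate u) →
           v ≡ next u ⊎ v ≡ prev u
    near apart (inj₁ p)        = inj₁ p
    near apart (inj₂ (inj₁ p)) = inj₂ p
    near apart (inj₂ (inj₂ p)) = contradiction (block⇒together (inj₂ p)) apart
    apart-next : ∀ u → ¬ next u ∈ₜ block u
    apart-next u (inj₁ p)        = Tr.edge-irrefl (edge-next u) (sym p)
    apart-next u (inj₂ (inj₁ p)) = next≢mate u p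
    apart-next u (inj₂ (inj₂ p)) = next≢mate² u p
    apart-prev : ∀ u → ¬ prev u ∈ₜ block u
    apart-prev u (inj₁ p)        = Tr.edge-irrefl (edge-prev u) (sym p)
    apart-prev u (inj₂ (inj₁ p)) = prev≢mate u p
    apart-prev u (inj₂ (inj₂ p)) = prev≢mate² u p

  abstract
    tour : Tour (Search.Link adj) walk
    tour = Walking.walk-tour (Search.Link adj) (Search.link? adj) rotation
      (λ v l → Tr.edge-irrefl (proj₁ l) refl) (≤-trans (s≤s (s≤s z≤n)) (proj₁ start))

  together-sym : ∀ {u v} → Together u v → Together v u
  together-sym s = block⇒together (block-sym (together⇒block s))

  together-trans : ∀ {u v w} → Together u v → Together v w → Together u w
  together-trans s t = block⇒together (block-trans (together⇒block s) (together⇒block t))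

  orbit : Fin n → Fin 3 → Fin n
  orbit u zero             = u
  orbit u (suc zero)       = mate u
  orbit u (suc (suc zero)) = mate (mate u)

  orbit-together : ∀ u a → Together u (orbit u a)
  orbit-together u zero             = block⇒together (inj₁ refl)
  orbit-together u (suc zero)       = block⇒together (inj₂ (inj₁ refl))
  orbit-together u (suc (suc zero)) = block⇒together (inj₂ (inj₂ refl))

  together-orbit : ∀ {u v} → Together u v → ∃[ a ] orbit u a ≡ v
  together-orbit s with together⇒block s
  ... | inj₁ p        = zero , sym p
  ... | inj₂ (inj₁ p) = suc zero , sym p
  ... | inj₂ (inj₂ p) = suc (suc zero) , sym p

  orbit-injective : ∀ u {a b} → orbit u a ≡ orbit u b → a ≡ b
  orbit-injective u {zero}           {zero}           _  = refl
  orbit-injective u {suc zero}       {suc zero}       _  = refl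
  orbit-injective u {suc (suc zero)} {suc (suc zero)} _  = refl
  orbit-injective u {zero}           {suc zero}       eq = contradiction eq (Tr.edge-irrefl (edge-mate u))
  orbit-injective u {zero}           {suc (suc zero)} eq = contradiction eq (Tr.edge-irrefl (edge-mate² u))
  orbit-injective u {suc zero}       {zero}           eq = contradiction (sym eq) (Tr.edge-irrefl (edge-mate u))
  orbit-injective u {suc zero}       {suc (suc zero)} eq = contradiction eq (Tr.edge-irrefl (edge-mate (mate u)))
  orbit-injective u {suc (suc zero)} {zero}           eq = contradiction (sym eq) (Tr.edge-irrefl (edge-mate² u))
  orbit-injective u {suc (suc zero)} {suc zero}       eq = contradiction (sym eq) (Tr.edge-irrefl (edge-mate (mate u)))

  abstract
    length-walk : length walk ≡ 3 * k
    length-walk = Tour.length≡ tour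

    length-representatives : length C.representatives ≡ k
    length-representatives = *-cancelʳ-≡ _ k 3
      (trans (C.3*representatives together-sym together-trans orbit orbit-together together-orbit orbit-injective) (*-comm 3 k))

    sizes : ∀ i → ∣ Vec.lookup (C.rows walk) i ∣ ≡ 3
    sizes = C.rows-size together-sym together-trans orbit orbit-together together-orbit orbit-injective walk tour

    apart : ∀ i j → i ≢ j → ∀ v → ¬ (v ∈ Vec.lookup (C.rows walk) i × v ∈ Vec.lookup (C.rows walk) j)
    apart = C.rows-disjoint together-sym together-trans orbit orbit-together together-orbit orbit-injective walk tour

    covered : ∀ v → ∃[ i ] v ∈ Vec.lookup (C.rows walk) i
    covered = C.rows-cover together-sym together-trans orbit orbit-together together-orbit orbit-injective walk tour

    two-thirds : 2 * k ≤ length walk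
    two-thirds = ≤-trans (*-monoˡ-≤ k (n≤1+n 2)) (≤-reflexive (sym length-walk))

    few-rows : length C.representatives ≤ length walk ∸ 2 * k + 1
    few-rows = begin
      length C.representatives ≡⟨ length-representatives ⟩
      k                        ≡⟨ m+n∸n≡m k (2 * k) ⟨
      3 * k ∸ 2 * k            ≡⟨ cong (_∸ 2 * k) length-walk ⟨
      length walk ∸ 2 * k      ≤⟨ m≤m+n _ 1 ⟩
      length walk ∸ 2 * k + 1  ∎
      where open ≤-Reasoning

    large-rows : ∀ i → 2 ≤ ∣ Vec.lookup (C.rows walk) i ∣
    large-rows i = ≤-trans (n≤1+n 2) (≤-reflexive (sym (sizes i)))

  instance′ : UnfairInstance
  instance′ = record
    { n = length walk ; k = k ; ℓ = length C.representatives ; sets = C.rows walk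
    ; 2k≤n = two-thirds ; few = few-rows ; large = large-rows }

  partition : PartitionIntoTriples instance′
  partition = record
    { n≡3k = length-walk ; ℓ≡k = length-representatives ; triples = sizes ; disjoint = apart ; cover = covered }

  module _ (s : UnfairSolution instance′) where
    open UnfairSolution s

    open Image walk set

    stable⇒¬adjacent : ∀ {p q} → p ∈ set → q ∈ set → ¬ CycleAdjacent p q
    stable⇒¬adjacent {p} {q} p∈ q∈ (inj₁ (inj₁ c)) = proj₁ (stable p q p∈ q∈) c
    stable⇒¬adjacent {p} {q} p∈ q∈ (inj₁ (inj₂ c)) = proj₁ (stable q p q∈ p∈) c
    stable⇒¬adjacent {p} {q} p∈ q∈ (inj₂ (inj₁ c)) = proj₂ (stable p q p∈ q∈) c
    stable⇒¬adjacent {p} {q} p∈ q∈ (inj₂ (inj₂ c)) = proj₂ (stable q p q∈ p∈) c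

    abstract
      -- An edge joins two vertices of one chosen triangle, which the set meets at most once, or is
      -- a link, whose ends have adjacent positions.
      independent-at : ∀ {p q} → p ∈ set → q ∈ set → ¬ Graph.Edge graph (List.lookup walk p) (List.lookup walk q)
      independent-at {p} {q} p∈ q∈ e = go (together? (List.lookup walk p) (List.lookup walk q))
        where
        go : ¬ Dec (Together (List.lookup walk p) (List.lookup walk q))
        go (yes s) = Tr.edge-irrefl e (cong (List.lookup walk)
          (C.fair-unique together-sym together-trans orbit orbit-together together-orbit orbit-injective
            walk tour set unfair p∈ q∈ s))
        go (no ¬s) = stable⇒¬adjacent p∈ q∈ (Tour.adjacent tour p q (e , ¬s))

      image-independent : Graph.Independent graph image
      image-independent u v u∈ v∈ e =
        let p , p∈ , u≡ = ∈-image⁻ u∈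
            q , q∈ , v≡ = ∈-image⁻ v∈
        in independent-at p∈ q∈ (subst₂ (Graph.Edge graph) u≡ v≡ e)

      image-size : ∣ image ∣ ≡ k
      image-size = trans (∣image∣ (Tour.injective tour)) card

    solution : CPTSolution x
    solution = record { set = image ; independent = image-independent ; card = image-size }

-- Running time

lookup-dropTreeˡ : {X : Set} (enc : X → Tree) (xs : List X) (i : Fin (length xs)) →
                   head-tree (dropTree (toℕ i) (encodeList enc xs)) ≡ enc (List.lookup xs i)
lookup-dropTreeˡ enc (x ∷ xs) zero    = refl
lookup-dropTreeˡ enc (x ∷ xs) (suc i) = lookup-dropTreeˡ enc xs i

encodeVec-tabulate-lookup : {X Y Z : Set} {enc : Y → Tree} {enc′ : Z → Tree} (g : X → Y) (g′ : X → Z) →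
  (∀ x → enc (g x) ≡ enc′ (g′ x)) → ∀ xs →
  encodeList enc′ (map g′ xs) ≡ encodeVec enc (Vec.tabulate (λ i → g (List.lookup xs i)))
encodeVec-tabulate-lookup g g′ eq []       = refl
encodeVec-tabulate-lookup g g′ eq (x ∷ xs) = cong₂ cons (sym (eq x)) (encodeVec-tabulate-lookup g g′ eq xs)

encodeVec-tabulate : {X Y : Set} (enc : Y → Tree) (g : X → Y) → ∀ n (f : Fin n → X) →
  encodeList enc (map g (tabulate f)) ≡ encodeVec enc (Vec.tabulate (λ i → g (f i)))
encodeVec-tabulate enc g zero    f = refl
encodeVec-tabulate enc g (suc n) f = cong (cons (enc (g (f zero)))) (encodeVec-tabulate enc g n (f ∘ suc))

module _ {A : Set} {e : A → Tree} where

  +P : {i j : A → ℕ} → Poly e nat i → Poly e nat j → Poly e nat (λ a → i a + j a)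
  +P {i} {j} I J = recode (λ a → lemma (i a) (j a))
    (foldlP {encX = unit} {encS = tree} {xs₀ = λ a → replicate (i a) tt} (λ _ _ → cons nil) (con 2)
      (λ _ _ t → ≤-reflexive (+-comm 2 (size t)))
      (recode (λ a → encodeℕ-replicate (i a)) I) (recode (λ _ → refl) J)
      (recode (λ _ → refl) (node leaf v0)))
    where
    lemma : ∀ i j → foldl (λ t _ → cons nil t) (encodeℕ j) (replicate i tt) ≡ encodeℕ (i + j)
    lemma zero    j = refl
    lemma (suc i) j = trans (lemma i (suc j)) (cong encodeℕ (+-suc i j))

  ≟trueP : {b : A → Bool} → Poly e bool b → Poly e bool (λ a → does (b a Bool.≟ true))
  ≟trueP {b} = replace (λ a → lemma (b a))
    where
    lemma : ∀ b → b ≡ does (b Bool.≟ true)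
    lemma false = refl
    lemma true  = refl

  module _ {X : A → Set} {enc : Encoding X} {xs : ∀ a → List (X a)} (P : Poly e (list enc) xs) where

    lengthP : Poly e nat (λ a → length (xs a))
    lengthP = recode (λ a → lemma (xs a)) (mapP {encY = unit} {f = λ _ _ → tt} (recode (λ _ → refl) leaf) P)
      where
      lemma : {X : Set} (xs : List X) → encodeList (λ _ → nil) (map (λ _ → tt) xs) ≡ encodeℕ (length xs)
      lemma []       = refl
      lemma (x ∷ xs) = cong (cons nil) (lemma xs)

    lookupˡP : {i : ∀ a → Fin (length (xs a))} → Poly e fin i → Poly e enc (λ a → List.lookup (xs a) (i a))
    lookupˡP {i} I = recode (λ a → lookup-dropTreeˡ (enc a) (xs a) (i a))
      (left (dropTreeP {i = λ a → toℕ (i a)} (recode (λ _ → refl) I) (recode (λ _ → refl) P)))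

    take-1P : Poly e (list enc) (λ a → take 1 (xs a))
    take-1P = recode (λ a → lemma (enc a) (xs a)) (caseTree (recode (λ _ → refl) P) (node (left (recode (λ _ → refl) P)) leaf) leaf)
      where
      lemma : {X : Set} (enc : X → Tree) (xs : List X) →
        branch (encodeList enc xs) (cons (head-tree (encodeList enc xs)) nil) nil ≡ encodeList enc (take 1 xs)
      lemma enc []       = refl
      lemma enc (x ∷ xs) = refl

triple : {A : Set} {n : A → ℕ} → Encoding (λ a → Triple (n a))
triple a (x , y , z) = cons (encodeℕ (toℕ x)) (cons (encodeℕ (toℕ y)) (encodeℕ (toℕ z)))

module _ {A : Set} {e : A → Tree} {n : A → ℕ} where

  fstP : {r : ∀ a → Triple (n a)} → Poly e triple r → Poly e fin (λ a → proj₁ (r a))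
  fstP R = recode (λ _ → refl) (left (recode (λ _ → refl) R))

  sndP : {r : ∀ a → Triple (n a)} → Poly e triple r → Poly e fin (λ a → proj₁ (proj₂ (r a)))
  sndP R = recode (λ _ → refl) (left (right (recode (λ _ → refl) R)))

  thdP : {r : ∀ a → Triple (n a)} → Poly e triple r → Poly e fin (λ a → proj₂ (proj₂ (r a)))
  thdP R = recode (λ _ → refl) (right (right (recode (λ _ → refl) R)))

  tripleP : {u v w : ∀ a → Fin (n a)} → Poly e fin u → Poly e fin v → Poly e fin w →
            Poly e triple (λ a → u a , v a , w a)
  tripleP U V W = recode (λ _ → refl) (node U (node V W))

  ∈ₜP : {v : ∀ a → Fin (n a)} {r : ∀ a → Triple (n a)} → Poly e fin v → Poly e triple r →
        Poly e bool (λ a → does (v a ∈ₜ? r a))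
  ∈ₜP V R = orP (≟P V (fstP R)) (orP (≟P V (sndP R)) (≟P V (thdP R)))

  module _ {r s : ∀ a → Triple (n a)} (R : Poly e triple r) (S : Poly e triple s) where

    ⊆P : Poly e bool (λ a → does (r a ⊆? s a))
    ⊆P = andP (∈ₜP (fstP R) S) (andP (∈ₜP (sndP R) S) (∈ₜP (thdP R) S))

    disjointP : Poly e bool (λ a → does (disjoint? (r a) (s a)))
    disjointP = andP (notP (∈ₜP (fstP R) S)) (andP (notP (∈ₜP (sndP R) S)) (notP (∈ₜP (thdP R) S)))

  ≐P : {r s : ∀ a → Triple (n a)} → Poly e triple r → Poly e triple s →
       Poly e bool (λ a → does (r a ≐? s a))
  ≐P R S = andP (⊆P R S) (⊆P S R)

module _ {A : Set} {e : A → Tree} {n : A → ℕ} where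

  commitP : {t : ∀ a → Triple (n a)} {B : ∀ a → List (Triple (n a))} →
            Poly e triple t → Poly e (list triple) B → Poly e (list triple) (λ a → commit (t a) (B a))
  commitP {t} T B = filterP {P? = λ a r → disjoint? r (t a) ⊎-dec (r ⊆? t a)}
    (orP (disjointP v0 (wk T)) (⊆P v0 (wk T))) B

  sameP : {B : ∀ a → List (Triple (n a))} {u v : ∀ a → Fin (n a)} →
          Poly e (list triple) B → Poly e fin u → Poly e fin v →
          Poly e bool (λ a → does (same? (B a) (u a) (v a)))
  sameP {u = u} {v} B U V = anyP {P? = λ a r → (u a ∈ₜ? r) ×-dec (v a ∈ₜ? r)}
    (andP (∈ₜP (wk U) v0) (∈ₜP (wk V) v0)) B

module _ {A : Set} {e : A → Tree} {n : A → ℕ} (V : Poly e (list fin) (λ a → allFin (n a))) where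

  supportedP : {B : ∀ a → List (Triple (n a))} {s : ∀ a → Triple (n a)} →
               Poly e (list triple) B → Poly e triple s →
               Poly e bool (λ a → does (supported? (B a) (s a)))
  supportedP {B} {s} PB PS =
    allP {P? = λ a v → (v ∈ₜ? s a) ⊎-dec any? (λ r → (v ∈ₜ? r) ×-dec disjoint? r (s a)) (B a)}
      (orP (∈ₜP v0 (wk PS))
        (anyP {P? = λ (a , v) r → (v ∈ₜ? r) ×-dec disjoint? r (s a)}
          (andP (∈ₜP (wk v0) v0) (disjointP v0 (wk (wk PS)))) (wk PB))) V

module _ {A : Set} {e : A → Tree} {n : A → ℕ} (V : Poly e (list fin) (λ a → allFin (n a))) where

  pruneP : {B : ∀ a → List (Triple (n a))} → Poly e (list triple) B →
           Poly e (list triple) (λ a → prune (B a))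
  pruneP {B} PB = filterP {P? = λ a → supported? (B a)} (supportedP (wk V) (wk PB) v0) PB

-- Filters only shrink the list of candidates, so the folds of the search run with growth 0.
size-prune : ∀ {A : Set} {n : A → ℕ} (a : A) (B : List (Triple (n a))) →
             size (list (triple {n = n}) a (prune B)) ≤ size (list (triple {n = n}) a B)
size-prune {n = n} a B = size-filter (triple {n = n} a) (supported? B) B

size-propagate : ∀ {A : Set} {n : A → ℕ} (a : A) (B : List (Triple (n a))) →
                 size (list (triple {n = n}) a (propagate B)) ≤ size (list (triple {n = n}) a B)
size-propagate {n = n} a B = go B B
  where
  go : ∀ (xs B : List (Triple (n a))) →
       size (list (triple {n = n}) a (foldl (λ B _ → prune B) B xs)) ≤ size (list (triple {n = n}) a B)
  go []       B = ≤-refl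
  go (_ ∷ xs) B = ≤-trans (go xs (prune B)) (size-prune {n = n} a B)

size-attempt : ∀ {A : Set} {n : A → ℕ} (a : A) (B : List (Triple (n a))) (t : Triple (n a)) →
               size (list (triple {n = n}) a (attempt B t)) ≤ size (list (triple {n = n}) a B)
size-attempt {n = n} a B t with does (any? (_≐? t) (propagate (commit t B)))
... | true  = ≤-trans (size-propagate {n = n} a (commit t B))
                (size-filter (triple {n = n} a) (λ r → disjoint? r t ⊎-dec (r ⊆? t)) B)
... | false = ≤-refl

module _ {A : Set} {e : A → Tree} {n : A → ℕ} (V : Poly e (list fin) (λ a → allFin (n a))) where

  propagateP : {B : ∀ a → List (Triple (n a))} → Poly e (list triple) B →
               Poly e (list triple) (λ a → propagate (B a))
  propagateP {B} PB = foldlP (λ _ _ → prune) (con 0)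
    (λ a _ B → ≤-trans (size-prune {n = n} a B) (m≤m+n _ 0)) PB PB (pruneP (wk (wk V)) v0)

module _ {A : Set} {e : A → Tree} {n : A → ℕ} (V : Poly e (list fin) (λ a → allFin (n a))) where

  attemptP : {B : ∀ a → List (Triple (n a))} {t : ∀ a → Triple (n a)} →
             Poly e (list triple) B → Poly e triple t → Poly e (list triple) (λ a → attempt (B a) (t a))
  attemptP {B} {t} PB T = ifP (anyP {P? = λ a r → r ≐? t a} (≐P v0 (wk T)) next) next PB
    where
    next : Poly e (list triple) (λ a → propagate (commit (t a) (B a)))
    next = propagateP V (commitP T PB)

  triplesP : Poly e (list triple) (λ a → triples (n a))
  triplesP = concatMapP (concatMapP (mapP (tripleP (wk (wk v0)) (wk v0) v0) (wk (wk V))) (wk V)) V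

module _ {A : Set} {e : A → Tree} {n : A → ℕ} {adj : ∀ a → Fin (n a) → Fin (n a) → Bool}
         (M : Poly e (vec (vec bool)) (λ a → Vec.tabulate λ u → Vec.tabulate λ v → adj a u v)) where

  edgeP : {u v : ∀ a → Fin (n a)} → Poly e fin u → Poly e fin v →
          Poly e bool (λ a → does (Search.edge? (adj a) (u a) (v a)))
  edgeP {u} {v} U V = ≟trueP (replace
    (λ a → trans (cong (λ row → Vec.lookup row (v a)) (lookup∘tabulate (λ u → Vec.tabulate (adj a u)) (u a)))
                 (lookup∘tabulate (adj a (u a)) (v a)))
    (lookupP (lookupP M U) V))

module _ {A : Set} {e : A → Tree} {n : A → ℕ} {adj : ∀ a → Fin (n a) → Fin (n a) → Bool}
         (M : Poly e (vec (vec bool)) (λ a → Vec.tabulate λ u → Vec.tabulate λ v → adj a u v))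
         (V : Poly e (list fin) (λ a → allFin (n a))) where

  trianglesP : Poly e (list triple) (λ a → Search.triangles (adj a))
  trianglesP = filterP {P? = λ a → Search.triangle? (adj a)}
    (andP (edgeP (wk M) (fstP v0) (sndP v0)) (andP (edgeP (wk M) (sndP v0) (thdP v0)) (edgeP (wk M) (fstP v0) (thdP v0))))
    (triplesP V)

  chosenP : Poly e (list triple) (λ a → Search.chosen (adj a))
  chosenP = foldlP (λ _ t B → attempt B t) (con 0)
    (λ a t B → ≤-trans (size-attempt {n = n} a B t) (m≤m+n _ 0)) trianglesP trianglesP
    (attemptP (wk (wk V)) v0 (wk v0))

module _ {A : Set} {e : A → Tree} {n : A → ℕ} {Link : ∀ a → Fin (n a) → Fin (n a) → Set}
         {link? : ∀ a u v → Dec (Link a u v)} (V : Poly e (list fin) (λ a → allFin (n a))) where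

  nextP : {vs : ∀ a → List (Fin (n a))} {u : ∀ a → Fin (n a)} →
          Poly ((e ▹ fin) ▹ fin) bool (λ ((a , u) , v) → does (link? a u v)) →
          Poly e (list fin) vs → Poly e fin u →
          Poly e bool (λ a → does (Walking.next? (Link a) (link? a) (vs a) (u a)))
  nextP {vs} {u} L VS U = andP
    (allP {P? = λ a c → link? a c (u a)} (push (wk U) then L) (take-1P VS))
    (notP (anyP {P? = λ a → u a Fin.≟_} (≟P (wk U) v0) VS))

module _ {A : Set} {e : A → Tree} {n : A → ℕ} {Link : ∀ a → Fin (n a) → Fin (n a) → Set}
         {link? : ∀ a u v → Dec (Link a u v)} (V : Poly e (list fin) (λ a → allFin (n a))) where

  -- A round adds at most one vertex, taken from the list of all vertices; the size of that list,
  -- and so `bound V`, bounds the growth.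
  walkP : Poly ((e ▹ fin) ▹ fin) bool (λ ((a , u) , v) → does (link? a u v)) →
          Poly e (list fin) (λ a → Walking.walk (Link a) (link? a))
  walkP L = foldlP (λ a _ → Walking.grow (Link a) (link? a)) (bound V ∘ₚ var) grows V []P growP
    where
    extend : ∀ {a} → List (Fin (n a)) → List (Fin (n a)) → List (Fin (n a))
    extend {a} = Walking.extend (Link a) (link? a)
    size-extend : ∀ {a} us vs → size (list (fin {n = n}) a (extend {a} us vs)) ≤
                                size (list (fin {n = n}) a vs) + size (list (fin {n = n}) a us)
    size-extend []       vs = m≤m+n _ _
    size-extend {a} (u ∷ us) vs = ≤-trans (≤-reflexive (+-comm (suc (size (fin {n = n} a u))) _))
      (+-monoʳ-≤ (size (list (fin {n = n}) a vs)) (s≤s (m≤m+n _ _)))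
    grows : ∀ a v vs → size (list (fin {n = n}) a (Walking.grow (Link a) (link? a) vs)) ≤
                       size (list (fin {n = n}) a vs) + eval (bound V ∘ₚ var) (size ((e ▹ fin {n = n}) (a , v)))
    grows a v vs = ≤-trans (size-extend {a} (filter (Walking.next? (Link a) (link? a) vs) (allFin (n a))) vs)
      (+-monoʳ-≤ (size (list (fin {n = n}) a vs))
        (≤-trans (size-filter (fin {n = n} a) (Walking.next? (Link a) (link? a) vs) (allFin (n a)))
          (≤-trans (size≤ V a) (eval-at-≤ (bound V) var (m≤n⇒m≤1+n (m≤m+n (size (e a)) _))))))
    -- The link test lives in a context with two vertices; the loop variables in between are
    -- forgotten.
    shift : Poly (((((e ▹ fin) ▹ list (fin {n = λ p → n (proj₁ p)})) ▹ fin) ▹ fin) ▹ fin) (λ _ → (e ▹ fin) ▹ fin)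
      (λ (((((a , _) , _) , _) , u) , v) → ((a , u) , v))
    shift = recode (λ _ → refl)
      (node (node (left (left (left (left (left environment))))) (right (left environment))) (right environment))
    extendP : {B : Set} {e : B → Tree} {n : B → ℕ} {Link : ∀ a → Fin (n a) → Fin (n a) → Set}
      {link? : ∀ a u v → Dec (Link a u v)} {us vs : ∀ b → List (Fin (n b))} →
      Poly e (list fin) us → Poly e (list fin) vs →
      Poly e (list fin) (λ b → Walking.extend (Link b) (link? b) (us b) (vs b))
    extendP {n = n} {Link} {link?} {us} {vs} US VS = recode (λ b → lemma b (us b) (vs b))
      (caseTree (recode (λ _ → refl) US) (node (left (recode (λ _ → refl) US)) VS) (recode (λ _ → refl) VS))
      where
      lemma : ∀ b us vs → branch (list (fin {n = n}) b us)
                (cons (head-tree (list (fin {n = n}) b us)) (list (fin {n = n}) b vs)) (list (fin {n = n}) b vs)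
              ≡ list (fin {n = n}) b (Walking.extend (Link b) (link? b) us vs)
      lemma b []       vs = refl
      lemma b (u ∷ us) vs = refl
    growP : Poly ((e ▹ fin) ▹ λ p → list (fin {n = n}) (proj₁ p)) (λ p → list (fin {n = n}) (proj₁ (proj₁ p)))
              (λ ((a , _) , vs) → Walking.grow (Link a) (link? a) vs)
    growP = extendP {link? = λ ((a , _) , _) → link? a}
      (filterP {P? = λ ((a , _) , vs) → Walking.next? (Link a) (link? a) vs}
        (nextP {link? = λ (((a , _) , _) , _) → link? a} (wk (wk (wk V))) (shift then L) (wk v0) v0)
        (wk (wk V))) v0

module _ {A : Set} {e : A → Tree} {n : A → ℕ} {Same : ∀ a → Fin (n a) → Fin (n a) → Set}
         {same? : ∀ a u v → Dec (Same a u v)}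
         (S : Poly ((e ▹ fin) ▹ fin) bool (λ ((a , u) , v) → does (same? a u v)))
         (V : Poly e (list fin) (λ a → allFin (n a))) where

  representativesP : Poly e (list fin) (λ a → Classes.representatives (Same a) (same? a))
  representativesP = filterP {P? = λ a → Classes.representative? (Same a) (same? a)}
    (allP {P? = λ (a , v) u → ¬? (same? a u v) ⊎-dec (toℕ v ≤? toℕ u)}
      (orP (notP (swapped then S)) (≤P (toℕP (wk v0)) (toℕP v0))) (wk V)) V
    where
    toℕP : {B : Set} {e : B → Tree} {n : B → ℕ} {u : ∀ b → Fin (n b)} → Poly e fin u → Poly e nat (λ b → toℕ (u b))
    toℕP = recode (λ _ → refl)
    swapped : Poly ((e ▹ fin) ▹ λ p → fin {n = n} (proj₁ p)) (λ _ → (e ▹ fin) ▹ fin) (λ ((a , v) , u) → ((a , u) , v))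
    swapped = recode (λ _ → refl) (node (node (left (left environment)) (right environment)) (right (left environment)))

  rowsP : {vs : ∀ a → List (Fin (n a))} → Poly e (list fin) vs →
          Poly e (vec (vec bool)) (λ a → Classes.rows (Same a) (same? a) (vs a))
  rowsP {vs} VS = recode
    (λ a → encodeVec-tabulate-lookup (Classes.row (Same a) (same? a) (vs a))
             (λ v → map (λ u → does (same? a v u)) (vs a))
             (λ v → sym (encodeVec-tabulate-lookup (λ u → does (same? a v u)) (λ u → does (same? a v u)) (λ _ → refl) (vs a)))
             (Classes.representatives (Same a) (same? a)))
    (mapP (mapP S (wk VS)) representativesP)

module _ {A : Set} {e : A → Tree} {n : A → ℕ} {vs : ∀ a → List (Fin (n a))}
         {S : ∀ a → Vec Bool (length (vs a))} (VS : Poly e (list fin) vs) (PS : Poly e (vec bool) S)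
         (V : Poly e (list fin) (λ a → allFin (n a))) where

  imageP : Poly e (vec bool) (λ a → Image.image (vs a) (S a))
  imageP = recode (λ a → encodeVec-tabulate encodeBool (does ∘ Image.hit? (vs a) (S a)) (n a) id)
    (mapP {f = λ a u → does (Image.hit? (vs a) (S a) u)}
      (anyP {P? = λ (a , u) p → (Vec.lookup (S a) p Bool.≟ true) ×-dec (u Fin.≟ List.lookup (vs a) p)}
        (andP (≟trueP (lookupP (wk (wk PS)) v0)) (≟P (wk v0) (lookupˡP (wk (wk VS)) v0)))
        (wk (allFinP (lengthP VS)))) V)

-- Any context from which the encoded instance can be computed will do, so both programs of the
-- reduction are instances. The second one computes the walk anew, because a solution consists of
-- positions only.
module Compute {A : Set} {e : A → Tree} {x : A → CPTInstance}
               (I : Poly e tree (λ a → SearchProblem.encodeInstance CyclePlusTriangles (x a))) where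

  private
    n : A → ℕ
    n a = 3 * CPTInstance.k (x a)

  kP : Poly e nat (λ a → CPTInstance.k (x a))
  kP = recode (λ _ → refl) (left I)

  matrixP : Poly e (vec (vec bool)) (λ a → Vec.tabulate λ u → Vec.tabulate λ v → Route.adj (x a) u v)
  matrixP = recode (λ _ → refl) (right I)

  verticesP : Poly e (list fin) (λ a → allFin (n a))
  -- `3 * k` unfolds to `k + (k + (k + 0))`.
  verticesP = allFinP (+P kP (+P kP (+P kP (recode {f = λ _ → nil} {g = λ _ → 0} (λ _ → refl) leaf))))

  pickedP : Poly e (list triple) (λ a → Search.chosen (Route.adj (x a)))
  pickedP = chosenP matrixP verticesP

  togetherP : Poly ((e ▹ fin) ▹ fin) bool (λ ((a , u) , v) → does (Route.together? (x a) u v))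
  togetherP = sameP (wk (wk pickedP)) (wk v0) v0

  routeP : Poly e (list fin) (λ a → Route.walk (x a))
  routeP = walkP {link? = λ a → Search.link? (Route.adj (x a))} verticesP
    (andP (edgeP (wk (wk matrixP)) (wk v0) v0) (notP togetherP))

  instanceP : Poly e tree (λ a → SearchProblem.encodeInstance UnfairIndependentSetInCycle (Route.instance′ (x a)))
  instanceP = recode (λ _ → refl)
    (node (lengthP routeP) (node kP (rowsP {same? = λ a → Route.together? (x a)} togetherP verticesP routeP)))

proposition4p1 : PolyTimeReducible CyclePlusTriangles (restrict UnfairIndependentSetInCycle PartitionIntoTriples)
proposition4p1 = record
  { mapInstance     = λ x → Route.instance′ x , Route.partition x
  ; mapSolution     = Route.solution
  ; mapInstancePoly = toPolyTime (Compute.instanceP {x = λ x → x} environment)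
  ; mapSolutionPoly = toPolyTime (imageP (Compute.routeP {x = proj₁} given) (recode (λ _ → refl) (right environment))
                                    (Compute.verticesP {x = proj₁} given))
  }
  where
  given : Poly {Σ[ x ∈ CPTInstance ] UnfairSolution (Route.instance′ x)}
            (λ (x , s) → cons (SearchProblem.encodeInstance CyclePlusTriangles x) (encodeSubset (UnfairSolution.set s)))
            tree (λ (x , s) → SearchProblem.encodeInstance CyclePlusTriangles x)
  given = left environment
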